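{- Let $m$ and $n$ be positive integers and put $\kappa:=m+n$. For $r\ge1$ let $(m^r)$ denote the partition with $r$ parts all equal to $m$. Then, as formal power series in $q$ (coefficientwise limit), \[ \lim_{r\to\infty} q^{ -m\binom{r}{2}} P_{(m^r)}\big(1,q,q^2,\dots;q^n\big) =\frac{(q^{\kappa};q^{\kappa})_{\infty}^{n-1}}{(q;q)_{\infty}^n}\prod_{1\leq i<j\leq n}\theta\big(q^{j-i};q^{\kappa}\big) =\frac{(q^{\kappa};q^{\kappa})_{\infty}^{m-1}}{(q;q)_{\infty}^m}\prod_{1\leq i<j\leq m}\theta\big(q^{j-i};q^{\kappa}\big). \]
   Context: For $k\ge0$, $(a;q)_k=\prod_{j=0}^{k-1}(1-aq^j)$ and $(a;q)_\infty=\prod_{j\ge0}(1-aq^j)$; $\theta(a;q):=(a;q)_\infty(q/a;q)_\infty$. Hall–Littlewood polynomials: for variables $x=(x_1,\dots,x_N)$, a parameter $t$ and a partition $\lambda$ with at most $N$ nonzero parts, let $m_i$ be the number of parts of $\lambda$ equal to $i$ ($m_0:=N-$ number of nonzero parts), $v_\lambda(t)=\prod_{i\ge0}(t;t)_{m_i}/(1-t)^{m_i}$, and $P_\lambda(x;t)=\frac{1}{v_\lambda(t)}\sum_{w\in\mathfrak S_N} w\Big(x_1^{\lambda_1}\cdots x_N^{\lambda_N}\prod_{i<j}\frac{x_i-tx_j}{x_i-x_j}\Big)$, where $\mathfrak S_N$ permutes the variables; $P_\lambda:=0$ if $\lambda$ has more than $N$ nonzero parts. These define Hall–Littlewood symmetric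 functions in infinitely many variables; $P_\lambda(1,q,q^2,\dots;t)$ denotes the specialization $x_i=q^{i-1}$ ($i\ge1$), i.e. the $N\to\infty$ limit of $P_\lambda(1,q,\dots,q^{N-1};t)$ as a formal power series in $q$. Here $t=q^n$. -}

module Defs where

open import Data.Nat as ℕ using (ℕ; zero; suc; _∸_; _⊔_; _<ᵇ_; _≤ᵇ_; _≡ᵇ_)
open import Data.Integer as ℤ using (ℤ; +_; -[1+_])
open import Data.List using (List; []; _∷_; map; upTo; foldr; replicate; length; _++_; concatMap; zipWith)
open import Data.Nat.ListAction using (sum)
open import Data.Product using (_×_; _,_)
open import Data.Bool using (Bool; true; false; if_then_else_)

-- Formal power series in q over ℤ, as coefficient functions.

PS : Set
PS = ℕ → ℤ

sumℤ : List ℤ → ℤ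
sumℤ = foldr ℤ._+_ (+ 0)

infixl 6 _⊕_ _⊖_
infixl 7 _⊗_

zeroPS : PS
zeroPS _ = + 0

mono : ℕ → PS
mono e k = if e ≡ᵇ k then + 1 else + 0

onePS : PS
onePS = mono 0

_⊕_ : PS → PS → PS
(f ⊕ g) k = f k ℤ.+ g k

_⊖_ : PS → PS → PS
(f ⊖ g) k = f k ℤ.- g k

_⊗_ : PS → PS → PS
(f ⊗ g) k = sumℤ (map (λ i → f i ℤ.* g (k ∸ i)) (upTo (suc k)))

sumPS : List PS → PS
sumPS = foldr _⊕_ zeroPS

prodPS : List PS → PS
prodPS = foldr _⊗_ onePS

powPS : PS → ℕ → PS
powPS f k = prodPS (replicate k f)

-- Multiplicative inverse of a power series with constant term 1:
-- b₀ = 1, b_k = - Σ_{i=1}^{k} f_i b_{k-i}.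
-- invUpTo f k = [b_k , b_{k-1} , … , b_0].
invUpTo : PS → ℕ → List ℤ
invUpTo f zero = + 1 ∷ []
invUpTo f (suc k) =
  let bs = invUpTo f k in
  ℤ.- sumℤ (zipWith ℤ._*_ (map (λ i → f (suc i)) (upTo (suc k))) bs) ∷ bs

headℤ : List ℤ → ℤ
headℤ [] = + 0
headℤ (x ∷ _) = x

inv : PS → PS
inv f k = headℤ (invUpTo f k)

coeffℤ : PS → ℤ → ℤ
coeffℤ f (+ d) = f d
coeffℤ f -[1+ _ ] = + 0

-- coefficient of q^k (k ∈ ℤ) of the Laurent series q^{-s} · f
shiftCoeff : ℕ → PS → ℤ → ℤ
shiftCoeff s f k = coeffℤ f (k ℤ.+ + s)

pairs : {A : Set} → List A → List (A × A)
pairs [] = []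
pairs (x ∷ xs) = map (λ y → (x , y)) xs ++ pairs xs

insertAll : {A : Set} → A → List A → List (List A)
insertAll x [] = (x ∷ []) ∷ []
insertAll x (y ∷ ys) = (x ∷ y ∷ ys) ∷ map (y ∷_) (insertAll x ys)

perms : {A : Set} → List A → List (List A)
perms [] = [] ∷ []
perms (x ∷ xs) = concatMap (insertAll x) (perms xs)

count : ℕ → List ℕ → ℕ
count i [] = 0
count i (x ∷ xs) = (if x ≡ᵇ i then 1 else 0) ℕ.+ count i xs

maxPart : List ℕ → ℕ
maxPart = foldr _⊔_ 0

tPoch : ℕ → ℕ → PS
tPoch n m = prodPS (map (λ j → onePS ⊖ mono (n ℕ.* suc j)) (upTo m))

oneMinusTPow : ℕ → ℕ → PS
oneMinusTPow n m = powPS (onePS ⊖ mono n) m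

-- padded partition (λ₁,…,λ_N) (assumes length λ ≤ N)
pad : ℕ → List ℕ → List ℕ
pad N lam = lam ++ replicate (N ∸ length lam) 0

-- v_λ(t) = ∏_{i ≥ 0} (t;t)_{m_i} / (1-t)^{m_i}, for the padded λ of length N
vLam : ℕ → List ℕ → PS
vLam n lamN =
  prodPS (map (λ i → tPoch n (count i lamN) ⊗ inv (oneMinusTPow n (count i lamN)))
              (upTo (suc (maxPart lamN))))

-- The rational function (x_i - t x_j)/(x_i - x_j) at x_i = q^a, x_j = q^b,
-- t = q^n (a ≠ b), expanded as a power series in q:
--   a < b :  (q^a - q^{b+n})/(q^a - q^b) = (1 - q^{b+n-a}) / (1 - q^{b-a})
--   a > b :  (q^a - q^{b+n})/(q^a - q^b) = (q^n - q^{a-b}) / (1 - q^{a-b})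
ratio : ℕ → ℕ → ℕ → PS
ratio n a b =
  if a <ᵇ b
  then (onePS ⊖ mono ((b ℕ.+ n) ∸ a)) ⊗ inv (onePS ⊖ mono (b ∸ a))
  else (mono n ⊖ mono (a ∸ b)) ⊗ inv (onePS ⊖ mono (a ∸ b))

-- the term w( x^λ ∏_{i<j} (x_i - t x_j)/(x_i - x_j) ) at x_i = q^{i-1},
-- where e = (w(1)-1, …, w(N)-1) encodes the permutation w.
hlTerm : ℕ → List ℕ → List ℕ → PS
hlTerm n lamN e =
  mono (sum (zipWith ℕ._*_ lamN e)) ⊗
  prodPS (map (λ { (a , b) → ratio n a b }) (pairs e))

-- P_λ(1, q, …, q^{N-1}; q^n) as a power series in q
-- (zero if λ has more than N parts).
hlP : List ℕ → ℕ → ℕ → PS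
hlP lam N n =
  if length lam ≤ᵇ N
  then inv (vLam n (pad N lam)) ⊗
       sumPS (map (hlTerm n (pad N lam)) (perms (upTo N)))
  else zeroPS

-- (q^c ; q^d)_∞ = ∏_{j ≥ 0} (1 - q^{c + d j}), for c, d ≥ 1.
-- Its coefficient of q^k only involves factors with c + d j ≤ k, so it
-- equals the coefficient of q^k of the finite product over j ≤ k.
qPochInf : ℕ → ℕ → PS
qPochInf c d k =
  prodPS (map (λ j → onePS ⊖ mono (c ℕ.+ d ℕ.* j)) (upTo (suc k))) k

-- θ(q^c ; q^κ) = (q^c ; q^κ)_∞ (q^{κ-c} ; q^κ)_∞   (for 1 ≤ c < κ)
theta : ℕ → ℕ → PS
theta c κ = qPochInf c κ ⊗ qPochInf (κ ∸ c) κ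

rhsSeries : ℕ → ℕ → PS
rhsSeries κ a =
  powPS (qPochInf κ κ) (a ∸ 1) ⊗
  inv (powPS (qPochInf 1 1) a) ⊗
  prodPS (map (λ { (i , j) → theta (j ∸ i) κ }) (pairs (map suc (upTo a))))

{-# OPTIONS --safe #-}
module Submission where

-- Write κ = m + n.  Symmetrization turns P_{(mʳ)}(1, q, q², …; t), t = qⁿ, into a
-- sum over r-subsets I of q^{m ∑ I} ∏ (qⁱ - t qʲ) / (qⁱ - qʲ), i ∈ I, j ∉ I.  A term
-- vanishes unless I is closed under subtraction of n, so I consists of the
-- first c_a members of the residue class of a for each a < n, with ∑ c_a = r.
-- The product then telescopes to a signed monomial times the Vandermonde
-- product of the q^{a + n c_a}, divided by factors that tend to (q; q)_∞ⁿ.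
--
-- The same sum with step κ instead of n, over the points a + κ c with a < n and
-- without the weight, equals 1 / (q^κ; q^κ)_r by Lagrange interpolation; this is
-- Macdonald's identity for A_{n-1}^{(1)}, and its denominators tend to the
-- theta product.  Expanding the Vandermonde products, the two numerators become
-- the coefficients of zʳ in the determinants of the matrix with entries
-- ∑_c z^c q^{nκ c(c-1)/2 + κ a c + n b c + a b} and of its transpose.
--
-- The product side is symmetric in m and n because the factors
-- (q^{a-b mod κ}; q^κ)_∞ over each full row or column a, b < κ multiply to (q; q)_∞.

-- For each `r` the two sums are written as numerator over denominator. Neither numerator is
-- evaluated in the limit: the two agree exactly up to the power of `q` with exponent
-- `m r (r - 1) / 2`, so only denominators have to converge. That exponent is the difference of the
-- monomials cleared for step `κ` and for step `n`, and it is also a lower bound for the order of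
-- every weight in the first sum. The unweighted sum is explicit because, over any `N` distinct
-- points, it is the `t`-binomial coefficient `(t;t)_N / ((t;t)_r (t;t)_(N-r))`. The obstacle is
-- that denominators do not converge uniformly: a composition of a large `r` may contain short
-- chains. In that case some other chain is long, and its last entry exceeds the next point of a
-- short chain by so much that the term is divisible by a high power of `q`. Since `qˣ - qʸ` is not
-- invertible as a power series, the quotients `qˣ / (qˣ - qʸ)` are the primitive objects, and
-- identities between them are proved by cancelling differences.

open import Defs
open import Algebra.Bundles using (CommutativeRing; RawRing)
open import Algebra.Morphism.Structures using (IsRingMonomorphism)
import Algebra.Morphism.RingMonomorphism
import Algebra.Properties.AbelianGroup
import Algebra.Properties.CommutativeSemigroup as Interchange
import Algebra.Properties.Ring
import Algebra.Properties.Semiring.Exp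
import Algebra.Properties.Semiring.Mult
import Algebra.Solver.Ring
open import Algebra.Solver.Ring.AlmostCommutativeRing
  using (fromCommutativeRing; _-Raw-AlmostCommutative⟶_)
open import Data.Bool using (true; false; if_then_else_; T)
open import Data.Empty using (⊥-elim)
open import Data.Integer as ℤ using (ℤ)
import Data.Integer.Properties as ℤ
open import Data.List
  using (List; []; _∷_; _++_; map; concatMap; foldr; length; upTo; downFrom; applyUpTo; zipWith; replicate)
open import Data.List.Membership.Propositional using (_∈_)
open import Data.List.Membership.Propositional.Properties using (∈-++⁺ʳ; ∈-downFrom⁻; ∈-upTo⁻)
import Data.List.Properties as List
open import Data.List.Relation.Binary.Permutation.Propositional
  using (_↭_; ↭-refl; ↭-sym; ↭-trans; ↭-reflexive; prep; swap; refl; trans; ↭⇒↭ₛ)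
open import Data.List.Relation.Binary.Permutation.Propositional.Properties
  using (shift; ↭-length; ++⁺; ++⁺ˡ; ++⁺ʳ; ++-comm; All-resp-↭; map⁺; ↭-reverse)
import Data.List.Relation.Binary.Permutation.Setoid.Properties as Setoid↭
open import Data.List.Relation.Unary.All as All using (All; []; _∷_)
import Data.List.Relation.Unary.All.Properties as All
open import Data.List.Relation.Unary.AllPairs using (AllPairs; []; _∷_)
open import Data.List.Relation.Unary.Any using (here; there)
open import Data.List.Relation.Unary.Unique.Propositional using (Unique)
import Data.List.Relation.Unary.Unique.Propositional.Properties as Unique
open import Data.Maybe using (Maybe; just; nothing)
open import Data.Nat as ℕ using (ℕ; zero; suc; _∸_; z≤n; s≤s)
open import Data.Nat.Combinatorics using (_C_; nC1≡n; nCk+nC[k+1]≡[n+1]C[k+1])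
open import Data.Nat.DivMod
  using (_/_; _%_; [m+kn]%n≡m%n; m<n⇒m%n≡m; m≡m%n+[m/n]*n; m%n≤n; /-monoˡ-≤; m*n/n≡m)
open import Data.Nat.ListAction using (sum)
import Data.Nat.Properties as ℕ
open import Data.Nat.Solver using (module +-*-Solver)
open import Data.Product using (_×_; _,_; proj₁; proj₂; ∃-syntax)
open import Data.Sum using (_⊎_; inj₁; inj₂)
open import Function using (_∘_; id; flip)
open import Level using (Level; 0ℓ; _⊔_)
import Relation.Binary.Reasoning.Setoid
open import Relation.Binary.Definitions using (tri<; tri≈; tri>)
open import Relation.Binary.PropositionalEquality as ≡ using (_≡_; _≢_)
open import Relation.Nullary using (yes; no)

-- The library's solver with coefficients in ℤ, represented by reduced formal
-- differences (a , 0) or (0 , b), so that every integer has a unique normal form.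
module RingSolver {c ℓ} (R : CommutativeRing c ℓ) where
  open CommutativeRing R
    hiding (zero) renaming (refl to ≈-refl; sym to ≈-sym; trans to ≈-trans)
  open Algebra.Properties.Ring ring
  open Algebra.Properties.AbelianGroup +-abelianGroup using (⁻¹-∙-comm)
  open Algebra.Properties.Semiring.Mult semiring
    using (×-homo-+; ×1-homo-*) renaming (_×_ to _×′_)
  open Relation.Binary.Reasoning.Setoid setoid

  +-interchange : ∀ w x y z → (w + x) + (y + z) ≈ (w + y) + (x + z)
  +-interchange = Interchange.interchange +-commutativeSemigroup

  *-interchange : ∀ w x y z → (w * x) * (y * z) ≈ (w * y) * (x * z)
  *-interchange = Interchange.interchange *-commutativeSemigroup

  private
    reduce : ℕ × ℕ → ℕ × ℕ
    reduce (suc a , suc b) = reduce (a , b)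
    reduce (a , b) = a , b

    differences : RawRing 0ℓ 0ℓ
    differences = record
      { Carrier = ℕ × ℕ
      ; _≈_ = _≡_
      ; _+_ = λ (a , b) (c , d) → reduce (a ℕ.+ c , b ℕ.+ d)
      ; _*_ = λ (a , b) (c , d) → reduce (a ℕ.* c ℕ.+ b ℕ.* d , a ℕ.* d ℕ.+ b ℕ.* c)
      ; -_ = λ (a , b) → b , a
      ; 0# = 0 , 0
      ; 1# = 1 , 0
      }

    ι : ℕ → Carrier
    ι n = n ×′ 1#

    ⟦_⟧ : ℕ × ℕ → Carrier
    ⟦ a , b ⟧ = ι a - ι b

    ⟦reduce⟧ : ∀ x → ⟦ reduce x ⟧ ≈ ⟦ x ⟧
    ⟦reduce⟧ (zero , b) = ≈-refl
    ⟦reduce⟧ (suc a , zero) = ≈-refl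
    ⟦reduce⟧ (suc a , suc b) = begin
      ⟦ reduce (a , b) ⟧               ≈⟨ ⟦reduce⟧ (a , b) ⟩
      ι a - ι b                        ≈⟨ +-identityˡ _ ⟨
      0# + (ι a - ι b)                 ≈⟨ +-congʳ (-‿inverseʳ 1#) ⟨
      (1# - 1#) + (ι a - ι b)          ≈⟨ +-interchange _ _ _ _ ⟩
      (1# + ι a) + (- 1# - ι b)        ≈⟨ +-congˡ (⁻¹-∙-comm _ _) ⟩
      (1# + ι a) - (1# + ι b)          ∎

    homo-+ : ∀ x y → ⟦ RawRing._+_ differences x y ⟧ ≈ ⟦ x ⟧ + ⟦ y ⟧
    homo-+ (a , b) (c , d) = begin
      ⟦ reduce (a ℕ.+ c , b ℕ.+ d) ⟧    ≈⟨ ⟦reduce⟧ (a ℕ.+ c , b ℕ.+ d) ⟩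
      ι (a ℕ.+ c) - ι (b ℕ.+ d)         ≈⟨ +-cong (×-homo-+ 1# a c) (-‿cong (×-homo-+ 1# b d)) ⟩
      (ι a + ι c) - (ι b + ι d)         ≈⟨ +-congˡ (⁻¹-∙-comm (ι b) (ι d)) ⟨
      (ι a + ι c) + (- ι b + - ι d)     ≈⟨ +-interchange _ _ _ _ ⟩
      (ι a - ι b) + (ι c - ι d)         ∎

    homo-* : ∀ x y → ⟦ RawRing._*_ differences x y ⟧ ≈ ⟦ x ⟧ * ⟦ y ⟧
    homo-* (a , b) (c , d) = ≈-sym (begin
      (ι a - ι b) * (ι c - ι d)
        ≈⟨ distribʳ _ _ _ ⟩
      ι a * (ι c - ι d) + - ι b * (ι c - ι d)
        ≈⟨ +-cong (distribˡ _ _ _) (distribˡ _ _ _) ⟩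
      (ι a * ι c + ι a * - ι d) + (- ι b * ι c + - ι b * - ι d)
        ≈⟨ +-congˡ (+-comm _ _) ⟩
      (ι a * ι c + ι a * - ι d) + (- ι b * - ι d + - ι b * ι c)
        ≈⟨ +-interchange _ _ _ _ ⟩
      (ι a * ι c + - ι b * - ι d) + (ι a * - ι d + - ι b * ι c)
        ≈⟨ +-cong
             (+-cong (≈-sym (×1-homo-* a c))
               (≈-trans (≈-sym (-‿distribˡ-* _ _))
                 (≈-trans (-‿cong (≈-sym (-‿distribʳ-* _ _)))
                   (≈-trans (-‿involutive _) (≈-sym (×1-homo-* b d))))))
             (≈-trans (+-cong (≈-sym (-‿distribʳ-* _ _)) (≈-sym (-‿distribˡ-* _ _)))
               (≈-trans (⁻¹-∙-comm _ _)
                 (-‿cong (+-cong (≈-sym (×1-homo-* a d)) (≈-sym (×1-homo-* b c)))))) ⟩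
      (ι (a ℕ.* c) + ι (b ℕ.* d)) - (ι (a ℕ.* d) + ι (b ℕ.* c))
        ≈⟨ +-cong (×-homo-+ 1# (a ℕ.* c) _) (-‿cong (×-homo-+ 1# (a ℕ.* d) _)) ⟨
      ι (a ℕ.* c ℕ.+ b ℕ.* d) - ι (a ℕ.* d ℕ.+ b ℕ.* c)
        ≈⟨ ⟦reduce⟧ (a ℕ.* c ℕ.+ b ℕ.* d , a ℕ.* d ℕ.+ b ℕ.* c) ⟨
      ⟦ reduce (a ℕ.* c ℕ.+ b ℕ.* d , a ℕ.* d ℕ.+ b ℕ.* c) ⟧ ∎)

    homo-neg : ∀ x → ⟦ RawRing.-_ differences x ⟧ ≈ - ⟦ x ⟧
    homo-neg (a , b) = begin
      ι b - ι a       ≈⟨ +-comm _ _ ⟩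
      - ι a + ι b     ≈⟨ +-congˡ (-‿involutive _) ⟨
      - ι a + - - ι b ≈⟨ ⁻¹-∙-comm _ _ ⟩
      - (ι a - ι b)   ∎

    -- Agrees with ⟦_⟧, but makes the constants of a goal literally 0# and 1#.
    ⟦_⟧₀₁ : ℕ × ℕ → Carrier
    ⟦ 0 , 0 ⟧₀₁ = 0#
    ⟦ 1 , 0 ⟧₀₁ = 1#
    ⟦ x ⟧₀₁ = ⟦ x ⟧

    ⟦⟧₀₁≈⟦⟧ : ∀ x → ⟦ x ⟧₀₁ ≈ ⟦ x ⟧
    ⟦⟧₀₁≈⟦⟧ (0 , 0) = ≈-sym (-‿inverseʳ 0#)
    ⟦⟧₀₁≈⟦⟧ (1 , 0) = ≈-sym (≈-trans (+-cong (+-identityʳ 1#) -0#≈0#) (+-identityʳ 1#))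
    ⟦⟧₀₁≈⟦⟧ (0 , suc b) = ≈-refl
    ⟦⟧₀₁≈⟦⟧ (1 , suc b) = ≈-refl
    ⟦⟧₀₁≈⟦⟧ (suc (suc a) , b) = ≈-refl

    morphism : differences -Raw-AlmostCommutative⟶ fromCommutativeRing R
    morphism = record
      { ⟦_⟧ = ⟦_⟧₀₁
      ; +-homo = λ x y → ≈-trans (⟦⟧₀₁≈⟦⟧ (RawRing._+_ differences x y))
          (≈-trans (homo-+ x y) (≈-sym (+-cong (⟦⟧₀₁≈⟦⟧ x) (⟦⟧₀₁≈⟦⟧ y))))
      ; *-homo = λ x y → ≈-trans (⟦⟧₀₁≈⟦⟧ (RawRing._*_ differences x y))
          (≈-trans (homo-* x y) (≈-sym (*-cong (⟦⟧₀₁≈⟦⟧ x) (⟦⟧₀₁≈⟦⟧ y))))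
      ; -‿homo = λ x → ≈-trans (⟦⟧₀₁≈⟦⟧ (RawRing.-_ differences x))
          (≈-trans (homo-neg x) (≈-sym (-‿cong (⟦⟧₀₁≈⟦⟧ x))))
      ; 0-homo = ≈-refl
      ; 1-homo = ≈-refl
      }

    _≟_ : ∀ x y → Maybe (⟦ x ⟧₀₁ ≈ ⟦ y ⟧₀₁)
    (a , b) ≟ (c , d) with a ℕ.+ d ℕ.≟ c ℕ.+ b
    ... | no _ = nothing
    ... | yes eq = just (begin
      ⟦ a , b ⟧₀₁                 ≈⟨ ⟦⟧₀₁≈⟦⟧ (a , b) ⟩
      ι a - ι b                   ≈⟨ +-identityʳ _ ⟨
      (ι a - ι b) + 0#            ≈⟨ +-congˡ (-‿inverseʳ (ι d)) ⟨
      (ι a - ι b) + (ι d - ι d)   ≈⟨ +-interchange _ _ _ _ ⟩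
      (ι a + ι d) + (- ι b - ι d) ≈⟨ +-congʳ (×-homo-+ 1# a d) ⟨
      ι (a ℕ.+ d) + (- ι b - ι d) ≡⟨ ≡.cong (λ k → ι k + (- ι b - ι d)) eq ⟩
      ι (c ℕ.+ b) + (- ι b - ι d) ≈⟨ +-congʳ (×-homo-+ 1# c b) ⟩
      (ι c + ι b) + (- ι b - ι d) ≈⟨ +-congˡ (+-comm _ _) ⟩
      (ι c + ι b) + (- ι d - ι b) ≈⟨ +-interchange _ _ _ _ ⟩
      (ι c - ι d) + (ι b - ι b)   ≈⟨ +-congˡ (-‿inverseʳ (ι b)) ⟩
      (ι c - ι d) + 0#            ≈⟨ +-identityʳ _ ⟩
      ι c - ι d                   ≈⟨ ⟦⟧₀₁≈⟦⟧ (c , d) ⟨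
      ⟦ c , d ⟧₀₁                 ∎)

  open Algebra.Solver.Ring differences (fromCommutativeRing R) morphism _≟_ public
    using (Polynomial; solve; _:=_; _:+_; _:*_; _:-_; :-_; con)

  :0 :1 : ∀ {n} → Polynomial n
  :0 = con (0 , 0)
  :1 = con (1 , 0)

-- Sums over selections, splittings and compositions

chain : ℕ → ℕ → ℕ → List ℕ
chain d a zero = []
chain d a (suc ℓ) = a ∷ chain d (a ℕ.+ d) ℓ

chain-end : ∀ d a c → (c ℕ.* d ℕ.+ a) ℕ.+ d ≡ suc c ℕ.* d ℕ.+ a
chain-end d a c = ≡.trans (ℕ.+-comm _ d) (≡.sym (ℕ.+-assoc d (c ℕ.* d) a))

chain-next : ∀ d a c → suc c ℕ.* d ℕ.+ a ≡ c ℕ.* d ℕ.+ (a ℕ.+ d)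
chain-next d a c = ≡.trans (≡.sym (chain-end d a c)) (ℕ.+-assoc (c ℕ.* d) a d)

size : ∀ {a} {A : Set a} → List (A × ℕ) → ℕ
size [] = 0
size ((_ , c) ∷ cs) = c ℕ.+ size cs

module ListSums {c ℓ} (R : CommutativeRing c ℓ) where
  open CommutativeRing R
    hiding (zero)
    renaming (Carrier to C; refl to ≈-refl; sym to ≈-sym; trans to ≈-trans)
  open RingSolver R
  open Relation.Binary.Reasoning.Setoid setoid

  private variable
    a : Level
    A B : Set a

  sumL : (A → C) → List A → C
  sumL f xs = foldr _+_ 0# (map f xs)

  prodL : (A → C) → List A → C
  prodL f xs = foldr _*_ 1# (map f xs)

  sum≤ : ℕ → (ℕ → C) → C
  sum≤ zero f = f 0
  sum≤ (suc k) f = f 0 + sum≤ k (f ∘ suc)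

  -- ∑ εᵖ f x Y, where x is the entry of the list at position p and Y the
  -- list of the other entries.
  sumPick : C → List A → (A → List A → C) → C
  sumPick ε [] f = 0#
  sumPick ε (x ∷ X) f = f x X + ε * sumPick ε X (λ y Y → f y (x ∷ Y))

  -- ∑ f I J over all ways to split a list into a sublist I of length r and
  -- its complement J.
  sumSplit : List A → ℕ → (List A → List A → C) → C
  sumSplit [] zero f = f [] []
  sumSplit [] (suc r) f = 0#
  sumSplit (x ∷ X) zero f = sumSplit X zero (λ I J → f I (x ∷ J))
  sumSplit (x ∷ X) (suc r) f =
    sumSplit X r (λ I J → f (x ∷ I) J) + sumSplit X (suc r) (λ I J → f I (x ∷ J))

  -- ∑ f [(a₁ , c₁), …, (aₙ , cₙ)] over all c₁ + ⋯ + cₙ = r.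
  sumComp : List A → ℕ → (List (A × ℕ) → C) → C
  sumComp [] zero f = f []
  sumComp [] (suc r) f = 0#
  sumComp (a ∷ as) r f = sum≤ r (λ c → sumComp as (r ∸ c) (λ cs → f ((a , c) ∷ cs)))

  -- An arbitrary compatible relation is allowed so that the same lemmas serve ring equality and
  -- agreement modulo a power of `q`.
  module Congruence {ℓ′} (_∼_ : C → C → Set ℓ′) (∼-refl : ∀ {x} → x ∼ x)
    (+-cong∼ : ∀ {x y u v} → x ∼ y → u ∼ v → (x + u) ∼ (y + v))
    (*-cong∼ : ∀ {x y u v} → x ∼ y → u ∼ v → (x * u) ∼ (y * v)) where

    sumL-cong : ∀ {f g : A → C} (xs : List A) → (∀ x → f x ∼ g x) → sumL f xs ∼ sumL g xs
    sumL-cong [] h = ∼-refl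
    sumL-cong (x ∷ xs) h = +-cong∼ (h x) (sumL-cong xs h)

    prodL-cong∈ : ∀ {f g : A → C} (xs : List A) → (∀ x → x ∈ xs → f x ∼ g x) →
      prodL f xs ∼ prodL g xs
    prodL-cong∈ [] h = ∼-refl
    prodL-cong∈ (x ∷ xs) h =
      *-cong∼ (h x (here ≡.refl)) (prodL-cong∈ xs (λ y y∈ → h y (there y∈)))

    prodL-cong : ∀ {f g : A → C} (xs : List A) → (∀ x → f x ∼ g x) → prodL f xs ∼ prodL g xs
    prodL-cong xs h = prodL-cong∈ xs (λ x _ → h x)

    sum≤-cong≤ : ∀ r {f g : ℕ → C} → (∀ k → k ℕ.≤ r → f k ∼ g k) → sum≤ r f ∼ sum≤ r g
    sum≤-cong≤ zero h = h 0 z≤n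
    sum≤-cong≤ (suc r) h = +-cong∼ (h 0 z≤n) (sum≤-cong≤ r (λ k k≤r → h (suc k) (s≤s k≤r)))

    sumPick-cong : ∀ {ε} (X : List A) {f g : A → List A → C} →
      (∀ x Y → x ∷ Y ↭ X → f x Y ∼ g x Y) → sumPick ε X f ∼ sumPick ε X g
    sumPick-cong [] h = ∼-refl
    sumPick-cong (x ∷ X) h = +-cong∼ (h x X ↭-refl) (*-cong∼ ∼-refl
      (sumPick-cong X (λ y Y p → h y (x ∷ Y) (trans (swap y x refl) (prep x p)))))

    sumSplit-cong : ∀ (X : List A) r {f g : List A → List A → C} →
      (∀ I J → I ++ J ↭ X → length I ≡ r → f I J ∼ g I J) → sumSplit X r f ∼ sumSplit X r g
    sumSplit-cong [] zero h = h [] [] refl ≡.refl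
    sumSplit-cong [] (suc r) h = ∼-refl
    sumSplit-cong (x ∷ X) zero h =
      sumSplit-cong X zero (λ I J p → h I (x ∷ J) (trans (shift x I J) (prep x p)))
    sumSplit-cong (x ∷ X) (suc r) h = +-cong∼
      (sumSplit-cong X r (λ I J p e → h (x ∷ I) J (prep x p) (≡.cong suc e)))
      (sumSplit-cong X (suc r) (λ I J p → h I (x ∷ J) (trans (shift x I J) (prep x p))))

    sumComp-cong : ∀ (as : List A) r {f g : List (A × ℕ) → C} →
      (∀ cs → map proj₁ cs ≡ as → size cs ≡ r → f cs ∼ g cs) → sumComp as r f ∼ sumComp as r g
    sumComp-cong [] zero h = h [] ≡.refl ≡.refl
    sumComp-cong [] (suc r) h = ∼-refl
    sumComp-cong (a ∷ as) r h = sum≤-cong≤ r (λ c c≤r → sumComp-cong as (r ∸ c)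
      (λ cs p e → h ((a , c) ∷ cs) (≡.cong (a ∷_) p)
        (≡.trans (≡.cong (c ℕ.+_) e) (ℕ.m+[n∸m]≡n c≤r))))

  open Congruence _≈_ ≈-refl +-cong *-cong public

  sumL-++ : ∀ (f : A → C) xs ys → sumL f (xs ++ ys) ≈ sumL f xs + sumL f ys
  sumL-++ f [] ys = ≈-sym (+-identityˡ _)
  sumL-++ f (x ∷ xs) ys = ≈-trans (+-congˡ (sumL-++ f xs ys)) (≈-sym (+-assoc _ _ _))

  sumL-+ : ∀ (f g : A → C) xs → sumL (λ x → f x + g x) xs ≈ sumL f xs + sumL g xs
  sumL-+ f g [] = ≈-sym (+-identityˡ 0#)
  sumL-+ f g (x ∷ xs) = ≈-trans (+-congˡ (sumL-+ f g xs))
    (+-interchange _ _ _ _)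

  sumL-*ˡ : ∀ k (f : A → C) xs → sumL (λ x → k * f x) xs ≈ k * sumL f xs
  sumL-*ˡ k f [] = ≈-sym (zeroʳ k)
  sumL-*ˡ k f (x ∷ xs) = ≈-trans (+-congˡ (sumL-*ˡ k f xs)) (≈-sym (distribˡ _ _ _))

  sumL-*ʳ : ∀ k (f : A → C) xs → sumL (λ x → f x * k) xs ≈ sumL f xs * k
  sumL-*ʳ k f xs = ≈-trans (sumL-cong xs (λ x → *-comm (f x) k))
    (≈-trans (sumL-*ˡ k f xs) (*-comm k _))

  sumL-concatMap : ∀ (f : B → C) (g : A → List B) xs →
    sumL f (concatMap g xs) ≈ sumL (λ x → sumL f (g x)) xs
  sumL-concatMap f g [] = ≈-refl
  sumL-concatMap f g (x ∷ xs) = ≈-trans (sumL-++ f (g x) _) (+-congˡ (sumL-concatMap f g xs))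

  sumL-map : ∀ (f : B → C) (g : A → B) xs → sumL f (map g xs) ≡ sumL (λ x → f (g x)) xs
  sumL-map f g xs = ≡.cong (foldr _+_ 0#) (≡.sym (List.map-∘ xs))

  prodL-++ : ∀ (f : A → C) xs ys → prodL f (xs ++ ys) ≈ prodL f xs * prodL f ys
  prodL-++ f [] ys = ≈-sym (*-identityˡ _)
  prodL-++ f (x ∷ xs) ys = ≈-trans (*-congˡ (prodL-++ f xs ys)) (≈-sym (*-assoc _ _ _))

  prodL-* : ∀ (f g : A → C) xs → prodL (λ x → f x * g x) xs ≈ prodL f xs * prodL g xs
  prodL-* f g [] = ≈-sym (*-identityˡ 1#)
  prodL-* f g (x ∷ xs) = ≈-trans (*-congˡ (prodL-* f g xs))
    (*-interchange _ _ _ _)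

  prodL-1 : ∀ (xs : List A) → prodL (λ _ → 1#) xs ≈ 1#
  prodL-1 [] = ≈-refl
  prodL-1 (x ∷ xs) = ≈-trans (*-identityˡ _) (prodL-1 xs)

  prodL-concatMap : ∀ (f : B → C) (g : A → List B) xs →
    prodL f (concatMap g xs) ≈ prodL (λ x → prodL f (g x)) xs
  prodL-concatMap f g [] = ≈-refl
  prodL-concatMap f g (x ∷ xs) = ≈-trans (prodL-++ f (g x) _) (*-congˡ (prodL-concatMap f g xs))

  prodL-map : ∀ (f : B → C) (g : A → B) xs → prodL f (map g xs) ≡ prodL (λ x → f (g x)) xs
  prodL-map f g xs = ≡.cong (foldr _*_ 1#) (≡.sym (List.map-∘ xs))

  prodL-swap : ∀ (f : A → B → C) xs ys →
    prodL (λ x → prodL (f x) ys) xs ≈ prodL (λ y → prodL (λ x → f x y) xs) ys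
  prodL-swap f [] ys = ≈-sym (prodL-1 ys)
  prodL-swap f (x ∷ xs) ys = ≈-trans (*-congˡ (prodL-swap f xs ys)) (≈-sym (prodL-* (f x) _ ys))

  prodL-↭ : ∀ (f : A → C) {xs ys} → xs ↭ ys → prodL f xs ≈ prodL f ys
  prodL-↭ f refl = ≈-refl
  prodL-↭ f (prep x p) = *-congˡ (prodL-↭ f p)
  prodL-↭ f (swap x y p) = ≈-trans (*-congˡ (*-congˡ (prodL-↭ f p)))
    (solve 3 (λ a b c → a :* (b :* c) := b :* (a :* c)) ≈-refl _ _ _)
  prodL-↭ f (trans p q) = ≈-trans (prodL-↭ f p) (prodL-↭ f q)

  square : (A → A → C) → List A → C
  square f cs = prodL (λ x → prodL (f x) cs) cs

  square-∷ : ∀ (f : A → A → C) x xs →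
    square f (x ∷ xs) ≈ f x x * (prodL (λ y → f x y * f y x) xs * square f xs)
  square-∷ f x xs = begin
    (f x x * prodL (f x) xs) * prodL (λ y → f y x * prodL (f y) xs) xs
      ≈⟨ *-congˡ (prodL-* (λ y → f y x) _ xs) ⟩
    (f x x * prodL (f x) xs) * (prodL (λ y → f y x) xs * square f xs)
      ≈⟨ solve 4 (λ a b c e → (a :* b) :* (c :* e) := a :* ((b :* c) :* e)) ≈-refl _ _ _ _ ⟩
    f x x * ((prodL (f x) xs * prodL (λ y → f y x) xs) * square f xs)
      ≈⟨ *-congˡ (*-congʳ (prodL-* (f x) (λ y → f y x) xs)) ⟨
    f x x * (prodL (λ y → f x y * f y x) xs * square f xs) ∎

  square-* : ∀ (f g : A → A → C) xs → square (λ x y → f x y * g x y) xs ≈ square f xs * square g xs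
  square-* f g xs = ≈-trans (prodL-cong xs (λ x → prodL-* (f x) (g x) xs)) (prodL-* _ _ xs)

  square-map : ∀ (f : B → B → C) (g : A → B) xs →
    square (λ x y → f (g x) (g y)) xs ≈ square f (map g xs)
  square-map f g xs = ≈-trans
    (prodL-cong xs (λ x → reflexive (≡.sym (prodL-map (f (g x)) g xs))))
    (reflexive (≡.sym (prodL-map (λ y → prodL (f y) (map g xs)) g xs)))

  sumPick-0 : ∀ {ε} (X : List A) → sumPick ε X (λ _ _ → 0#) ≈ 0#
  sumPick-0 [] = ≈-refl
  sumPick-0 (x ∷ X) = ≈-trans (+-identityˡ _) (≈-trans (*-congˡ (sumPick-0 X)) (zeroʳ _))

  sumPick-+ : ∀ {ε} (X : List A) (f g : A → List A → C) →
    sumPick ε X (λ x Y → f x Y + g x Y) ≈ sumPick ε X f + sumPick ε X g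
  sumPick-+ [] f g = ≈-sym (+-identityˡ 0#)
  sumPick-+ (x ∷ X) f g = ≈-trans (+-congˡ (*-congˡ (sumPick-+ X _ _)))
    (solve 5 (λ a b e c d → (a :+ b) :+ e :* (c :+ d) := (a :+ e :* c) :+ (b :+ e :* d))
      ≈-refl _ _ _ _ _)

  sumPick-*ˡ : ∀ {ε} k (X : List A) (f : A → List A → C) →
    sumPick ε X (λ x Y → k * f x Y) ≈ k * sumPick ε X f
  sumPick-*ˡ k [] f = ≈-sym (zeroʳ k)
  sumPick-*ˡ k (x ∷ X) f = ≈-trans (+-congˡ (*-congˡ (sumPick-*ˡ k X _)))
    (solve 4 (λ k a e c → k :* a :+ e :* (k :* c) := k :* (a :+ e :* c)) ≈-refl _ _ _ _)

  sumPick-*ʳ : ∀ {ε} k (X : List A) (f : A → List A → C) →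
    sumPick ε X (λ x Y → f x Y * k) ≈ sumPick ε X f * k
  sumPick-*ʳ k X f = ≈-trans (sumPick-cong X (λ x Y _ → *-comm (f x Y) k))
    (≈-trans (sumPick-*ˡ k X f) (*-comm k _))

  sumPick-swap : ∀ {ε} (X : List A) (Y : List B) (f : A → List A → B → List B → C) →
    sumPick ε X (λ x X′ → sumPick ε Y (f x X′)) ≈
    sumPick ε Y (λ y Y′ → sumPick ε X (λ x X′ → f x X′ y Y′))
  sumPick-swap [] Y f = ≈-sym (sumPick-0 Y)
  sumPick-swap {ε = ε} (x ∷ X) Y f = begin
    sumPick ε Y (f x X) + ε * sumPick ε X (λ z Z → sumPick ε Y (f z (x ∷ Z)))
      ≈⟨ +-congˡ (*-congˡ (sumPick-swap X Y (λ z Z → f z (x ∷ Z)))) ⟩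
    sumPick ε Y (f x X) + ε * sumPick ε Y (λ y Y′ → sumPick ε X (λ z Z → f z (x ∷ Z) y Y′))
      ≈⟨ +-congˡ (sumPick-*ˡ ε Y _) ⟨
    sumPick ε Y (f x X) + sumPick ε Y (λ y Y′ → ε * sumPick ε X (λ z Z → f z (x ∷ Z) y Y′))
      ≈⟨ sumPick-+ Y _ _ ⟨
    sumPick ε Y (λ y Y′ → sumPick ε (x ∷ X) (λ z Z → f z Z y Y′)) ∎

  sumSplit-0 : ∀ (X : List A) r → sumSplit X r (λ _ _ → 0#) ≈ 0#
  sumSplit-0 [] zero = ≈-refl
  sumSplit-0 [] (suc r) = ≈-refl
  sumSplit-0 (x ∷ X) zero = sumSplit-0 X zero
  sumSplit-0 (x ∷ X) (suc r) =
    ≈-trans (+-cong (sumSplit-0 X r) (sumSplit-0 X (suc r))) (+-identityˡ 0#)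

  sumSplit-zero : ∀ (X : List A) f → sumSplit X 0 f ≡ f [] X
  sumSplit-zero [] f = ≡.refl
  sumSplit-zero (x ∷ X) f = sumSplit-zero X (λ I J → f I (x ∷ J))

  sumSplit-+ : ∀ (X : List A) r (f g : List A → List A → C) →
    sumSplit X r (λ I J → f I J + g I J) ≈ sumSplit X r f + sumSplit X r g
  sumSplit-+ [] zero f g = ≈-refl
  sumSplit-+ [] (suc r) f g = ≈-sym (+-identityˡ 0#)
  sumSplit-+ (x ∷ X) zero f g = sumSplit-+ X zero _ _
  sumSplit-+ (x ∷ X) (suc r) f g =
    ≈-trans (+-cong (sumSplit-+ X r _ _) (sumSplit-+ X (suc r) _ _))
      (+-interchange _ _ _ _)

  sumSplit-*ʳ : ∀ k (X : List A) r (f : List A → List A → C) →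
    sumSplit X r (λ I J → f I J * k) ≈ sumSplit X r f * k
  sumSplit-*ʳ k [] zero f = ≈-refl
  sumSplit-*ʳ k [] (suc r) f = ≈-sym (zeroˡ k)
  sumSplit-*ʳ k (x ∷ X) zero f = sumSplit-*ʳ k X zero _
  sumSplit-*ʳ k (x ∷ X) (suc r) f =
    ≈-trans (+-cong (sumSplit-*ʳ k X r _) (sumSplit-*ʳ k X (suc r) _)) (≈-sym (distribʳ _ _ _))

  -- Sublists inherit the order of the list, so a rearrangement of the list reorders `I` and `J`;
  -- the invariance of `f` absorbs this.
  sumSplit-↭ : ∀ {X Y : List A} r {f : List A → List A → C} →
    (∀ {I I′ J J′} → I ↭ I′ → J ↭ J′ → f I J ≈ f I′ J′) → X ↭ Y →
    sumSplit X r f ≈ sumSplit Y r f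
  sumSplit-↭ r resp refl = ≈-refl
  sumSplit-↭ zero resp (prep x p) = sumSplit-↭ zero (λ q q′ → resp q (prep x q′)) p
  sumSplit-↭ (suc r) resp (prep x p) = +-cong
    (sumSplit-↭ r (λ q q′ → resp (prep x q) q′) p)
    (sumSplit-↭ (suc r) (λ q q′ → resp q (prep x q′)) p)
  sumSplit-↭ zero resp (swap {xs = X} x y p) = ≈-trans
    (sumSplit-cong X 0 (λ I J _ _ → resp refl (swap x y refl)))
    (sumSplit-↭ zero (λ q q′ → resp q (prep y (prep x q′))) p)
  sumSplit-↭ (suc zero) resp (swap {xs = X} x y p) = ≈-trans
    (solve 3 (λ u v w → u :+ (v :+ w) := v :+ (u :+ w)) ≈-refl _ _ _)
    (+-cong (sumSplit-↭ 0 (λ q q′ → resp (prep y q) (prep x q′)) p)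
      (+-cong (sumSplit-↭ 0 (λ q q′ → resp (prep x q) (prep y q′)) p)
        (≈-trans (sumSplit-cong X 1 (λ I J _ _ → resp refl (swap x y refl)))
          (sumSplit-↭ 1 (λ q q′ → resp q (prep y (prep x q′))) p))))
  sumSplit-↭ (suc (suc r)) resp (swap {xs = X} x y p) = ≈-trans
    (+-interchange _ _ _ _)
    (+-cong
      (+-cong (≈-trans (sumSplit-cong X r (λ I J _ _ → resp (swap x y refl) refl))
                (sumSplit-↭ r (λ q q′ → resp (prep y (prep x q)) q′) p))
              (sumSplit-↭ (suc r) (λ q q′ → resp (prep y q) (prep x q′)) p))
      (+-cong (sumSplit-↭ (suc r) (λ q q′ → resp (prep x q) (prep y q′)) p)
              (≈-trans (sumSplit-cong X (suc (suc r)) (λ I J _ _ → resp refl (swap x y refl)))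
                (sumSplit-↭ (suc (suc r)) (λ q q′ → resp q (prep y (prep x q′))) p))))
  sumSplit-↭ r resp (trans p q) = ≈-trans (sumSplit-↭ r resp p) (sumSplit-↭ r resp q)

  -- Double counting: an element followed by `r` of the others, or `r + 1` elements with one of them
  -- distinguished.
  sumPick-sumSplit : ∀ (X : List A) r (h : A → List A → List A → C) →
    sumPick 1# X (λ x Y → sumSplit Y r (h x)) ≈
    sumSplit X (suc r) (λ I J → sumPick 1# I (λ x I′ → h x I′ J))
  sumPick-sumSplit [] r h = ≈-refl
  sumPick-sumSplit (z ∷ Z) zero h = begin
    sumSplit Z 0 (h z) + 1# * sumPick 1# Z (λ x Y → sumSplit Y 0 (λ I J → h x I (z ∷ J)))
      ≈⟨ +-cong (reflexive (sumSplit-zero Z (h z)))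
           (≈-trans (*-identityˡ _) (sumPick-sumSplit Z 0 (λ x I J → h x I (z ∷ J)))) ⟩
    h z [] Z + sumSplit Z 1 (λ I J → sumPick 1# I (λ x I′ → h x I′ (z ∷ J)))
      ≈⟨ +-congʳ (≈-trans (reflexive (sumSplit-zero Z _))
           (solve 1 (λ a → a :+ :1 :* :0 := a) ≈-refl _)) ⟨
    _ ∎
  sumPick-sumSplit (z ∷ Z) (suc r) h = begin
    sumSplit Z (suc r) (h z) +
      1# * sumPick 1# Z (λ x Y → sumSplit Y r (λ I J → h x (z ∷ I) J) +
                                 sumSplit Y (suc r) (λ I J → h x I (z ∷ J)))
      ≈⟨ +-congˡ (≈-trans (*-identityˡ _) (≈-trans (sumPick-+ Z _ _)
           (+-cong (sumPick-sumSplit Z r (λ x I J → h x (z ∷ I) J))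
                   (sumPick-sumSplit Z (suc r) (λ x I J → h x I (z ∷ J)))))) ⟩
    sumSplit Z (suc r) (h z) +
      (sumSplit Z (suc r) (λ I J → sumPick 1# I (λ x I′ → h x (z ∷ I′) J)) +
       sumSplit Z (suc (suc r)) (λ I J → sumPick 1# I (λ x I′ → h x I′ (z ∷ J))))
      ≈⟨ +-assoc _ _ _ ⟨
    _ ≈⟨ +-congʳ (sumSplit-+ Z (suc r) _ _) ⟨
    _ ≈⟨ +-congʳ (sumSplit-cong Z (suc r) (λ I J _ _ → +-congˡ (≈-sym (*-identityˡ _)))) ⟩
    _ ∎

  perms-∷ : ∀ (F : List A → C) x X →
    sumL F (perms (x ∷ X)) ≈ sumL (λ e → sumL F (insertAll x e)) (perms X)
  perms-∷ F x X = sumL-concatMap F (insertAll x) (perms X)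

  -- `perms` inserts the head everywhere, while recursions need the first entry. Inserting `x` into
  -- `y ∷ e` either puts `x` first or leaves `y` first.
  perms-pick : ∀ (F : List A → C) x X →
    sumL F (perms (x ∷ X)) ≈ sumPick 1# (x ∷ X) (λ y Y → sumL (λ e → F (y ∷ e)) (perms Y))
  perms-pick F x [] = ≈-sym (solve 1 (λ a → (a :+ :0) :+ :1 :* :0 := a :+ :0) ≈-refl _)
  perms-pick F x X@(z ∷ Z) = begin
    sumL F (perms (x ∷ X))
      ≈⟨ perms-∷ F x X ⟩
    sumL (λ e → sumL F (insertAll x e)) (perms X)
      ≈⟨ perms-pick _ z Z ⟩
    sumPick 1# X (λ y Y → sumL (λ e → sumL F (insertAll x (y ∷ e))) (perms Y))
      ≈⟨ sumPick-cong X (λ y Y _ → ≈-trans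
           (sumL-cong (perms Y) (λ e → +-congˡ (reflexive (sumL-map F (y ∷_) (insertAll x e)))))
           (≈-trans (sumL-+ _ _ (perms Y)) (+-congˡ (≈-sym (perms-∷ (λ e → F (y ∷ e)) x Y))))) ⟩
    sumPick 1# X (λ y Y → sumL (λ e → F (x ∷ y ∷ e)) (perms Y) +
                          sumL (λ e → F (y ∷ e)) (perms (x ∷ Y)))
      ≈⟨ sumPick-+ X (λ y Y → sumL (λ e → F (x ∷ y ∷ e)) (perms Y))
                     (λ y Y → sumL (λ e → F (y ∷ e)) (perms (x ∷ Y))) ⟩
    sumPick 1# X (λ y Y → sumL (λ e → F (x ∷ y ∷ e)) (perms Y)) +
    sumPick 1# X (λ y Y → sumL (λ e → F (y ∷ e)) (perms (x ∷ Y)))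
      ≈⟨ +-cong (≈-sym (perms-pick (λ e → F (x ∷ e)) z Z)) (≈-sym (*-identityˡ _)) ⟩
    _ ∎

  -- `perms-pick` fixes the first `r` entries one at a time, and `sumPick-sumSplit` collects them
  -- into the set `I`.
  perms-split : ∀ (F : List A → C) X r → r ℕ.≤ length X →
    sumL F (perms X) ≈
    sumSplit X r (λ I J → sumL (λ e₁ → sumL (λ e₂ → F (e₁ ++ e₂)) (perms J)) (perms I))
  perms-split F X zero _ =
    ≈-sym (≈-trans (reflexive (sumSplit-zero X _)) (+-identityʳ _))
  perms-split F X@(x ∷ X₀) (suc r) (s≤s r≤) = begin
    sumL F (perms X)
      ≈⟨ perms-pick F x X₀ ⟩
    sumPick 1# X (λ y Y → sumL (λ e → F (y ∷ e)) (perms Y))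
      ≈⟨ sumPick-cong X (λ y Y p → perms-split _ Y r
           (≡.subst (r ℕ.≤_) (≡.sym (ℕ.suc-injective (↭-length p))) r≤)) ⟩
    sumPick 1# X (λ y Y → sumSplit Y r (h y))
      ≈⟨ sumPick-sumSplit X r h ⟩
    sumSplit X (suc r) (λ I J → sumPick 1# I (λ y I′ → h y I′ J))
      ≈⟨ sumSplit-cong X (suc r) {λ I J → sumPick 1# I (λ y I′ → h y I′ J)} {g}
           (λ { (i ∷ I) J _ _ → ≈-sym (perms-pick (λ e₁ → sumL (λ e₂ → F (e₁ ++ e₂)) (perms J)) i I) }) ⟩
    sumSplit X (suc r) g ∎
    where
    h : _ → List _ → List _ → C
    h y I J = sumL (λ e₁ → sumL (λ e₂ → F (y ∷ e₁ ++ e₂)) (perms J)) (perms I)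
    g : List _ → List _ → C
    g I J = sumL (λ e₁ → sumL (λ e₂ → F (e₁ ++ e₂)) (perms J)) (perms I)

-- Power series and determinants

module LinearSums {c ℓ} (R : CommutativeRing c ℓ) where
  open CommutativeRing R
    hiding (zero) renaming (Carrier to C; refl to ≈-refl; sym to ≈-sym; trans to ≈-trans)
  open RingSolver R
  open ListSums R
  open Relation.Binary.Reasoning.Setoid setoid

  private variable
    a : Level
    A B : Set a

  sum≤-0 : ∀ r → sum≤ r (λ _ → 0#) ≈ 0#
  sum≤-0 zero = ≈-refl
  sum≤-0 (suc r) = ≈-trans (+-identityˡ _) (sum≤-0 r)

  sum≤-+ : ∀ r (f g : ℕ → C) → sum≤ r (λ k → f k + g k) ≈ sum≤ r f + sum≤ r g
  sum≤-+ zero f g = ≈-refl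
  sum≤-+ (suc r) f g = ≈-trans (+-congˡ (sum≤-+ r _ _))
    (+-interchange _ _ _ _)

  sum≤-*ˡ : ∀ k r (f : ℕ → C) → sum≤ r (λ i → k * f i) ≈ k * sum≤ r f
  sum≤-*ˡ k zero f = ≈-refl
  sum≤-*ˡ k (suc r) f = ≈-trans (+-congˡ (sum≤-*ˡ k r _)) (≈-sym (distribˡ _ _ _))

  sumComp-0 : ∀ (as : List A) r → sumComp as r (λ _ → 0#) ≈ 0#
  sumComp-0 [] zero = ≈-refl
  sumComp-0 [] (suc r) = ≈-refl
  sumComp-0 (a ∷ as) r = ≈-trans (sum≤-cong≤ r (λ c _ → sumComp-0 as (r ∸ c))) (sum≤-0 r)

  sumComp-+ : ∀ (as : List A) r f g →
    sumComp as r (λ cs → f cs + g cs) ≈ sumComp as r f + sumComp as r g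
  sumComp-+ [] zero f g = ≈-refl
  sumComp-+ [] (suc r) f g = ≈-sym (+-identityˡ 0#)
  sumComp-+ (a ∷ as) r f g =
    ≈-trans (sum≤-cong≤ r (λ c _ → sumComp-+ as (r ∸ c) _ _)) (sum≤-+ r _ _)

  sumComp-*ˡ : ∀ k (as : List A) r f → sumComp as r (λ cs → k * f cs) ≈ k * sumComp as r f
  sumComp-*ˡ k [] zero f = ≈-refl
  sumComp-*ˡ k [] (suc r) f = ≈-sym (zeroʳ k)
  sumComp-*ˡ k (a ∷ as) r f =
    ≈-trans (sum≤-cong≤ r (λ c _ → sumComp-*ˡ k as (r ∸ c) _)) (sum≤-*ˡ k r _)

  sumComp-sumPick : ∀ {ε} (as : List A) r (X : List B)
    (g : B → List B → C) (f : B → List B → List (A × ℕ) → C) →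
    sumComp as r (λ cs → sumPick ε X (λ x Y → g x Y * f x Y cs)) ≈
    sumPick ε X (λ x Y → g x Y * sumComp as r (f x Y))
  sumComp-sumPick as r [] g f = sumComp-0 as r
  sumComp-sumPick as r (x ∷ X) g f = ≈-trans (sumComp-+ as r _ _)
    (+-cong (sumComp-*ˡ _ as r _)
      (≈-trans (sumComp-*ˡ _ as r _) (*-congˡ (sumComp-sumPick as r X _ _))))

  sum≤-sumPick : ∀ {ε} r (X : List B) (f : B → List B → ℕ → C) →
    sum≤ r (λ k → sumPick ε X (λ x Y → f x Y k)) ≈ sumPick ε X (λ x Y → sum≤ r (f x Y))
  sum≤-sumPick r [] f = sum≤-0 r
  sum≤-sumPick r (x ∷ X) f = ≈-trans (sum≤-+ r _ _)
    (+-congˡ (≈-trans (sum≤-*ˡ _ r _) (*-congˡ (sum≤-sumPick r X _))))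

module PowerSeries {c ℓ} (R : CommutativeRing c ℓ) where
  open CommutativeRing R
    hiding (zero) renaming (Carrier to C; refl to ≈-refl; sym to ≈-sym; trans to ≈-trans)
  open RingSolver R
  open ListSums R
  open LinearSums R
  open Relation.Binary.Reasoning.Setoid setoid

  conv : (ℕ → C) → (ℕ → C) → ℕ → C
  conv f g k = sum≤ k (λ i → f i * g (k ∸ i))

  one : ℕ → C
  one zero = 1#
  one (suc _) = 0#

  conv-cong : ∀ {f f′ g g′} → (∀ k → f k ≈ f′ k) → (∀ k → g k ≈ g′ k) →
    ∀ k → conv f g k ≈ conv f′ g′ k
  conv-cong p q k = sum≤-cong≤ k (λ i _ → *-cong (p i) (q (k ∸ i)))

  -- `conv` unfolds from the low end; peeling off the high end is what commutativity needs.
  conv-last : ∀ f g k → conv f g (suc k) ≈ conv f (g ∘ suc) k + f (suc k) * g 0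
  conv-last f g zero = ≈-refl
  conv-last f g (suc k) = ≈-trans (+-congˡ (conv-last (f ∘ suc) g k)) (≈-sym (+-assoc _ _ _))

  conv-comm : ∀ f g k → conv f g k ≈ conv g f k
  conv-comm f g zero = *-comm _ _
  conv-comm f g (suc k) = begin
    f 0 * g (suc k) + conv (f ∘ suc) g k ≈⟨ +-cong (*-comm _ _) (conv-comm (f ∘ suc) g k) ⟩
    g (suc k) * f 0 + conv g (f ∘ suc) k ≈⟨ +-comm _ _ ⟩
    conv g (f ∘ suc) k + g (suc k) * f 0 ≈⟨ conv-last g f k ⟨
    conv g f (suc k)                     ∎

  conv-distribʳ : ∀ h f g k → conv (λ i → f i + g i) h k ≈ conv f h k + conv g h k
  conv-distribʳ h f g k =
    ≈-trans (sum≤-cong≤ k (λ i _ → distribʳ (h (k ∸ i)) (f i) (g i))) (sum≤-+ k _ _)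

  conv-*ˡ : ∀ x f g k → conv (λ i → x * f i) g k ≈ x * conv f g k
  conv-*ˡ x f g k = ≈-trans (sum≤-cong≤ k (λ i _ → *-assoc _ _ _)) (sum≤-*ˡ x k _)

  conv-assoc : ∀ f g h k → conv (conv f g) h k ≈ conv f (conv g h) k
  conv-assoc f g h zero = *-assoc _ _ _
  conv-assoc f g h (suc k) = begin
    (f 0 * g 0) * h (suc k) + conv (λ i → f 0 * g (suc i) + conv (f ∘ suc) g i) h k
      ≈⟨ +-congˡ (conv-distribʳ h _ _ k) ⟩
    (f 0 * g 0) * h (suc k) + (conv (λ i → f 0 * g (suc i)) h k + conv (conv (f ∘ suc) g) h k)
      ≈⟨ +-congˡ (+-cong (conv-*ˡ (f 0) (g ∘ suc) h k) (conv-assoc (f ∘ suc) g h k)) ⟩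
    (f 0 * g 0) * h (suc k) + (f 0 * conv (g ∘ suc) h k + conv (f ∘ suc) (conv g h) k)
      ≈⟨ solve 5 (λ x y z u v → (x :* y) :* z :+ (x :* u :+ v) := x :* (y :* z :+ u) :+ v)
           ≈-refl _ _ _ _ _ ⟩
    f 0 * (g 0 * h (suc k) + conv (g ∘ suc) h k) + conv (f ∘ suc) (conv g h) k ∎

  conv-identityˡ : ∀ f k → conv one f k ≈ f k
  conv-identityˡ f zero = *-identityˡ _
  conv-identityˡ f (suc k) = ≈-trans
    (+-cong (*-identityˡ _)
      (≈-trans (sum≤-cong≤ k (λ i _ → zeroˡ (f (k ∸ i)))) (sum≤-0 k)))
    (+-identityʳ _)

  ring′ : CommutativeRing c ℓ
  ring′ = record
    { Carrier = ℕ → C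
    ; _≈_ = λ f g → ∀ k → f k ≈ g k
    ; _+_ = λ f g k → f k + g k
    ; _*_ = conv
    ; -_ = λ f k → - f k
    ; 0# = λ _ → 0#
    ; 1# = one
    ; isCommutativeRing = record
      { isRing = record
        { +-isAbelianGroup = record
          { isGroup = record
            { isMonoid = record
              { isSemigroup = record
                { isMagma = record
                  { isEquivalence = record
                    { refl = λ _ → ≈-refl
                    ; sym = λ p k → ≈-sym (p k)
                    ; trans = λ p q k → ≈-trans (p k) (q k)
                    }
                  ; ∙-cong = λ p q k → +-cong (p k) (q k)
                  }
                ; assoc = λ f g h k → +-assoc _ _ _
                }
              ; identity = (λ f k → +-identityˡ _) , (λ f k → +-identityʳ _)
              }
            ; inverse = (λ f k → -‿inverseˡ _) , (λ f k → -‿inverseʳ _)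
            ; ⁻¹-cong = λ p k → -‿cong (p k)
            }
          ; comm = λ f g k → +-comm _ _
          }
        ; *-cong = conv-cong
        ; *-assoc = conv-assoc
        ; *-identity = conv-identityˡ , (λ f k → ≈-trans (conv-comm f one k) (conv-identityˡ f k))
        ; distrib =
            (λ f g h k → ≈-trans (conv-comm f _ k) (≈-trans (conv-distribʳ f g h k)
              (+-cong (conv-comm g f k) (conv-comm h f k))))
          , conv-distribʳ
        }
      ; *-comm = conv-comm
      }
    }

-- Determinants by Laplace expansion

module Determinant {c ℓ} (R : CommutativeRing c ℓ) where
  open CommutativeRing R
    hiding (zero) renaming (Carrier to C; refl to ≈-refl; sym to ≈-sym; trans to ≈-trans)
  open RingSolver R
  open ListSums R
  open Relation.Binary.Reasoning.Setoid setoid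

  private variable
    a : Level
    A B : Set a

  -- Expansion along the first row, with the signs supplied by `sumPick (- 1#)`. Rows and columns
  -- are lists of indices, so a minor is the same function `M` on shorter lists.
  det : (A → B → C) → List A → List B → C
  det M [] [] = 1#
  det M [] (b ∷ bs) = 0#
  det M (a ∷ as) bs = sumPick (- 1#) bs (λ b bs′ → M a b * det M as bs′)

  -- The term `M a b` is common to both expansions. In all other terms the minors still contain
  -- column `b`; they are expanded along it by induction and the two sums are exchanged.
  det-column : ∀ (M : A → B → C) as b bs →
    det M as (b ∷ bs) ≈ sumPick (- 1#) as (λ a as′ → M a b * det M as′ bs)
  det-column M [] b bs = ≈-refl
  det-column M (a ∷ as) b bs = +-congˡ (*-congˡ (begin
    sumPick ε bs (λ b′ bs′ → M a b′ * det M as (b ∷ bs′))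
      ≈⟨ sumPick-cong bs (λ b′ bs′ _ → ≈-trans (*-congˡ (det-column M as b bs′))
           (≈-sym (sumPick-*ˡ (M a b′) as _))) ⟩
    sumPick ε bs (λ b′ bs′ → sumPick ε as (λ a′ as′ → M a b′ * (M a′ b * det M as′ bs′)))
      ≈⟨ sumPick-swap bs as _ ⟩
    sumPick ε as (λ a′ as′ → sumPick ε bs (λ b′ bs′ → M a b′ * (M a′ b * det M as′ bs′)))
      ≈⟨ sumPick-cong as (λ a′ as′ _ → ≈-trans
           (sumPick-cong bs (λ b′ bs′ _ →
             solve 3 (λ x y z → x :* (y :* z) := y :* (x :* z)) ≈-refl _ _ _))
           (sumPick-*ˡ (M a′ b) bs _)) ⟩
    sumPick ε as (λ a′ as′ → M a′ b * det M (a ∷ as′) bs) ∎))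
    where ε = - 1#

  det-transpose : ∀ (M : A → B → C) as bs → det M as bs ≈ det (flip M) bs as
  det-transpose M [] [] = ≈-refl
  det-transpose M (a ∷ as) [] = ≈-refl
  det-transpose M as (b ∷ bs) = ≈-trans (det-column M as b bs)
    (sumPick-cong as (λ a as′ _ → *-congˡ (det-transpose M as′ bs)))

  det-cong : ∀ {M N : A → B → C} as bs → (∀ a b → M a b ≈ N a b) → det M as bs ≈ det N as bs
  det-cong [] [] h = ≈-refl
  det-cong [] (b ∷ bs) h = ≈-refl
  det-cong (a ∷ as) bs h =
    sumPick-cong bs (λ b bs′ _ → *-cong (h a b) (det-cong as bs′ h))

  det-scale-rows : ∀ (h : A → C) (M : A → B → C) as bs →
    det (λ a b → h a * M a b) as bs ≈ prodL h as * det M as bs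
  det-scale-rows h M [] [] = ≈-sym (*-identityˡ 1#)
  det-scale-rows h M [] (b ∷ bs) = ≈-sym (zeroʳ _)
  det-scale-rows h M (a ∷ as) bs = begin
    sumPick ε bs (λ b bs′ → (h a * M a b) * det _ as bs′)
      ≈⟨ sumPick-cong bs (λ b bs′ _ → ≈-trans (*-congˡ (det-scale-rows h M as bs′))
           (*-interchange _ _ _ _)) ⟩
    sumPick ε bs (λ b bs′ → (h a * prodL h as) * (M a b * det M as bs′))
      ≈⟨ sumPick-*ˡ _ bs _ ⟩
    (h a * prodL h as) * sumPick ε bs (λ b bs′ → M a b * det M as bs′) ∎
    where ε = - 1#

-- The sequence λ c → N a c b is read as the power series ∑ N a c b zᶜ.
module GradedDeterminant {c ℓ} (R : CommutativeRing c ℓ) where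
  open CommutativeRing R
    hiding (zero) renaming (Carrier to C; refl to ≈-refl; sym to ≈-sym; trans to ≈-trans)
  open ListSums R
  open LinearSums R
  open PowerSeries R using (ring′; conv)
  private
    module Z = CommutativeRing ring′
    module S = ListSums ring′
    module ZP = Algebra.Properties.Ring Z.ring
    module P = Algebra.Properties.Ring ring
  open Determinant R using (det)
  open Determinant ring′ using () renaming (det to detz)
  open Relation.Binary.Reasoning.Setoid setoid

  private variable
    a : Level
    A B : Set a

  coefficient-sumPick : ∀ (X : List A) f r →
    S.sumPick (Z.- Z.1#) X f r ≈ sumPick (- 1#) X (λ x Y → f x Y r)
  coefficient-sumPick [] f r = ≈-refl
  coefficient-sumPick (x ∷ X) f r = +-congˡ (≈-trans
    (ZP.-1*x≈-x (S.sumPick (Z.- Z.1#) X (λ y Y → f y (x ∷ Y))) r)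
    (≈-trans (-‿cong (coefficient-sumPick X _ r)) (≈-sym (P.-1*x≈-x _))))

  -- Multilinearity in the rows: choosing a degree `c` in every row with total degree `r` is the
  -- Cauchy product that computes the coefficient of `zʳ`.
  sumComp-det : ∀ (N : A → ℕ → B → C) as r bs →
    sumComp as r (λ cs → det (λ (a , c) b → N a c b) cs bs) ≈
    detz (λ a b c → N a c b) as bs r
  sumComp-det N [] zero [] = ≈-refl
  sumComp-det N [] (suc r) [] = ≈-refl
  sumComp-det N [] zero (b ∷ bs) = ≈-refl
  sumComp-det N [] (suc r) (b ∷ bs) = ≈-refl
  sumComp-det N (a ∷ as) r bs = begin
    sum≤ r (λ c → sumComp as (r ∸ c) (λ cs →
      sumPick (- 1#) bs (λ b bs′ → N a c b * det _ cs bs′)))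
      ≈⟨ sum≤-cong≤ r (λ c _ → sumComp-sumPick as (r ∸ c) bs (λ b _ → N a c b)
           (λ b bs′ cs → det _ cs bs′)) ⟩
    sum≤ r (λ c → sumPick (- 1#) bs (λ b bs′ →
      N a c b * sumComp as (r ∸ c) (λ cs → det _ cs bs′)))
      ≈⟨ sum≤-cong≤ r (λ c _ → sumPick-cong bs (λ b bs′ _ →
           *-congˡ (sumComp-det N as (r ∸ c) bs′))) ⟩
    sum≤ r (λ c → sumPick (- 1#) bs (λ b bs′ → N a c b * detz (λ a b c → N a c b) as bs′ (r ∸ c)))
      ≈⟨ sum≤-sumPick r bs _ ⟩
    sumPick (- 1#) bs (λ b bs′ → conv (λ c → N a c b) (detz (λ a b c → N a c b) as bs′) r)
      ≈⟨ coefficient-sumPick bs _ r ⟨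
    detz (λ a b c → N a c b) (a ∷ as) bs r ∎

-- Sums over subsets closed under subtraction of a step

module ChainSums {c ℓ} (R : CommutativeRing c ℓ) (d : ℕ) where
  open CommutativeRing R
    hiding (zero) renaming (Carrier to C; refl to ≈-refl; sym to ≈-sym; trans to ≈-trans)
  open ListSums R
  open Relation.Binary.Reasoning.Setoid setoid

  -- Equivalently, only sets `I` that contain `y` whenever they contain `y + d`, among the listed
  -- points, contribute.
  Vanishing : (List ℕ → List ℕ → C) → Set ℓ
  Vanishing f = ∀ {I J y} → y ∈ J → y ℕ.+ d ∈ I → f I J ≈ 0#

  -- Once an entry lies in `J`, the next one cannot lie in `I`; the hypothesis that `a ∈ I` kills
  -- the term passes along the chain and pushes all of it into `J`.
  sumSplit-chain-absent : ∀ ℓ a X r f → Vanishing f → (∀ {I J} → a ∈ I → f I J ≈ 0#) →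
    sumSplit (chain d a ℓ ++ X) r f ≈ sumSplit X r (λ I J → f I (chain d a ℓ ++ J))
  sumSplit-chain-absent zero a X r f van abs = ≈-refl
  sumSplit-chain-absent (suc ℓ) a X zero f van abs =
    sumSplit-chain-absent ℓ (a ℕ.+ d) X zero _ (λ p q → van (there p) q) (van (here ≡.refl))
  sumSplit-chain-absent (suc ℓ) a X (suc r) f van abs = ≈-trans
    (+-cong
      (≈-trans (sumSplit-cong (chain d (a ℕ.+ d) ℓ ++ X) r (λ I J _ _ → abs (here ≡.refl)))
        (sumSplit-0 (chain d (a ℕ.+ d) ℓ ++ X) r))
      (sumSplit-chain-absent ℓ (a ℕ.+ d) X (suc r) _ (λ p q → van (there p) q) (van (here ≡.refl))))
    (+-identityˡ _)

  -- The index `c` counts the entries of the chain that lie in `I`. Because `r ≤ ℓ`, the chain is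
  -- never exhausted and `c` takes all values up to `r`.
  sumSplit-chain : ∀ r ℓ a X f → r ℕ.≤ ℓ → Vanishing f →
    sumSplit (chain d a ℓ ++ X) r f ≈
    sum≤ r (λ c → sumSplit X (r ∸ c) (λ I J →
      f (chain d a c ++ I) (chain d (c ℕ.* d ℕ.+ a) (ℓ ∸ c) ++ J)))
  sumSplit-chain zero ℓ a X f _ van = reflexive (≡.trans
    (sumSplit-zero (chain d a ℓ ++ X) f) (≡.sym (sumSplit-zero X _)))
  sumSplit-chain (suc r) (suc ℓ) a X f (s≤s r≤ℓ) van = ≈-trans
    -- `sumSplit` lists the case of the head in `I` first, whereas `sum≤` starts with `c = 0`, the
    -- case of the head in `J`.
    (+-comm _ _)
    (+-cong
      (sumSplit-chain-absent ℓ (a ℕ.+ d) X (suc r) _ (λ p q → van (there p) q) (van (here ≡.refl)))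
      (≈-trans
        (sumSplit-chain r ℓ (a ℕ.+ d) X _ r≤ℓ (λ p q → van p (there q)))
        (sum≤-cong≤ r (λ c _ → sumSplit-cong X (r ∸ c) (λ I J _ _ → reflexive
          (≡.cong (λ y → f (chain d a (suc c) ++ I) (chain d y (ℓ ∸ c) ++ J))
            (≡.sym (chain-next d a c))))))))

  taken : List (ℕ × ℕ) → List ℕ
  taken = concatMap (λ (a , c) → chain d a c)

  left : (ℕ → ℕ) → List (ℕ × ℕ) → List ℕ
  left ℓ = concatMap (λ (a , c) → chain d (c ℕ.* d ℕ.+ a) (ℓ a ∸ c))

  chains : (ℕ → ℕ) → List ℕ → List ℕ
  chains ℓ = concatMap (λ a → chain d a (ℓ a))

  sumSplit-chains : ∀ ℓ as r f → (∀ a → r ℕ.≤ ℓ a) → Vanishing f →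
    sumSplit (chains ℓ as) r f ≈ sumComp as r (λ cs → f (taken cs) (left ℓ cs))
  sumSplit-chains ℓ [] zero f r≤ van = ≈-refl
  sumSplit-chains ℓ [] (suc r) f r≤ van = ≈-refl
  sumSplit-chains ℓ (a ∷ as) r f r≤ van = ≈-trans
    (sumSplit-chain r (ℓ a) a (chains ℓ as) f (r≤ a) van)
    (sum≤-cong≤ r (λ c _ → sumSplit-chains ℓ as (r ∸ c) _
      (λ b → ℕ.≤-trans (ℕ.m∸n≤m r c) (r≤ b))
      (λ p q → van (∈-++⁺ʳ _ p) (∈-++⁺ʳ (chain d a c) q))))

-- Interpolation at powers of q

Unique-resp-↭ : ∀ {X Y : List ℕ} → X ↭ Y → Unique X → Unique Y
Unique-resp-↭ p = Setoid↭.Unique-resp-↭ (≡.setoid ℕ) (↭⇒↭ₛ p)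

-- Points x of ℕ stand for elements q x = qˣ of R, and G x y for the quotient
-- qˣ / (qˣ - qʸ), which exists in R although qˣ - qʸ is not invertible.
record PointSystem {c ℓ} (R : CommutativeRing c ℓ) : Set (c ⊔ ℓ) where
  open CommutativeRing R
  field
    q : ℕ → Carrier
    q-0 : q 0 ≈ 1#
    q-+ : ∀ x y → q (x ℕ.+ y) ≈ q x * q y
    cancel : ∀ {x y f g} → x ≢ y → (q x - q y) * f ≈ (q x - q y) * g → f ≈ g
    G : ℕ → ℕ → Carrier
    G-def : ∀ {x y} → x ≢ y → (q x - q y) * G x y ≈ q x

module Points {c ℓ} (R : CommutativeRing c ℓ) (P : PointSystem R) where
  open PointSystem P
  open CommutativeRing R
    hiding (zero) renaming (Carrier to C; refl to ≈-refl; sym to ≈-sym; trans to ≈-trans)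
  open RingSolver R
  open ListSums R
  open Determinant R
  open Algebra.Properties.Semiring.Exp semiring using (_^_; ^-homo-*)
  open Relation.Binary.Reasoning.Setoid setoid

  G-swap : ∀ {x y} → x ≢ y → (q x - q y) * G y x ≈ - q y
  G-swap {x} {y} x≢y = ≈-trans
    (solve 3 (λ x y g → (x :- y) :* g := :- ((y :- x) :* g)) ≈-refl _ _ _)
    (-‿cong (G-def (≡.≢-sym x≢y)))

  G-sum : ∀ {x y} → x ≢ y → G x y + G y x ≈ 1#
  G-sum {x} {y} x≢y = cancel x≢y (begin
    (q x - q y) * (G x y + G y x)               ≈⟨ distribˡ _ _ _ ⟩
    (q x - q y) * G x y + (q x - q y) * G y x   ≈⟨ +-cong (G-def x≢y) (G-swap x≢y) ⟩
    q x - q y                                   ≈⟨ *-identityʳ _ ⟨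
    (q x - q y) * 1#                            ∎)

  -- Partial fractions in `q z` for two poles, verified by clearing all three differences.
  G-three : ∀ {x y z} → z ≢ x → z ≢ y → x ≢ y →
    G z x * G z y ≈ G z x * G x y + G z y * G y x
  G-three {x} {y} {z} z≢x z≢y x≢y = cancel z≢x (cancel z≢y (cancel x≢y (begin
    (q x - q y) * ((q z - q y) * ((q z - q x) * (G z x * G z y)))
      ≈⟨ solve 5 (λ u v w g h → u :* (v :* (w :* (g :* h))) := u :* ((v :* h) :* (w :* g)))
           ≈-refl _ _ _ _ _ ⟩
    (q x - q y) * (((q z - q y) * G z y) * ((q z - q x) * G z x))
      ≈⟨ *-congˡ (*-cong (G-def z≢y) (G-def z≢x)) ⟩
    (q x - q y) * (q z * q z)
      ≈⟨ solve 3 (λ x y z → (x :- y) :* (z :* z) :=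
           (z :- y) :* (z :* x) :+ (z :- x) :* (z :* (:- y))) ≈-refl _ _ _ ⟩
    (q z - q y) * (q z * q x) + (q z - q x) * (q z * (- q y))
      ≈⟨ +-cong (*-congˡ (*-cong (G-def z≢x) (G-def x≢y)))
                (*-congˡ (*-cong (G-def z≢y) (G-swap x≢y))) ⟨
    (q z - q y) * (((q z - q x) * G z x) * ((q x - q y) * G x y)) +
    (q z - q x) * (((q z - q y) * G z y) * ((q x - q y) * G y x))
      ≈⟨ solve 7 (λ u v w gzx gxy gzy gyx →
           v :* ((w :* gzx) :* (u :* gxy)) :+ w :* ((v :* gzy) :* (u :* gyx)) :=
           u :* (v :* (w :* (gzx :* gxy :+ gzy :* gyx)))) ≈-refl _ _ _ _ _ _ _ ⟩
    (q x - q y) * ((q z - q y) * ((q z - q x) * (G z x * G x y + G z y * G y x))) ∎)))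

  -- Only differences may be cancelled by assumption; `q x - q (x + 1)` is `q x` times `1 - q 1`, so
  -- the equation is first multiplied by `1 - q 1`.
  q-cancel : ∀ x {f g} → q x * f ≈ q x * g → f ≈ g
  q-cancel x {f} {g} eq = cancel {x} {x ℕ.+ 1} (ℕ.m≢1+m+n x {0} ∘ shape) (begin
    (q x - q (x ℕ.+ 1)) * f        ≈⟨ *-congʳ (+-congˡ (-‿cong (q-+ x 1))) ⟩
    (q x - q x * q 1) * f          ≈⟨ solve 3 (λ x o f → (x :- x :* o) :* f := (:1 :- o) :* (x :* f)) ≈-refl _ _ _ ⟩
    (1# - q 1) * (q x * f)         ≈⟨ *-congˡ eq ⟩
    (1# - q 1) * (q x * g)         ≈⟨ solve 3 (λ x o f → (:1 :- o) :* (x :* f) := (x :- x :* o) :* f) ≈-refl _ _ _ ⟩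
    (q x - q x * q 1) * g          ≈⟨ *-congʳ (+-congˡ (-‿cong (q-+ x 1))) ⟨
    (q x - q (x ℕ.+ 1)) * g        ∎)
    where
    shape : x ≡ x ℕ.+ 1 → x ≡ suc (x ℕ.+ 0)
    shape p = ≡.trans p (ℕ.+-suc x 0)

  -- (qˣ - t qʸ) / (qˣ - qʸ)
  ratioG : C → ℕ → ℕ → C
  ratioG t x y = t + (1# - t) * G x y

  -- Partial fractions in the variable z.
  prod-ratio : ∀ t z X → Unique (z ∷ X) →
    prodL (ratioG t z) X ≈
    t ^ length X + (1# - t) * sumPick 1# X (λ i Y → G z i * prodL (ratioG t i) Y)
  prod-ratio t z [] _ = solve 1 (λ t → :1 := :1 :+ (:1 :- t) :* :0) ≈-refl t
  prod-ratio t z (y ∷ X) ((z≢y ∷ z∉X) ∷ (y∉X ∷ uX)) = begin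
    r * prodL (ratioG t z) X
      ≈⟨ *-congˡ (prod-ratio t z X (z∉X ∷ uX)) ⟩
    r * (tᴺ + (1# - t) * S)
      ≈⟨ solve 4 (λ r tᴺ t S → r :* (tᴺ :+ (:1 :- t) :* S) := r :* tᴺ :+ (:1 :- t) :* (r :* S))
           ≈-refl _ _ _ _ ⟩
    r * tᴺ + (1# - t) * (r * S)
      ≈⟨ +-congˡ (*-congˡ (begin
           r * S
             ≈⟨ sumPick-*ˡ r X _ ⟨
           sumPick 1# X (λ i Y → r * (G z i * prodL (ratioG t i) Y))
             ≈⟨ sumPick-cong X (λ i Y p → step i Y
                  (All.head (All-resp-↭ (↭-sym p) z∉X)) (All.head (All-resp-↭ (↭-sym p) y∉X))) ⟩
           sumPick 1# X (λ i Y → G z i * (ratioG t i y * prodL (ratioG t i) Y) +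
             ((1# - t) * G z y) * (G y i * prodL (ratioG t i) Y))
             ≈⟨ ≈-trans (sumPick-+ X _ _) (+-congˡ (sumPick-*ˡ _ X _)) ⟩
           S₁ + ((1# - t) * G z y) * S₂ ∎)) ⟩
    r * tᴺ + (1# - t) * (S₁ + ((1# - t) * G z y) * S₂)
      ≈⟨ solve 5 (λ t g tᴺ S₁ S₂ →
           (t :+ (:1 :- t) :* g) :* tᴺ :+ (:1 :- t) :* (S₁ :+ ((:1 :- t) :* g) :* S₂) :=
           t :* tᴺ :+ (:1 :- t) :* (g :* (tᴺ :+ (:1 :- t) :* S₂) :+ :1 :* S₁)) ≈-refl _ _ _ _ _ ⟩
    t * tᴺ + (1# - t) * (G z y * (tᴺ + (1# - t) * S₂) + 1# * S₁)
      ≈⟨ +-congˡ (*-congˡ (+-congʳ (*-congˡ (prod-ratio t y X (y∉X ∷ uX))))) ⟨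
    t * tᴺ + (1# - t) * (G z y * prodL (ratioG t y) X + 1# * S₁) ∎
    where
    r = ratioG t z y
    tᴺ = t ^ length X
    S = sumPick 1# X (λ i Y → G z i * prodL (ratioG t i) Y)
    S₁ = sumPick 1# X (λ i Y → G z i * (ratioG t i y * prodL (ratioG t i) Y))
    S₂ = sumPick 1# X (λ i Y → G y i * prodL (ratioG t i) Y)
    step : ∀ i Y → z ≢ i → y ≢ i → r * (G z i * prodL (ratioG t i) Y) ≈
      G z i * (ratioG t i y * prodL (ratioG t i) Y) +
      ((1# - t) * G z y) * (G y i * prodL (ratioG t i) Y)
    step i Y z≢i y≢i = begin
      (t + (1# - t) * G z y) * (G z i * p)
        ≈⟨ solve 4 (λ t gzy gzi p → (t :+ (:1 :- t) :* gzy) :* (gzi :* p) :=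
             t :* gzi :* p :+ (:1 :- t) :* (gzi :* gzy) :* p) ≈-refl _ _ _ _ ⟩
      t * G z i * p + (1# - t) * (G z i * G z y) * p
        ≈⟨ +-congˡ (*-congʳ (*-congˡ (G-three z≢i z≢y (≡.≢-sym y≢i)))) ⟩
      t * G z i * p + (1# - t) * (G z i * G i y + G z y * G y i) * p
        ≈⟨ solve 6 (λ t gzy gzi giy gyi p →
             t :* gzi :* p :+ (:1 :- t) :* (gzi :* giy :+ gzy :* gyi) :* p :=
             gzi :* ((t :+ (:1 :- t) :* giy) :* p) :+ ((:1 :- t) :* gzy) :* (gyi :* p))
             ≈-refl _ _ _ _ _ _ ⟩
      G z i * (ratioG t i y * p) + ((1# - t) * G z y) * (G y i * p) ∎
      where p = prodL (ratioG t i) Y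

  lagrange : C → List ℕ → C
  lagrange t X = sumPick 1# X (λ i Y → prodL (ratioG t i) Y)

  -- By `G-sum` the factor `ratioG t i z` equals `1 - (1 - t) G z i`. The corrections
  -- `(1 - t) G z i` cancel the sum in the partial fraction expansion of the new term.
  lagrange-∷ : ∀ t z X → Unique (z ∷ X) → lagrange t (z ∷ X) ≈ t ^ length X + lagrange t X
  lagrange-∷ t z X u@(z∉X ∷ uX) = begin
    prodL (ratioG t z) X + 1# * sumPick 1# X (λ i Y → ratioG t i z * prodL (ratioG t i) Y)
      ≈⟨ +-cong (prod-ratio t z X u) (*-congˡ (sumPick-cong X (λ i Y p →
           step i Y (All.head (All-resp-↭ (↭-sym p) z∉X))))) ⟩
    (tᴺ + (1# - t) * S) + 1# * sumPick 1# X (λ i Y →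
      prodL (ratioG t i) Y + (- (1# - t)) * (G z i * prodL (ratioG t i) Y))
      ≈⟨ +-congˡ (*-congˡ (≈-trans (sumPick-+ X _ _) (+-congˡ (sumPick-*ˡ _ X _)))) ⟩
    (tᴺ + (1# - t) * S) + 1# * (lagrange t X + (- (1# - t)) * S)
      ≈⟨ solve 4 (λ tᴺ t S l →
           (tᴺ :+ (:1 :- t) :* S) :+ :1 :* (l :+ (:- (:1 :- t)) :* S) := tᴺ :+ l) ≈-refl _ _ _ _ ⟩
    tᴺ + lagrange t X ∎
    where
    tᴺ = t ^ length X
    S = sumPick 1# X (λ i Y → G z i * prodL (ratioG t i) Y)
    step : ∀ i Y → z ≢ i → ratioG t i z * prodL (ratioG t i) Y ≈
      prodL (ratioG t i) Y + (- (1# - t)) * (G z i * prodL (ratioG t i) Y)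
    step i Y z≢i = begin
      (t + (1# - t) * G i z) * p
        ≈⟨ solve 4 (λ t g h p → (t :+ (:1 :- t) :* g) :* p :=
             t :* p :+ (:1 :- t) :* ((h :+ g) :- h) :* p) ≈-refl t (G i z) (G z i) p ⟩
      t * p + (1# - t) * ((G z i + G i z) - G z i) * p
        ≈⟨ +-congˡ (*-congʳ (*-congˡ (+-congʳ (G-sum z≢i)))) ⟩
      t * p + (1# - t) * (1# - G z i) * p
        ≈⟨ solve 3 (λ t g p → t :* p :+ (:1 :- t) :* (:1 :- g) :* p :=
             p :+ (:- (:1 :- t)) :* (g :* p)) ≈-refl _ _ _ ⟩
      p + (- (1# - t)) * (G z i * p) ∎
      where p = prodL (ratioG t i) Y

  lagrange-geometric : ∀ t X → Unique X → (1# - t) * lagrange t X ≈ 1# - t ^ length X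
  lagrange-geometric t [] _ = solve 1 (λ t → (:1 :- t) :* :0 := :1 :- :1) ≈-refl t
  lagrange-geometric t (z ∷ X) u@(_ ∷ uX) = begin
    (1# - t) * lagrange t (z ∷ X)
      ≈⟨ *-congˡ (lagrange-∷ t z X u) ⟩
    (1# - t) * (t ^ length X + lagrange t X)
      ≈⟨ distribˡ _ _ _ ⟩
    (1# - t) * t ^ length X + (1# - t) * lagrange t X
      ≈⟨ +-congˡ (lagrange-geometric t X uX) ⟩
    (1# - t) * t ^ length X + (1# - t ^ length X)
      ≈⟨ solve 2 (λ t p → (:1 :- t) :* p :+ (:1 :- p) := :1 :- t :* p) ≈-refl _ _ ⟩
    1# - t * t ^ length X ∎

  -- The Lagrange sum at `t = 0`: adding a point to a nonempty list changes it by a positive power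
  -- of `0`.
  sumPick-prod-G : ∀ z X → Unique (z ∷ X) →
    sumPick 1# (z ∷ X) (λ i Y → prodL (G i) Y) ≈ 1#
  sumPick-prod-G z X u = ≈-trans
    (sumPick-cong (z ∷ X) (λ i Y _ → prodL-cong Y (λ j →
      solve 1 (λ g → g := :0 :+ (:1 :- :0) :* g) ≈-refl (G i j))))
    (go z X u)
    where
    go : ∀ z X → Unique (z ∷ X) → lagrange 0# (z ∷ X) ≈ 1#
    go z [] u = solve 0 (:1 :+ :1 :* :0 := :1) ≈-refl
    go z (y ∷ X) u@(_ ∷ uX) = ≈-trans (lagrange-∷ 0# z (y ∷ X) u)
      (≈-trans (+-cong (zeroˡ _) (go y X uX)) (+-identityˡ 1#))

  -- Agreement is required only on genuine rearrangements of `X`, which is where distinctness of the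
  -- entries is available. The recursion runs on the length, since the lists left by `sumPick` are
  -- not structural parts of `X`.
  perms-cong : ∀ {F H : List ℕ → C} X → (∀ e → e ↭ X → F e ≈ H e) →
    sumL F (perms X) ≈ sumL H (perms X)
  perms-cong X h = go (length X) X h ≡.refl
    where
    go : ∀ n {F H : List ℕ → C} X → (∀ e → e ↭ X → F e ≈ H e) → length X ≡ n →
      sumL F (perms X) ≈ sumL H (perms X)
    go n [] h _ = +-congʳ (h [] ↭-refl)
    go (suc n) {F} {H} (x ∷ X) h eq = ≈-trans (perms-pick F x X) (≈-trans
      (sumPick-cong (x ∷ X) {λ y Y → sumL (λ e → F (y ∷ e)) (perms Y)}
        {λ y Y → sumL (λ e → H (y ∷ e)) (perms Y)} (λ y Y p →
        go n Y (λ e e↭Y → h (y ∷ e) (trans (prep y e↭Y) p))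
          (≡.trans (ℕ.suc-injective (↭-length p)) (ℕ.suc-injective eq))))
      (≈-sym (perms-pick H x X)))

  prod-upTo-suc : ∀ (f : ℕ → C) n → prodL f (upTo (suc n)) ≈ prodL f (upTo n) * f n
  prod-upTo-suc f n = begin
    prodL f (upTo (suc n))           ≡⟨ ≡.cong (prodL f) (List.upTo-∷ʳ n) ⟨
    prodL f (upTo n ++ n ∷ [])       ≈⟨ prodL-++ f (upTo n) (n ∷ []) ⟩
    prodL f (upTo n) * (f n * 1#)    ≈⟨ *-congˡ (*-identityʳ _) ⟩
    prodL f (upTo n) * f n           ∎

  -- Symmetrization of the Hall-Littlewood kernel

  module HallLittlewood (t : C) where

    -- (t ; t)ₙ
    pochT : ℕ → C
    pochT n = prodL (λ j → 1# - t ^ suc j) (upTo n)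

    arrangement : List ℕ → C
    arrangement e = prodL (λ (x , y) → ratioG t x y) (pairs e)

    cross : List ℕ → List ℕ → C
    cross I J = prodL (λ i → prodL (ratioG t i) J) I

    arrangement-∷ : ∀ x e → arrangement (x ∷ e) ≈ prodL (ratioG t x) e * arrangement e
    arrangement-∷ x e = ≈-trans (prodL-++ _ (map (x ,_) e) (pairs e))
      (*-congʳ (reflexive (prodL-map _ (x ,_) e)))

    arrangement-++ : ∀ e e′ →
      arrangement (e ++ e′) ≈ cross e e′ * (arrangement e * arrangement e′)
    arrangement-++ [] e′ = solve 1 (λ a → a := :1 :* (:1 :* a)) ≈-refl _
    arrangement-++ (x ∷ e) e′ = begin
      arrangement (x ∷ e ++ e′)
        ≈⟨ arrangement-∷ x (e ++ e′) ⟩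
      prodL (ratioG t x) (e ++ e′) * arrangement (e ++ e′)
        ≈⟨ *-cong (prodL-++ _ e e′) (arrangement-++ e e′) ⟩
      (prodL (ratioG t x) e * prodL (ratioG t x) e′) *
        (cross e e′ * (arrangement e * arrangement e′))
        ≈⟨ solve 5 (λ u v w y z → (u :* v) :* (w :* (y :* z)) := (v :* w) :* ((u :* y) :* z))
             ≈-refl _ _ _ _ _ ⟩
      (prodL (ratioG t x) e′ * cross e e′) *
        ((prodL (ratioG t x) e * arrangement e) * arrangement e′)
        ≈⟨ *-congˡ (*-congʳ (arrangement-∷ x e)) ⟨
      cross (x ∷ e) e′ * (arrangement (x ∷ e) * arrangement e′) ∎

    cross-↭ : ∀ {I I′ J J′} → I ↭ I′ → J ↭ J′ → cross I J ≈ cross I′ J′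
    cross-↭ {I′ = I′} p p′ = ≈-trans (prodL-↭ _ p) (prodL-cong I′ (λ i → prodL-↭ _ p′))

    -- With the first entry fixed, the remaining sum depends only on the number of points by
    -- induction, so the sum over the first entry is a Lagrange sum. The result is independent of
    -- the points, which is what makes the unweighted sums explicit.
    sum-arrangements : ∀ X → Unique X →
      (1# - t) ^ length X * sumL arrangement (perms X) ≈ pochT (length X)
    sum-arrangements X u = go (length X) X u ≡.refl
      where
      go : ∀ n X → Unique X → length X ≡ n →
        (1# - t) ^ n * sumL arrangement (perms X) ≈ pochT n
      go zero [] u _ = solve 0 (:1 :* (:1 :+ :0) := :1) ≈-refl
      go (suc n) X@(x ∷ X₀) u eq = begin
        ((1# - t) * (1# - t) ^ n) * sumL arrangement (perms X)
          ≈⟨ *-congˡ (perms-pick arrangement x X₀) ⟩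
        ((1# - t) * (1# - t) ^ n) *
          sumPick 1# X (λ y Y → sumL (λ e → arrangement (y ∷ e)) (perms Y))
          ≈⟨ *-congˡ (sumPick-cong X {g = λ y Y → prodL (ratioG t y) Y * sumL arrangement (perms Y)}
               (λ y Y _ → ≈-trans
               (perms-cong Y (λ e e↭Y → ≈-trans (arrangement-∷ y e) (*-congʳ (prodL-↭ _ e↭Y))))
               (sumL-*ˡ _ arrangement (perms Y)))) ⟩
        ((1# - t) * (1# - t) ^ n) *
          sumPick 1# X (λ y Y → prodL (ratioG t y) Y * sumL arrangement (perms Y))
          ≈⟨ *-assoc _ _ _ ⟩
        (1# - t) * ((1# - t) ^ n *
          sumPick 1# X (λ y Y → prodL (ratioG t y) Y * sumL arrangement (perms Y)))
          ≈⟨ *-congˡ (sumPick-*ˡ _ X (λ y Y → prodL (ratioG t y) Y * sumL arrangement (perms Y))) ⟨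
        (1# - t) * sumPick 1# X (λ y Y →
          (1# - t) ^ n * (prodL (ratioG t y) Y * sumL arrangement (perms Y)))
          ≈⟨ *-congˡ (sumPick-cong X {g = λ y Y → prodL (ratioG t y) Y * pochT n} (λ y Y p → ≈-trans
               (solve 3 (λ a b c → a :* (b :* c) := b :* (a :* c)) ≈-refl _ _ _)
               (*-congˡ (go n Y (tail (Unique-resp-↭ (↭-sym p) u))
                 (≡.trans (ℕ.suc-injective (↭-length p)) (ℕ.suc-injective eq)))))) ⟩
        (1# - t) * sumPick 1# X (λ y Y → prodL (ratioG t y) Y * pochT n)
          ≈⟨ *-congˡ (sumPick-*ʳ _ X (λ y Y → prodL (ratioG t y) Y)) ⟩
        (1# - t) * (lagrange t X * pochT n)
          ≈⟨ *-assoc _ _ _ ⟨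
        ((1# - t) * lagrange t X) * pochT n
          ≈⟨ *-congʳ (lagrange-geometric t X u) ⟩
        (1# - t ^ length X) * pochT n
          ≡⟨ ≡.cong (λ k → (1# - t ^ k) * pochT n) eq ⟩
        (1# - t ^ suc n) * pochT n
          ≈⟨ *-comm _ _ ⟩
        pochT n * (1# - t ^ suc n)
          ≈⟨ prod-upTo-suc _ n ⟨
        pochT (suc n) ∎
        where
        tail : ∀ {y Y} → Unique (y ∷ Y) → Unique Y
        tail (_ ∷ uY) = uY

    unique-split : ∀ {X} I J → Unique X → I ++ J ↭ X → Unique I × Unique J
    unique-split I J u p = go I (Unique-resp-↭ (↭-sym p) u)
      where
      split-All : ∀ {P : ℕ → Set} I {J} → All P (I ++ J) → All P I
      split-All [] _ = []
      split-All (x ∷ I) (px ∷ ps) = px ∷ split-All I ps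
      go : ∀ I {J} → Unique (I ++ J) → Unique I × Unique J
      go [] u = [] , u
      go (x ∷ I) (x∉ ∷ u) = let uI , uJ = go I u in (split-All I x∉ ∷ uI) , uJ

    -- The weight sees only which points occupy the first `r` positions, so the orders within `I`
    -- and within `J` are summed out separately by `sum-arrangements`, leaving the factor
    -- `cross I J` between the blocks.
    weighted-sum : ∀ (w : ℕ → C) (W : List ℕ → C) X r → Unique X → r ℕ.≤ length X →
      (∀ I J → I ++ J ↭ X → length I ≡ r → W (I ++ J) ≈ prodL w I) →
      (1# - t) ^ length X * sumL (λ e → W e * arrangement e) (perms X) ≈
      sumSplit X r (λ I J → prodL w I * cross I J) * (pochT r * pochT (length X ∸ r))
    weighted-sum w W X r u r≤ W-def = begin
      s ^ N * sumL (λ e → W e * arrangement e) (perms X)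
        ≈⟨ *-congˡ (perms-split _ X r r≤) ⟩
      s ^ N * sumSplit X r (λ I J → sumL (λ e₁ → sumL (λ e₂ →
        W (e₁ ++ e₂) * arrangement (e₁ ++ e₂)) (perms J)) (perms I))
        ≈⟨ *-congˡ (sumSplit-cong X r factor) ⟩
      s ^ N * sumSplit X r (λ I J → (prodL w I * cross I J) * (σ I * σ J))
        ≈⟨ ≈-trans (*-comm _ _) (≈-sym (sumSplit-*ʳ (s ^ N) X r _)) ⟩
      sumSplit X r (λ I J → ((prodL w I * cross I J) * (σ I * σ J)) * s ^ N)
        ≈⟨ sumSplit-cong X r evaluate ⟩
      sumSplit X r (λ I J → (prodL w I * cross I J) * (pochT r * pochT (N ∸ r)))
        ≈⟨ sumSplit-*ʳ _ X r _ ⟩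
      sumSplit X r (λ I J → prodL w I * cross I J) * (pochT r * pochT (N ∸ r)) ∎
      where
      s = 1# - t
      N = length X
      σ : List ℕ → C
      σ I = sumL arrangement (perms I)

      factor : ∀ I J → I ++ J ↭ X → length I ≡ r →
        sumL (λ e₁ → sumL (λ e₂ → W (e₁ ++ e₂) * arrangement (e₁ ++ e₂)) (perms J)) (perms I) ≈
        (prodL w I * cross I J) * (σ I * σ J)
      factor I J p len = begin
        sumL (λ e₁ → sumL (λ e₂ → W (e₁ ++ e₂) * arrangement (e₁ ++ e₂)) (perms J)) (perms I)
          ≈⟨ perms-cong I (λ e₁ q₁ → perms-cong J (λ e₂ q₂ → *-cong
               (≈-trans (W-def e₁ e₂ (trans (++⁺ q₁ q₂) p) (≡.trans (↭-length q₁) len)) (prodL-↭ w q₁))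
               (≈-trans (arrangement-++ e₁ e₂) (*-congʳ (cross-↭ q₁ q₂))))) ⟩
        sumL (λ e₁ → sumL (λ e₂ →
          prodL w I * (cross I J * (arrangement e₁ * arrangement e₂))) (perms J)) (perms I)
          ≈⟨ sumL-cong (perms I) (λ e₁ → ≈-trans
               (sumL-cong (perms J) (λ e₂ →
                 solve 4 (λ w k a b → w :* (k :* (a :* b)) := ((w :* k) :* a) :* b) ≈-refl _ _ _ _))
               (≈-trans (sumL-*ˡ _ arrangement (perms J)) (*-assoc _ _ _))) ⟩
        sumL (λ e₁ → (prodL w I * cross I J) * (arrangement e₁ * σ J)) (perms I)
          ≈⟨ ≈-trans (sumL-*ˡ _ _ (perms I)) (*-congˡ (sumL-*ʳ (σ J) arrangement (perms I))) ⟩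
        (prodL w I * cross I J) * (σ I * σ J) ∎

      evaluate : ∀ I J → I ++ J ↭ X → length I ≡ r →
        ((prodL w I * cross I J) * (σ I * σ J)) * s ^ N ≈
        (prodL w I * cross I J) * (pochT r * pochT (N ∸ r))
      evaluate I J p len = begin
        ((prodL w I * cross I J) * (σ I * σ J)) * s ^ N
          ≡⟨ ≡.cong (λ k → ((prodL w I * cross I J) * (σ I * σ J)) * s ^ k)
               (≡.trans (≡.sym (↭-length p)) (List.length-++ I)) ⟩
        ((prodL w I * cross I J) * (σ I * σ J)) * s ^ (length I ℕ.+ length J)
          ≈⟨ *-congˡ (^-homo-* s (length I) (length J)) ⟩
        ((prodL w I * cross I J) * (σ I * σ J)) * (s ^ length I * s ^ length J)
          ≈⟨ solve 5 (λ w i j u v → (w :* (i :* j)) :* (u :* v) := w :* ((u :* i) :* (v :* j)))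
               ≈-refl _ _ _ _ _ ⟩
        (prodL w I * cross I J) * ((s ^ length I * σ I) * (s ^ length J * σ J))
          ≈⟨ *-congˡ (*-cong (sum-arrangements I (proj₁ (unique-split I J u p)))
                             (sum-arrangements J (proj₂ (unique-split I J u p)))) ⟩
        (prodL w I * cross I J) * (pochT (length I) * pochT (length J))
          ≡⟨ ≡.cong₂ (λ a b → (prodL w I * cross I J) * (pochT a * pochT b)) len
               (≡.trans (≡.sym (ℕ.m+n∸m≡n (length I) (length J)))
                 (≡.cong₂ _∸_ (≡.trans (≡.sym (List.length-++ I)) (↭-length p)) len)) ⟩
        (prodL w I * cross I J) * (pochT r * pochT (N ∸ r)) ∎

  -- Vandermonde determinants by interpolation

  vander : List ℕ → C
  vander [] = 1#
  vander (x ∷ X) = prodL (λ y → q x - q y) X * vander X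

  -- The factors of `vander X` that involve `i` cancel the denominators of `prodL (G i) Y`, leaving
  -- one `q i` for each entry of `Y` and one sign for each entry before `i`. The free weight `w`
  -- stores what earlier entries contribute during the induction.
  vander-pick : ∀ (w : ℕ → List ℕ → C) X → Unique X →
    sumPick 1# X (λ i Y → w i Y * (vander X * prodL (G i) Y)) ≈
    sumPick (- 1#) X (λ i Y → w i Y * (q i ^ length Y * vander Y))
  vander-pick w [] _ = ≈-refl
  vander-pick w (x ∷ X) (x∉X ∷ uX) = +-cong
    (*-congˡ (≈-trans
      (solve 3 (λ p v g → (p :* v) :* g := (p :* g) :* v) ≈-refl _ _ _)
      (*-congʳ (head X x∉X))))
    (begin
      1# * sumPick 1# X (λ i Y → w i (x ∷ Y) * ((prodL (δ x) X * vander X) * (G i x * prodL (G i) Y)))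
        ≈⟨ ≈-trans (*-identityˡ _) (sumPick-cong X (λ i Y p →
             tail i Y p (All.head (All-resp-↭ (↭-sym p) x∉X)))) ⟩
      sumPick 1# X (λ i Y → (w i (x ∷ Y) * ((- q i) * prodL (δ x) Y)) * (vander X * prodL (G i) Y))
        ≈⟨ vander-pick (λ i Y → w i (x ∷ Y) * ((- q i) * prodL (δ x) Y)) X uX ⟩
      sumPick (- 1#) X (λ i Y → (w i (x ∷ Y) * ((- q i) * prodL (δ x) Y)) * (q i ^ length Y * vander Y))
        ≈⟨ sumPick-cong X (λ i Y _ → solve 5 (λ w q p m v →
             (w :* ((:- q) :* p)) :* (m :* v) := (:- :1) :* (w :* ((q :* m) :* (p :* v))))
             ≈-refl (w i (x ∷ Y)) (q i) (prodL (δ x) Y) (q i ^ length Y) (vander Y)) ⟩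
      sumPick (- 1#) X (λ i Y → (- 1#) * (w i (x ∷ Y) * (q i ^ suc (length Y) * vander (x ∷ Y))))
        ≈⟨ sumPick-*ˡ _ X _ ⟩
      (- 1#) * sumPick (- 1#) X (λ i Y → w i (x ∷ Y) * (q i ^ suc (length Y) * vander (x ∷ Y))) ∎)
    where
    δ : ℕ → ℕ → C
    δ x y = q x - q y
    head : ∀ Y → All (x ≢_) Y → prodL (δ x) Y * prodL (G x) Y ≈ q x ^ length Y
    head [] [] = *-identityˡ 1#
    head (y ∷ Y) (x≢y ∷ x∉Y) = ≈-trans
      (*-interchange _ _ _ _)
      (*-cong (G-def x≢y) (head Y x∉Y))
    tail : ∀ i Y → i ∷ Y ↭ X → x ≢ i →
      w i (x ∷ Y) * ((prodL (δ x) X * vander X) * (G i x * prodL (G i) Y)) ≈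
      (w i (x ∷ Y) * ((- q i) * prodL (δ x) Y)) * (vander X * prodL (G i) Y)
    tail i Y p x≢i = begin
      w i (x ∷ Y) * ((prodL (δ x) X * vander X) * (G i x * prodL (G i) Y))
        ≈⟨ *-congˡ (*-congʳ (*-congʳ (prodL-↭ (δ x) p))) ⟨
      w i (x ∷ Y) * (((δ x i * prodL (δ x) Y) * vander X) * (G i x * prodL (G i) Y))
        ≈⟨ solve 6 (λ w e p v g r → w :* (((e :* p) :* v) :* (g :* r)) :=
             (w :* ((e :* g) :* p)) :* (v :* r)) ≈-refl _ _ _ _ _ _ ⟩
      (w i (x ∷ Y) * ((δ x i * G i x) * prodL (δ x) Y)) * (vander X * prodL (G i) Y)
        ≈⟨ *-congʳ (*-congˡ (*-congʳ (G-swap x≢i))) ⟩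
      (w i (x ∷ Y) * ((- q i) * prodL (δ x) Y)) * (vander X * prodL (G i) Y) ∎

  -- The exponents descend, so the first column holds the highest power. Expansion along it is the
  -- alternating sum of `vander-pick`, which is `vander X` times a Lagrange sum at `t = 0`, that is,
  -- times 1.
  vandermonde : ∀ n X → length X ≡ n → Unique X →
    det (λ x b → q x ^ b) X (downFrom n) ≈ vander X
  vandermonde zero [] _ _ = ≈-refl
  vandermonde (suc n) X@(x ∷ X₀) eq u = begin
    det (λ x b → q x ^ b) X (n ∷ downFrom n)
      ≈⟨ det-column _ X n (downFrom n) ⟩
    sumPick (- 1#) X (λ i Y → q i ^ n * det (λ x b → q x ^ b) Y (downFrom n))
      ≈⟨ sumPick-cong X {g = λ i Y → 1# * (q i ^ length Y * vander Y)} (λ i Y p → step i Y p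
           (≡.trans (ℕ.suc-injective (↭-length p)) (ℕ.suc-injective eq))
           (Unique-resp-↭ (↭-sym p) u)) ⟩
    sumPick (- 1#) X (λ i Y → 1# * (q i ^ length Y * vander Y))
      ≈⟨ vander-pick (λ _ _ → 1#) X u ⟨
    sumPick 1# X (λ i Y → 1# * (vander X * prodL (G i) Y))
      ≈⟨ sumPick-cong X {g = λ i Y → vander X * prodL (G i) Y} (λ i Y _ → *-identityˡ _) ⟩
    sumPick 1# X (λ i Y → vander X * prodL (G i) Y)
      ≈⟨ sumPick-*ˡ (vander X) X (λ i Y → prodL (G i) Y) ⟩
    vander X * sumPick 1# X (λ i Y → prodL (G i) Y)
      ≈⟨ *-congˡ (sumPick-prod-G x X₀ u) ⟩
    vander X * 1#
      ≈⟨ *-identityʳ _ ⟩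
    vander X ∎
    where
    step : ∀ i Y → i ∷ Y ↭ X → length Y ≡ n → Unique (i ∷ Y) →
      q i ^ n * det (λ x b → q x ^ b) Y (downFrom n) ≈ 1# * (q i ^ length Y * vander Y)
    step i Y p len (_ ∷ uY) = ≈-trans
      (*-cong (reflexive (≡.cong (q i ^_) (≡.sym len))) (vandermonde n Y len uY))
      (≈-sym (*-identityˡ _))

-- Products over pairs of residue chains

-- The binomial coefficient `c C 2`.
tri : ℕ → ℕ
tri zero = 0
tri (suc c) = tri c ℕ.+ c

chain-∷ʳ : ∀ d a c → chain d a (suc c) ≡ chain d a c ++ (c ℕ.* d ℕ.+ a) ∷ []
chain-∷ʳ d a zero = ≡.refl
chain-∷ʳ d a (suc c) = ≡.cong (a ∷_) (≡.trans (chain-∷ʳ d (a ℕ.+ d) c)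
  (≡.cong (λ y → chain d (a ℕ.+ d) c ++ y ∷ []) (≡.sym (chain-next d a c))))

module Residues (d : ℕ) where
  open import Data.Nat using (_+_; _*_; _≤_; _<_)

  point : ℕ × ℕ → ℕ
  point (a , c) = c * d + a

  -- The least e ≥ 1 congruent to a - b modulo d, for a , b < d.
  gap : ℕ → ℕ → ℕ
  gap a b = if b ℕ.<ᵇ a then a ∸ b else d ∸ (b ∸ a)

  descent : ℕ → ℕ → ℕ
  descent a b = if b ℕ.<ᵇ a then 1 else 0

  -- Identifies the exponent of the factor that `D a b c` gains when `c` increases by one; stated
  -- additively to avoid truncated subtraction.
  gap-descent : ∀ {a b} c → a < d → b < d →
    (gap a b + d * (descent a b + c)) + b ≡ (c * d + a) + d
  gap-descent {a} {b} c a<d b<d with b ℕ.<ᵇ a in eq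
  ... | true = begin
    ((a ∸ b) + d * suc c) + b
      ≡⟨ solve 4 (λ x b d c → (x :+ d :* (con 1 :+ c)) :+ b := (c :* d :+ (x :+ b)) :+ d)
           ≡.refl (a ∸ b) b d c ⟩
    (c * d + ((a ∸ b) + b)) + d
      ≡⟨ ≡.cong (λ x → (c * d + x) + d)
           (ℕ.m∸n+n≡m (ℕ.<⇒≤ (ℕ.<ᵇ⇒< b a (≡.subst T (≡.sym eq) _)))) ⟩
    (c * d + a) + d ∎
    where open ≡.≡-Reasoning
          open +-*-Solver
  ... | false = begin
    ((d ∸ (b ∸ a)) + d * c) + b
      ≡⟨ ≡.cong (((d ∸ (b ∸ a)) + d * c) +_) (ℕ.m∸n+n≡m a≤b) ⟨
    ((d ∸ (b ∸ a)) + d * c) + ((b ∸ a) + a)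
      ≡⟨ solve 5 (λ x y a d c → (x :+ d :* c) :+ (y :+ a) := (c :* d :+ a) :+ (x :+ y))
           ≡.refl (d ∸ (b ∸ a)) (b ∸ a) a d c ⟩
    (c * d + a) + ((d ∸ (b ∸ a)) + (b ∸ a))
      ≡⟨ ≡.cong ((c * d + a) +_)
           (ℕ.m∸n+n≡m (ℕ.≤-trans (ℕ.m∸n≤m b a) (ℕ.<⇒≤ b<d))) ⟩
    (c * d + a) + d ∎
    where
    open ≡.≡-Reasoning
    open +-*-Solver
    a≤b : a ≤ b
    a≤b = ℕ.≮⇒≥ (λ b<a → ≡.subst T eq (ℕ.<⇒<ᵇ b<a))

  Separated : ℕ → ℕ → Set
  Separated a b = ∀ k l → k * d + a ≢ l * d + b

  -- (a , c) stands for the chain a , a + d , …, a + (c - 1) d.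
  Decreasing : List (ℕ × ℕ) → Set
  Decreasing = AllPairs (λ (a , _) (b , _) → b < a)

  Bounded : List (ℕ × ℕ) → Set
  Bounded = All (λ (a , _) → a < d)

  -- Exponents and sign in `Ψ-vander`, obtained by accumulating the steps of `Ψ-suc`: lengthening
  -- the chain of `x` contributes `point y` on the left, and `point x` and one sign on the right.
  pairL pairR pairS : ℕ × ℕ → ℕ × ℕ → ℕ
  pairL (a , c) (b , c′) = (c * b + (c′ * a + d * (c * c′))) + b
  pairR (a , c) (b , c′) = (c * a + c′ * b) + d * (tri c + tri c′)
  pairS (a , c) (b , c′) = suc (c + c′)

  module PairSteps where
    open +-*-Solver

    pairL-sucˡ : ∀ (x y : ℕ × ℕ) → let (a , c) = x in pairL (a , suc c) y ≡ pairL x y + point y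
    pairL-sucˡ (a , c) (b , c′) = solve 5 (λ a b c c′ d →
      (((con 1 :+ c) :* b :+ (c′ :* a :+ d :* ((con 1 :+ c) :* c′))) :+ b) :=
      ((c :* b :+ (c′ :* a :+ d :* (c :* c′))) :+ b) :+ (c′ :* d :+ b)) ≡.refl a b c c′ d

    pairR-sucˡ : ∀ (x y : ℕ × ℕ) → let (a , c) = x in pairR (a , suc c) y ≡ pairR x y + point x
    pairR-sucˡ (a , c) (b , c′) = solve 7 (λ a b c c′ d t t′ →
      ((con 1 :+ c) :* a :+ c′ :* b) :+ d :* ((t :+ c) :+ t′) :=
      ((c :* a :+ c′ :* b) :+ d :* (t :+ t′)) :+ (c :* d :+ a)) ≡.refl a b c c′ d (tri c) (tri c′)

    pairL-sucʳ : ∀ a (y : ℕ × ℕ) → let (b , c′) = y in pairL (a , 0) (b , suc c′) ≡ pairL (a , 0) y + a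
    pairL-sucʳ a (b , c′) = solve 4 (λ a b c′ d →
      (((con 1 :+ c′) :* a :+ d :* con 0) :+ b) :=
      ((c′ :* a :+ d :* con 0) :+ b) :+ a) ≡.refl a b c′ d

    pairR-sucʳ : ∀ a (y : ℕ × ℕ) → let (b , c′) = y in pairR (a , 0) (b , suc c′) ≡ pairR (a , 0) y + point y
    pairR-sucʳ a (b , c′) = solve 5 (λ a b c′ d t′ →
      ((con 1 :+ c′) :* b) :+ d :* (t′ :+ c′) :=
      ((c′ :* b) :+ d :* t′) :+ (c′ :* d :+ b)) ≡.refl a b c′ d (tri c′)

  sumPairs : (ℕ × ℕ → ℕ × ℕ → ℕ) → List (ℕ × ℕ) → ℕ
  sumPairs f [] = 0
  sumPairs f (x ∷ xs) = sum (map (f x) xs) + sumPairs f xs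

module ChainProducts {c ℓ} (R : CommutativeRing c ℓ) (P : PointSystem R) (d : ℕ) where
  open PointSystem P
  open CommutativeRing R
    hiding (zero) renaming (Carrier to C; refl to ≈-refl; sym to ≈-sym; trans to ≈-trans)
  open RingSolver R
  open ListSums R
  open Points R P
  open Residues d
  open PairSteps
  open Algebra.Properties.Semiring.Exp semiring using (_^_; ^-homo-*)
  open Relation.Binary.Reasoning.Setoid setoid

  q-cong : ∀ {x y} → x ≡ y → q x ≈ q y
  q-cong p = reflexive (≡.cong q p)

  poch : ℕ → ℕ → C
  poch e L = prodL (λ j → 1# - q (e ℕ.+ d ℕ.* j)) (upTo L)

  -- What the product of the ratios over `i` in the chain and `j` in `y , y + d , …` leaves after
  -- telescoping.
  F : ℕ → ℕ → ℕ → C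
  F a c y = prodL (λ i → G i y) (chain d a c)

  -- For `a , b < d`, the product of `1 - qᵉ` over all `e ≥ 1` congruent to `a - b` modulo `d` with
  -- `e ≤ c d + a - b`. The extra factor counted by `descent` is the one with `e = a - b`.
  D : ℕ → ℕ → ℕ → C
  D a b c = poch (gap a b) (descent a b ℕ.+ c)

  F-suc : ∀ a c y → F a (suc c) y ≈ F a c y * G (c ℕ.* d ℕ.+ a) y
  F-suc a c y = begin
    F a (suc c) y
      ≡⟨ ≡.cong (prodL (λ i → G i y)) (chain-∷ʳ d a c) ⟩
    prodL (λ i → G i y) (chain d a c ++ (c ℕ.* d ℕ.+ a) ∷ [])
      ≈⟨ prodL-++ _ (chain d a c) _ ⟩
    F a c y * (G (c ℕ.* d ℕ.+ a) y * 1#)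
      ≈⟨ *-congˡ (*-identityʳ _) ⟩
    F a c y * G (c ℕ.* d ℕ.+ a) y ∎

  D-suc : ∀ {a b} c δ → a ℕ.< d → b ℕ.< d → δ ℕ.+ b ≡ (c ℕ.* d ℕ.+ a) ℕ.+ d →
    D a b (suc c) ≈ D a b c * (1# - q δ)
  D-suc {a} {b} c δ a<d b<d eq = begin
    poch (gap a b) (descent a b ℕ.+ suc c)
      ≡⟨ ≡.cong (poch (gap a b)) (ℕ.+-suc (descent a b) c) ⟩
    poch (gap a b) (suc (descent a b ℕ.+ c))
      ≈⟨ prod-upTo-suc _ (descent a b ℕ.+ c) ⟩
    D a b c * (1# - q (gap a b ℕ.+ d ℕ.* (descent a b ℕ.+ c)))
      ≈⟨ *-congˡ (+-congˡ (-‿cong (q-cong (ℕ.+-cancelʳ-≡ b _ δ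
           (≡.trans (gap-descent c a<d b<d) (≡.sym eq)))))) ⟩
    D a b c * (1# - q δ) ∎

  G-shift : ∀ {x y} → x ≢ y → G (x ℕ.+ d) (y ℕ.+ d) ≈ G x y
  G-shift {x} {y} x≢y = cancel x+d≢y+d (begin
    (q (x ℕ.+ d) - q (y ℕ.+ d)) * G (x ℕ.+ d) (y ℕ.+ d)
      ≈⟨ G-def x+d≢y+d ⟩
    q (x ℕ.+ d)
      ≈⟨ q-+ x d ⟩
    q x * q d
      ≈⟨ *-congʳ (G-def x≢y) ⟨
    ((q x - q y) * G x y) * q d
      ≈⟨ solve 4 (λ x y g d → ((x :- y) :* g) :* d := (x :* d :- y :* d) :* g) ≈-refl _ _ _ _ ⟩
    (q x * q d - q y * q d) * G x y
      ≈⟨ *-congʳ (+-cong (q-+ x d) (-‿cong (q-+ y d))) ⟨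
    (q (x ℕ.+ d) - q (y ℕ.+ d)) * G x y ∎)
    where
    x+d≢y+d : x ℕ.+ d ≢ y ℕ.+ d
    x+d≢y+d eq = x≢y (ℕ.+-cancelʳ-≡ d x y eq)

  G-forward : ∀ {b y} δ → δ ≢ 0 → δ ℕ.+ b ≡ y → G b y * (1# - q δ) ≈ 1#
  G-forward {b} δ δ≢0 ≡.refl = q-cancel b (begin
    q b * (G b (δ ℕ.+ b) * (1# - q δ))
      ≈⟨ solve 3 (λ b g δ → b :* (g :* (:1 :- δ)) := (b :- δ :* b) :* g) ≈-refl _ _ _ ⟩
    (q b - q δ * q b) * G b (δ ℕ.+ b)
      ≈⟨ *-congʳ (+-congˡ (-‿cong (q-+ δ b))) ⟨
    (q b - q (δ ℕ.+ b)) * G b (δ ℕ.+ b)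
      ≈⟨ G-def (λ eq → δ≢0 (ℕ.+-cancelʳ-≡ b δ 0 (≡.sym eq))) ⟩
    q b
      ≈⟨ *-identityʳ _ ⟨
    q b * 1# ∎)

  F-shift : ∀ a c y → (∀ k → k ℕ.< c → k ℕ.* d ℕ.+ a ≢ y) → F (a ℕ.+ d) c (y ℕ.+ d) ≈ F a c y
  F-shift a zero y sep = ≈-refl
  F-shift a (suc c) y sep = *-cong (G-shift (sep 0 (s≤s z≤n)))
    (F-shift (a ℕ.+ d) c y (λ k k<c eq → sep (suc k) (s≤s k<c) (≡.trans (chain-next d a k) eq)))

  -- Both sides are `F a (suc c) (y + d)`, with either the last or the first entry split off; the
  -- remainder of the second is translated back by `d`.
  F-move : ∀ a c y → (∀ k → k ℕ.* d ℕ.+ a ≢ y) →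
    G (c ℕ.* d ℕ.+ a) (y ℕ.+ d) * F a c (y ℕ.+ d) ≈ G a (y ℕ.+ d) * F a c y
  F-move a c y sep = ≈-trans (*-comm _ _) (≈-trans (≈-sym (F-suc a c (y ℕ.+ d)))
    (*-congˡ (F-shift a c y (λ k _ → sep k))))

  Ψ : ℕ × ℕ → ℕ × ℕ → C
  Ψ (a , c) (b , c′) =
    (F a c (point (b , c′)) * F b c′ (point (a , c))) * (D a b c * D b a c′)

  Ψ-comm : ∀ x y → Ψ x y ≈ Ψ y x
  Ψ-comm x y = *-cong (*-comm _ _) (*-comm _ _)

  -- Lengthening a chain changes Ψ / (q ya - q yb) by a sign and a monomial.
  Ψ-suc : ∀ {a b} c c′ → a ℕ.< d → b ℕ.< d → Separated a b →
    let ya = point (a , c); yb = point (b , c′); ya⁺ = point (a , suc c) in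
    q yb * (Ψ (a , suc c) (b , c′) * (q ya - q yb)) ≈
    - (q ya * (Ψ (a , c) (b , c′) * (q ya⁺ - q yb)))
  Ψ-suc {a} {b} c c′ a<d b<d sep rewrite ≡.sym (chain-end d a c) = begin
    q yb * (((F a (suc c) yb * F b c′ (ya ℕ.+ d)) * (D a b (suc c) * D b a c′)) * (q ya - q yb))
      ≈⟨ *-congˡ (*-congʳ (*-cong (*-congʳ (F-suc a c yb))
           (*-congʳ (D-suc c δ a<d b<d δ+b)))) ⟩
    q yb * ((((F a c yb * G ya yb) * F b c′ (ya ℕ.+ d)) *
      ((D a b c * (1# - q δ)) * D b a c′)) * (q ya - q yb))
      ≈⟨ solve 8 (λ yb fa g fb da u db v →
           yb :* (((fa :* g) :* fb) :* ((da :* u) :* db) :* v) :=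
           ((v :* g) :* (yb :* fb)) :* (fa :* ((da :* u) :* db))) ≈-refl _ _ _ _ _ _ _ _ ⟩
    (((q ya - q yb) * G ya yb) * (q yb * F b c′ (ya ℕ.+ d))) *
      (F a c yb * ((D a b c * (1# - q δ)) * D b a c′))
      ≈⟨ *-congʳ (*-cong (G-def (sep c c′)) (begin
           q yb * F b c′ (ya ℕ.+ d)
             ≈⟨ *-congʳ (G-def yb≢) ⟨
           ((q yb - q (ya ℕ.+ d)) * G yb (ya ℕ.+ d)) * F b c′ (ya ℕ.+ d)
             ≈⟨ ≈-trans (*-assoc _ _ _) (*-congˡ (F-move b c′ ya (λ k → ≡.≢-sym (sep c k)))) ⟩
           (q yb - q (ya ℕ.+ d)) * (G b (ya ℕ.+ d) * F b c′ ya) ∎)) ⟩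
    (q ya * ((q yb - q (ya ℕ.+ d)) * (G b (ya ℕ.+ d) * F b c′ ya))) *
      (F a c yb * ((D a b c * (1# - q δ)) * D b a c′))
      ≈⟨ solve 9 (λ ya yb yd g fb fa da u db →
           (ya :* ((yb :- yd) :* (g :* fb))) :* (fa :* ((da :* u) :* db)) :=
           (ya :* (yb :- yd)) :* (((fa :* fb) :* (da :* db)) :* (g :* u))) ≈-refl _ _ _ _ _ _ _ _ _ ⟩
    (q ya * (q yb - q (ya ℕ.+ d))) *
      (((F a c yb * F b c′ ya) * (D a b c * D b a c′)) * (G b (ya ℕ.+ d) * (1# - q δ)))
      ≈⟨ *-congˡ (*-congˡ (G-forward δ δ≢0 δ+b)) ⟩
    (q ya * (q yb - q (ya ℕ.+ d))) * (Ψ (a , c) (b , c′) * 1#)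
      ≈⟨ solve 4 (λ ya yb yd p → (ya :* (yb :- yd)) :* (p :* :1) := :- (ya :* (p :* (yd :- yb))))
           ≈-refl _ _ _ _ ⟩
    - (q ya * (Ψ (a , c) (b , c′) * (q (ya ℕ.+ d) - q yb))) ∎
    where
    ya = point (a , c)
    yb = point (b , c′)
    δ = (ya ℕ.+ d) ∸ b
    b<ya+d : b ℕ.< ya ℕ.+ d
    b<ya+d = ℕ.<-≤-trans b<d (ℕ.m≤n+m d ya)
    δ+b : δ ℕ.+ b ≡ ya ℕ.+ d
    δ+b = ℕ.m∸n+n≡m (ℕ.<⇒≤ b<ya+d)
    δ≢0 : δ ≢ 0
    δ≢0 eq = ℕ.<-irrefl (≡.trans (≡.cong (ℕ._+ b) (≡.sym eq)) δ+b) b<ya+d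
    yb≢ : yb ≢ ya ℕ.+ d
    yb≢ eq = sep (suc c) c′ (≡.trans (≡.sym (chain-end d a c)) (≡.sym eq))

  sgn : ℕ → C
  sgn k = (- 1#) ^ k

  -- Induction on `c`, then on `c′` with the first chain empty; `Ψ-suc` gives each step once the old
  -- difference of points is cancelled. For two empty chains only `D a b 0`, which is
  -- `1 - q (a - b)`, remains, and `q b` times it is `- (q a - q b)`.
  Ψ-vander : ∀ {a b} c c′ → b ℕ.< a → a ℕ.< d → b ℕ.< d → Separated a b →
    let x = a , c; y = b , c′ in
    q (pairL x y) * Ψ x y ≈ sgn (pairS x y) * (q (pairR x y) * (q (point x) - q (point y)))
  Ψ-vander {a} {b} zero zero b<a a<d b<d sep with b ℕ.<ᵇ a in eq₁ | a ℕ.<ᵇ b in eq₂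
  ... | false | _ = ⊥-elim (≡.subst T eq₁ (ℕ.<⇒<ᵇ b<a))
  ... | true | true = ⊥-elim (ℕ.<-asym b<a (ℕ.<ᵇ⇒< a b (≡.subst T (≡.sym eq₂) _)))
  ... | true | false = begin
    q (d ℕ.* 0 ℕ.+ b) * ((1# * 1#) * (((1# - q ((a ∸ b) ℕ.+ d ℕ.* 0)) * 1#) * 1#))
      ≈⟨ *-cong (q-cong (≡.cong (ℕ._+ b) (ℕ.*-zeroʳ d)))
           (*-congˡ (*-congʳ (*-congʳ (+-congˡ (-‿cong (q-cong
             (≡.trans (≡.cong ((a ∸ b) ℕ.+_) (ℕ.*-zeroʳ d)) (ℕ.+-identityʳ _)))))))) ⟩
    q b * ((1# * 1#) * (((1# - q (a ∸ b)) * 1#) * 1#))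
      ≈⟨ solve 2 (λ b e → b :* ((:1 :* :1) :* (((:1 :- e) :* :1) :* :1)) :=
           (:- :1) :* :1 :* (:1 :* (e :* b :- b))) ≈-refl _ _ ⟩
    ((- 1#) * 1#) * (1# * (q (a ∸ b) * q b - q b))
      ≈⟨ *-congˡ (*-cong (≈-trans (≈-sym q-0) (q-cong (≡.sym (ℕ.*-zeroʳ d))))
           (+-congʳ (≈-trans (≈-sym (q-+ (a ∸ b) b)) (q-cong (ℕ.m∸n+n≡m (ℕ.<⇒≤ b<a)))))) ⟩
    ((- 1#) * 1#) * (q (d ℕ.* 0) * (q a - q b)) ∎
  Ψ-vander {a} {b} (suc c) c′ b<a a<d b<d sep = cancel (sep c c′) (begin
    v * (q (pairL x⁺ y) * Ψ x⁺ y)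
      ≈⟨ *-congˡ (*-congʳ (≈-trans (q-cong (pairL-sucˡ x y)) (q-+ (pairL x y) yb))) ⟩
    v * ((q (pairL x y) * q yb) * Ψ x⁺ y)
      ≈⟨ solve 4 (λ v l y p → v :* ((l :* y) :* p) := l :* (y :* (p :* v))) ≈-refl _ _ _ _ ⟩
    q (pairL x y) * (q yb * (Ψ x⁺ y * v))
      ≈⟨ *-congˡ (Ψ-suc c c′ a<d b<d sep) ⟩
    q (pairL x y) * (- (q ya * (Ψ x y * v⁺)))
      ≈⟨ solve 4 (λ l y p v → l :* (:- (y :* (p :* v))) := (:- (y :* v)) :* (l :* p)) ≈-refl _ _ _ _ ⟩
    (- (q ya * v⁺)) * (q (pairL x y) * Ψ x y)
      ≈⟨ *-congˡ (Ψ-vander c c′ b<a a<d b<d sep) ⟩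
    (- (q ya * v⁺)) * (sgn (pairS x y) * (q (pairR x y) * v))
      ≈⟨ solve 5 (λ y v⁺ s r v → (:- (y :* v⁺)) :* (s :* (r :* v)) :=
           v :* (((:- :1) :* s) :* ((r :* y) :* v⁺))) ≈-refl _ _ _ _ _ ⟩
    v * (((- 1#) * sgn (pairS x y)) * ((q (pairR x y) * q ya) * v⁺))
      ≈⟨ *-congˡ (*-congˡ (*-congʳ (≈-trans (q-cong (pairR-sucˡ x y)) (q-+ (pairR x y) ya)))) ⟨
    v * (sgn (pairS x⁺ y) * (q (pairR x⁺ y) * v⁺)) ∎)
    where
    x = a , c; x⁺ = a , suc c; y = b , c′
    ya = point x; yb = point y
    v = q ya - q yb
    v⁺ = q (point x⁺) - q yb

  Ψ-vander {a} {b} zero (suc c′) b<a a<d b<d sep = cancel (sep 0 c′) (begin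
    v * (q (pairL x y⁺) * Ψ x y⁺)
      ≈⟨ *-congˡ (*-cong (≈-trans (q-cong (pairL-sucʳ a y)) (q-+ (pairL x y) ya)) (Ψ-comm x y⁺)) ⟩
    v * ((q (pairL x y) * q ya) * Ψ y⁺ x)
      ≈⟨ solve 5 (λ ya yb l y p → (ya :- yb) :* ((l :* y) :* p) :=
           :- (l :* (y :* (p :* (yb :- ya))))) ≈-refl _ _ _ _ _ ⟩
    - (q (pairL x y) * (q ya * (Ψ y⁺ x * (q yb - q ya))))
      ≈⟨ -‿cong (*-congˡ (Ψ-suc c′ 0 b<d a<d (λ k l → ≡.≢-sym (sep l k)))) ⟩
    - (q (pairL x y) * (- (q yb * (Ψ y x * (q (point y⁺) - q ya)))))
      ≈⟨ solve 5 (λ l yb p yb⁺ ya → :- (l :* (:- (yb :* (p :* (yb⁺ :- ya))))) :=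
           (:- (yb :* (ya :- yb⁺))) :* (l :* p)) ≈-refl _ _ _ _ _ ⟩
    (- (q yb * v⁺)) * (q (pairL x y) * Ψ y x)
      ≈⟨ *-congˡ (≈-trans (*-congˡ (Ψ-comm y x)) (Ψ-vander 0 c′ b<a a<d b<d sep)) ⟩
    (- (q yb * v⁺)) * (sgn (pairS x y) * (q (pairR x y) * v))
      ≈⟨ solve 5 (λ y v⁺ s r v → (:- (y :* v⁺)) :* (s :* (r :* v)) :=
           v :* (((:- :1) :* s) :* ((r :* y) :* v⁺))) ≈-refl _ _ _ _ _ ⟩
    v * (((- 1#) * sgn (pairS x y)) * ((q (pairR x y) * q yb) * v⁺))
      ≈⟨ *-congˡ (*-congˡ (*-congʳ (≈-trans (q-cong (pairR-sucʳ a y)) (q-+ (pairR x y) yb)))) ⟨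
    v * (sgn (pairS x y⁺) * (q (pairR x y⁺) * v⁺)) ∎)
    where
    x = a , 0; y = b , c′; y⁺ = b , suc c′
    ya = point x; yb = point y
    v = q ya - q yb
    v⁺ = q ya - q (point y⁺)

  K : ℕ × ℕ → ℕ × ℕ → C
  K (a , c) y@(b , _) = F a c (point y) * D a b c

  -- The entries of a chain lie at distances `d , 2 d , … , c d` below its next point, so their
  -- quotients are the inverses of the factors of `poch d c`.
  F-diagonal : d ≢ 0 → ∀ a c → F a c (point (a , c)) * poch d c ≈ 1#
  F-diagonal d≢0 a zero = *-identityˡ 1#
  F-diagonal d≢0 a (suc c) = begin
    (G a y⁺ * F (a ℕ.+ d) c y⁺) * poch d (suc c)
      ≈⟨ *-congˡ (prod-upTo-suc _ c) ⟩
    (G a y⁺ * F (a ℕ.+ d) c y⁺) * (poch d c * (1# - q (d ℕ.+ d ℕ.* c)))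
      ≈⟨ solve 4 (λ g f p u → (g :* f) :* (p :* u) := (g :* u) :* (f :* p)) ≈-refl _ _ _ _ ⟩
    (G a y⁺ * (1# - q (d ℕ.+ d ℕ.* c))) * (F (a ℕ.+ d) c y⁺ * poch d c)
      ≈⟨ *-cong (G-forward (d ℕ.+ d ℕ.* c) (λ eq → d≢0 (ℕ.m+n≡0⇒m≡0 d eq))
                  (≡.cong (λ k → d ℕ.+ k ℕ.+ a) (ℕ.*-comm d c)))
           (≈-trans (*-congʳ (reflexive (≡.cong (F (a ℕ.+ d) c) (chain-next d a c))))
             (F-diagonal d≢0 (a ℕ.+ d) c)) ⟩
    1# * 1#
      ≈⟨ *-identityˡ 1# ⟩
    1# ∎
    where y⁺ = point (a , suc c)

  K-diagonal : ∀ {a} c → a ℕ.< d → K (a , c) (a , c) ≈ 1#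
  K-diagonal {a} c a<d with a ℕ.<ᵇ a in eq
  ... | true = ⊥-elim (ℕ.<-irrefl ≡.refl (ℕ.<ᵇ⇒< a a (≡.subst T (≡.sym eq) _)))
  ... | false = ≈-trans
    (*-congˡ (reflexive (≡.cong (λ e → poch (d ∸ e) c) (ℕ.n∸n≡0 a))))
    (F-diagonal (λ { ≡.refl → ℕ.n≮0 a<d }) a c)

  row-vander : ∀ {x} xs → proj₁ x ℕ.< d → All (λ y → proj₁ y ℕ.< proj₁ x) xs → Bounded xs →
    (∀ {a b} → b ℕ.< a → a ℕ.< d → Separated a b) →
    q (sum (map (pairL x) xs)) * prodL (λ y → K x y * K y x) xs ≈
    sgn (sum (map (pairS x) xs)) *
      (q (sum (map (pairR x) xs)) * prodL (λ y → q (point x) - q y) (map point xs))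
  row-vander [] _ _ _ _ = ≈-trans (*-congʳ q-0) (≈-trans
    (solve 0 (:1 :* :1 := :1 :* (:1 :* :1)) ≈-refl) (*-congˡ (*-congʳ (≈-sym q-0))))
  row-vander {x} (y ∷ ys) x<d (y<x ∷ ys<x) (y<d ∷ ys<d) sep = begin
    q (pairL x y ℕ.+ L) * ((K x y * K y x) * Πs)
      ≈⟨ *-cong (q-+ (pairL x y) L) (*-congʳ (
           *-interchange _ _ _ _)) ⟩
    (q (pairL x y) * q L) * (Ψ x y * Πs)
      ≈⟨ *-interchange _ _ _ _ ⟩
    (q (pairL x y) * Ψ x y) * (q L * Πs)
      ≈⟨ *-cong (Ψ-vander _ _ y<x x<d y<d (sep y<x x<d)) (row-vander ys x<d ys<x ys<d sep) ⟩
    (sgn (pairS x y) * (q (pairR x y) * v)) * (sgn S * (q R′ * V))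
      ≈⟨ solve 6 (λ s r v s′ r′ v′ → (s :* (r :* v)) :* (s′ :* (r′ :* v′)) :=
           (s :* s′) :* ((r :* r′) :* (v :* v′))) ≈-refl _ _ _ _ _ _ ⟩
    (sgn (pairS x y) * sgn S) * ((q (pairR x y) * q R′) * (v * V))
      ≈⟨ *-cong (^-homo-* (- 1#) (pairS x y) S) (*-congʳ (q-+ (pairR x y) R′)) ⟨
    sgn (pairS x y ℕ.+ S) * (q (pairR x y ℕ.+ R′) * (v * V)) ∎
    where
    L = sum (map (pairL x) ys)
    S = sum (map (pairS x) ys)
    R′ = sum (map (pairR x) ys)
    Πs = prodL (λ y → K x y * K y x) ys
    v = q (point x) - q (point y)
    V = prodL (λ y → q (point x) - q y) (map point ys)

  -- The diagonal factors are 1, and the factors of two different chains multiply to `Ψ`, which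
  -- supplies one difference of the Vandermonde product.
  square-vander : ∀ cs → Decreasing cs → Bounded cs →
    (∀ {a b} → b ℕ.< a → a ℕ.< d → Separated a b) →
    q (sumPairs pairL cs) * square K cs ≈
    sgn (sumPairs pairS cs) * (q (sumPairs pairR cs) * vander (map point cs))
  square-vander [] _ _ _ = ≈-trans (*-congʳ q-0) (≈-trans
    (solve 0 (:1 :* :1 := :1 :* (:1 :* :1)) ≈-refl) (*-congˡ (*-congʳ (≈-sym q-0))))
  square-vander (x ∷ xs) (xs<x ∷ dec) (x<d ∷ bnd) sep = begin
    q (L ℕ.+ Ls) * square K (x ∷ xs)
      ≈⟨ *-cong (q-+ L Ls) (square-∷ K x xs) ⟩
    (q L * q Ls) * (K x x * (Πs * square K xs))
      ≈⟨ *-congˡ (≈-trans (*-congʳ (K-diagonal _ x<d)) (*-identityˡ _)) ⟩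
    (q L * q Ls) * (Πs * square K xs)
      ≈⟨ *-interchange _ _ _ _ ⟩
    (q L * Πs) * (q Ls * square K xs)
      ≈⟨ *-cong (row-vander xs x<d xs<x bnd sep) (square-vander xs dec bnd sep) ⟩
    (sgn S * (q R′ * V)) * (sgn Ss * (q Rs * Vs))
      ≈⟨ solve 6 (λ s r v s′ r′ v′ → (s :* (r :* v)) :* (s′ :* (r′ :* v′)) :=
           (s :* s′) :* ((r :* r′) :* (v :* v′))) ≈-refl _ _ _ _ _ _ ⟩
    (sgn S * sgn Ss) * ((q R′ * q Rs) * (V * Vs))
      ≈⟨ *-cong (^-homo-* (- 1#) S Ss) (*-congʳ (q-+ R′ Rs)) ⟨
    sgn (S ℕ.+ Ss) * (q (R′ ℕ.+ Rs) * (V * Vs)) ∎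
    where
    L = sum (map (pairL x) xs); Ls = sumPairs pairL xs
    S = sum (map (pairS x) xs); Ss = sumPairs pairS xs
    R′ = sum (map (pairR x) xs); Rs = sumPairs pairR xs
    Πs = prodL (λ y → K x y * K y x) xs
    V = prodL (λ y → q (point x) - q y) (map point xs)
    Vs = vander (map point xs)

-- Vandermonde numerators and their duality

separated : ∀ {d a b} → a ℕ.< d → b ℕ.< d → a ≢ b → Residues.Separated d a b
separated {d@(suc _)} {a} {b} a<d b<d a≢b k l eq = a≢b (begin
  a                     ≡⟨ m<n⇒m%n≡m a<d ⟨
  a % d                 ≡⟨ [m+kn]%n≡m%n a k d ⟨
  (a ℕ.+ k ℕ.* d) % d   ≡⟨ ≡.cong (_% d) (≡.trans (ℕ.+-comm a _) (≡.trans eq (ℕ.+-comm _ b))) ⟩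
  (b ℕ.+ l ℕ.* d) % d   ≡⟨ [m+kn]%n≡m%n b l d ⟩
  b % d                 ≡⟨ m<n⇒m%n≡m b<d ⟩
  b                     ∎)
  where open ≡.≡-Reasoning

-- The binomial coefficient `n C 3`.
tri₂ : ℕ → ℕ
tri₂ zero = 0
tri₂ (suc n) = tri₂ n ℕ.+ tri n

tri-+ : ∀ x y → tri (x ℕ.+ y) ≡ tri x ℕ.+ tri y ℕ.+ x ℕ.* y
tri-+ zero y = ≡.sym (ℕ.+-identityʳ (tri y))
tri-+ (suc x) y = ≡.trans (≡.cong (ℕ._+ (x ℕ.+ y)) (tri-+ x y))
  (solve 4 (λ x y t u → t :+ u :+ x :* y :+ (x :+ y) := t :+ x :+ u :+ (y :+ x :* y))
    ≡.refl x y (tri x) (tri y))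
  where open +-*-Solver

-- Lists [(n - 1 , c₁), …, (0 , cₙ)].
data Filling : ℕ → List (ℕ × ℕ) → Set where
  [] : Filling 0 []
  cons : ∀ {n cs} c → Filling n cs → Filling (suc n) ((n , c) ∷ cs)

filling : ∀ n cs → map proj₁ cs ≡ downFrom n → Filling n cs
filling zero [] _ = []
filling (suc n) ((a , c) ∷ cs) eq with ≡.refl , eq′ ← List.∷-injective eq =
  cons c (filling n cs eq′)

-- Together with `tris` it gives the sum of all entries of the chains: `moment cs + d * tris cs`.
moment : List (ℕ × ℕ) → ℕ
moment [] = 0
moment ((a , c) ∷ cs) = a ℕ.* c ℕ.+ moment cs

tris : List (ℕ × ℕ) → ℕ
tris [] = 0
tris ((_ , c) ∷ cs) = tri c ℕ.+ tris cs

Filling-length : ∀ {n cs} → Filling n cs → length cs ≡ n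
Filling-length [] = ≡.refl
Filling-length (cons c f) = ≡.cong suc (Filling-length f)

Filling-< : ∀ {n cs} → Filling n cs → All (λ (a , _) → a ℕ.< n) cs
Filling-< [] = []
Filling-< (cons c f) = ℕ.≤-refl ∷ All.map ℕ.m<n⇒m<1+n (Filling-< f)

short-or-long : ∀ K (cs : List (ℕ × ℕ)) →
  All (λ (_ , c) → K ℕ.≤ c) cs ⊎ ∃[ b ] ∃[ c ] (b , c) ∈ cs × c ℕ.< K
short-or-long K [] = inj₁ []
short-or-long K ((a , c) ∷ cs) with K ℕ.≤? c | short-or-long K cs
... | no K≰c | _ = inj₂ (a , c , here ≡.refl , ℕ.≰⇒> K≰c)
... | yes _ | inj₂ (b , c′ , p , c′<K) = inj₂ (b , c′ , there p , c′<K)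
... | yes K≤c | inj₁ all = inj₁ (K≤c ∷ all)

-- The second alternative is what `c + 1 ≤ B` for every chain adds up to.
pigeonhole : ∀ B (cs : List (ℕ × ℕ)) →
  (∃[ a ] ∃[ c ] (a , c) ∈ cs × B ℕ.≤ c) ⊎ (size cs ℕ.+ length cs ℕ.≤ length cs ℕ.* B)
pigeonhole B [] = inj₂ z≤n
pigeonhole B ((a , c) ∷ cs) with B ℕ.≤? c | pigeonhole B cs
... | yes B≤c | _ = inj₁ (a , c , here ≡.refl , B≤c)
... | no _ | inj₁ (a′ , c′ , p , B≤) = inj₁ (a′ , c′ , there p , B≤)
... | no B≰c | inj₂ le = inj₂ (ℕ.≤-trans
  (ℕ.≤-reflexive (regroup c (size cs) (length cs)))
  (ℕ.+-mono-≤ (ℕ.≰⇒> B≰c) le))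
  where
  regroup : ∀ c s l → (c ℕ.+ s) ℕ.+ suc l ≡ suc c ℕ.+ (s ℕ.+ l)
  regroup = solve 3 (λ c s l → (c :+ s) :+ (con 1 :+ l) := (con 1 :+ c) :+ (s :+ l)) ≡.refl
    where open +-*-Solver

∈-chain⁺ : ∀ d a {k c} → k ℕ.< c → k ℕ.* d ℕ.+ a ∈ chain d a c
∈-chain⁺ d a {zero} {suc c} _ = here ≡.refl
∈-chain⁺ d a {suc k} {suc c} (s≤s k<c) =
  there (≡.subst (_∈ chain d (a ℕ.+ d) c) (≡.sym (chain-next d a k)) (∈-chain⁺ d (a ℕ.+ d) k<c))

-- The right side exceeds the left by `(x - y) (x - y + 1) / 2`, half a product of consecutive
-- integers.
cross-term-≤ : ∀ x y → x ℕ.* y ℕ.≤ tri y ℕ.+ (x ℕ.+ tri x)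
cross-term-≤ zero y = z≤n
cross-term-≤ (suc x) zero = ℕ.≤-trans (ℕ.≤-reflexive (ℕ.*-zeroʳ x)) z≤n
cross-term-≤ (suc x) (suc y) = begin
  suc x ℕ.* suc y
    ≡⟨ solve 2 (λ x y → (con 1 :+ x) :* (con 1 :+ y) := x :* y :+ (con 1 :+ (x :+ y))) ≡.refl x y ⟩
  x ℕ.* y ℕ.+ (1 ℕ.+ (x ℕ.+ y))
    ≤⟨ ℕ.+-monoˡ-≤ _ (cross-term-≤ x y) ⟩
  (tri y ℕ.+ (x ℕ.+ tri x)) ℕ.+ (1 ℕ.+ (x ℕ.+ y))
    ≡⟨ solve 4 (λ x y t u → (u :+ (x :+ t)) :+ (con 1 :+ (x :+ y)) :=
         (u :+ y) :+ ((con 1 :+ x) :+ (t :+ x))) ≡.refl x y (tri x) (tri y) ⟩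
  tri (suc y) ℕ.+ (suc x ℕ.+ tri (suc x)) ∎
  where open ℕ.≤-Reasoning
        open +-*-Solver

-- The entries of the chains of step n are distinct, so their sum is least for 0 , …, r - 1.
tri-size-≤ : ∀ {n cs} → Filling n cs → tri (size cs) ℕ.≤ moment cs ℕ.+ n ℕ.* tris cs
tri-size-≤ [] = z≤n
tri-size-≤ (cons {n} {cs} c f) = begin
  tri (c ℕ.+ size cs)
    ≡⟨ tri-+ c (size cs) ⟩
  tri c ℕ.+ tri (size cs) ℕ.+ c ℕ.* size cs
    ≤⟨ ℕ.+-mono-≤ (ℕ.+-monoʳ-≤ (tri c) (tri-size-≤ f)) (cross-≤ f) ⟩
  tri c ℕ.+ (moment cs ℕ.+ n ℕ.* tris cs) ℕ.+ (tris cs ℕ.+ n ℕ.* (c ℕ.+ tri c))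
    ≡⟨ solve 5 (λ n c t p u → t :+ (p :+ n :* u) :+ (u :+ n :* (c :+ t)) :=
         (n :* c :+ p) :+ (con 1 :+ n) :* (t :+ u)) ≡.refl n c (tri c) (moment cs) (tris cs) ⟩
  (n ℕ.* c ℕ.+ moment cs) ℕ.+ suc n ℕ.* (tri c ℕ.+ tris cs) ∎
  where
  open ℕ.≤-Reasoning
  open +-*-Solver
  cross-≤ : ∀ {n cs} → Filling n cs → c ℕ.* size cs ℕ.≤ tris cs ℕ.+ n ℕ.* (c ℕ.+ tri c)
  cross-≤ [] = ℕ.≤-reflexive (ℕ.*-zeroʳ c)
  cross-≤ (cons {n} {cs} c′ f) = begin
    c ℕ.* (c′ ℕ.+ size cs)
      ≡⟨ ℕ.*-distribˡ-+ c c′ (size cs) ⟩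
    c ℕ.* c′ ℕ.+ c ℕ.* size cs
      ≤⟨ ℕ.+-mono-≤ (cross-term-≤ c c′) (cross-≤ f) ⟩
    (tri c′ ℕ.+ (c ℕ.+ tri c)) ℕ.+ (tris cs ℕ.+ n ℕ.* (c ℕ.+ tri c))
      ≡⟨ solve 5 (λ n c t t′ u → (t′ :+ (c :+ t)) :+ (u :+ n :* (c :+ t)) :=
           (t′ :+ u) :+ (con 1 :+ n) :* (c :+ t)) ≡.refl n c (tri c) (tri c′) (tris cs) ⟩
    (tri c′ ℕ.+ tris cs) ℕ.+ suc n ℕ.* (c ℕ.+ tri c) ∎

module Fillings (d : ℕ) where
  open import Data.Nat using (_+_; _*_; _≤_)
  open Residues d
  open +-*-Solver

  Filling-Bounded : ∀ {n cs} → Filling n cs → n ≤ d → Bounded cs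
  Filling-Bounded f n≤d = All.map (λ a<n → ℕ.<-≤-trans a<n n≤d) (Filling-< f)

  Filling-Decreasing : ∀ {n cs} → Filling n cs → Decreasing cs
  Filling-Decreasing [] = []
  Filling-Decreasing (cons c f) = Filling-< f ∷ Filling-Decreasing f

  Filling-Unique : ∀ {n cs} → Filling n cs → n ≤ d → Unique (map point cs)
  Filling-Unique [] _ = []
  Filling-Unique (cons {n} c f) n<d =
    All.map⁺ (All.map (λ {(_ , c′)} a<n →
      separated n<d (ℕ.<-trans a<n n<d) (≡.≢-sym (ℕ.<⇒≢ a<n)) c c′) (Filling-< f))
    ∷ Filling-Unique f (ℕ.<⇒≤ n<d)

  private
    sum-pairS : ∀ a c {n cs} → Filling n cs →
      sum (map (pairS (a , c)) cs) ≡ n * suc c + size cs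
    sum-pairS a c [] = ≡.refl
    sum-pairS a c (cons {n} {cs} c′ f) = ≡.trans
      (≡.cong (pairS (a , c) (n , c′) +_) (sum-pairS a c f))
      (solve 4 (λ c c′ n r →
        (con 1 :+ (c :+ c′)) :+ (n :* (con 1 :+ c) :+ r) :=
        ((con 1 :+ n) :* (con 1 :+ c)) :+ (c′ :+ r)) ≡.refl c c′ n (size cs))

    sum-pairL : ∀ a c {n cs} → Filling n cs →
      sum (map (pairL (a , c)) cs) ≡ (suc c * tri n + a * size cs) + d * (c * size cs)
    sum-pairL a c [] = solve 3 (λ a c d →
      con 0 := ((con 1 :+ c) :* con 0 :+ a :* con 0) :+ d :* (c :* con 0)) ≡.refl a c d
    sum-pairL a c (cons {n} {cs} c′ f) = ≡.trans
      (≡.cong (pairL (a , c) (n , c′) +_) (sum-pairL a c f))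
      (solve 7 (λ a c c′ n r d t →
        ((c :* n :+ (c′ :* a :+ d :* (c :* c′))) :+ n) :+
        (((con 1 :+ c) :* t :+ a :* r) :+ d :* (c :* r)) :=
        ((con 1 :+ c) :* (t :+ n) :+ a :* (c′ :+ r)) :+ d :* (c :* (c′ :+ r)))
        ≡.refl a c c′ n (size cs) d (tri n))

    sum-pairR : ∀ a c {n cs} → Filling n cs →
      sum (map (pairR (a , c)) cs) ≡
      (n * (c * a) + moment cs) + d * (n * tri c + tris cs)
    sum-pairR a c [] = ≡.sym (ℕ.*-zeroʳ d)
    sum-pairR a c (cons {n} {cs} c′ f) = ≡.trans
      (≡.cong (pairR (a , c) (n , c′) +_) (sum-pairR a c f))
      (solve 9 (λ a c c′ n p d t t′ u →
        ((c :* a :+ c′ :* n) :+ d :* (t :+ t′)) :+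
        ((n :* (c :* a) :+ p) :+ d :* (n :* t :+ u)) :=
        ((con 1 :+ n) :* (c :* a) :+ (n :* c′ :+ p)) :+ d :* ((con 1 :+ n) :* t :+ (t′ :+ u)))
        ≡.refl a c c′ n (moment cs) d (tri c) (tri c′) (tris cs))

  -- The sign depends only on `n` and `r`. Adding `size cs` on the left replaces a coefficient
  -- `n - 1` on the right.
  sumPairs-S : ∀ {n cs} → Filling n cs →
    sumPairs pairS cs + size cs ≡ n * size cs + tri n
  sumPairs-S [] = ≡.refl
  sumPairs-S (cons {n} {cs} c f) = begin
    (sum (map (pairS (n , c)) cs) + S) + (c + r)
      ≡⟨ ≡.cong (λ k → (k + S) + (c + r)) (sum-pairS n c f) ⟩
    ((n * suc c + r) + S) + (c + r)
      ≡⟨ solve 4 (λ n c r S → ((n :* (con 1 :+ c) :+ r) :+ S) :+ (c :+ r) :=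
           (S :+ r) :+ (n :* (con 1 :+ c) :+ (c :+ r))) ≡.refl n c r S ⟩
    (S + r) + (n * suc c + (c + r))
      ≡⟨ ≡.cong (_+ (n * suc c + (c + r))) (sumPairs-S f) ⟩
    (n * r + tri n) + (n * suc c + (c + r))
      ≡⟨ solve 4 (λ n c r t → (n :* r :+ t) :+ (n :* (con 1 :+ c) :+ (c :+ r)) :=
           (con 1 :+ n) :* (c :+ r) :+ (t :+ n)) ≡.refl n c r (tri n) ⟩
    suc n * (c + r) + tri (suc n) ∎
    where open ≡.≡-Reasoning
          S = sumPairs pairS cs
          r = size cs

  -- A composition enters these exponents only through the sum `μ` of its chain entries: the left
  -- exponent is a function of `n`, `d` and `r` minus `μ`, and by `sumPairs-R` the right one is
  -- `(n - 1) μ`. Hence a single monomial can be taken out of the whole sum over compositions.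
  sumPairs-L : ∀ {n cs} → Filling n cs →
    sumPairs pairL cs + (moment cs + d * tris cs) ≡
    (tri n * size cs + d * tri (size cs)) + tri₂ n
  sumPairs-L [] = ≡.sym (ℕ.+-identityʳ _)
  sumPairs-L (cons {n} {cs} c f) = begin
    (sum (map (pairL (n , c)) cs) + S) + ((n * c + p) + d * (tri c + t))
      ≡⟨ ≡.cong (λ k → (k + S) + ((n * c + p) + d * (tri c + t))) (sum-pairL n c f) ⟩
    (((suc c * tri n + n * r) + d * (c * r)) + S) +
      ((n * c + p) + d * (tri c + t))
      ≡⟨ solve 9 (λ n c r d S p t tc tn →
           ((((con 1 :+ c) :* tn :+ n :* r) :+ d :* (c :* r)) :+ S) :+ ((n :* c :+ p) :+ d :* (tc :+ t)) :=
           (S :+ (p :+ d :* t)) :+ ((((con 1 :+ c) :* tn :+ n :* r) :+ d :* (c :* r)) :+ (n :* c :+ d :* tc)))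
           ≡.refl n c r d S p t (tri c) (tri n) ⟩
    (S + (p + d * t)) + x
      ≡⟨ ≡.cong (_+ x) (sumPairs-L f) ⟩
    ((tri n * r + d * tri r) + tri₂ n) + x
      ≡⟨ solve 8 (λ n c r d tc tn tr t₂ →
           ((tn :* r :+ d :* tr) :+ t₂) :+
           ((((con 1 :+ c) :* tn :+ n :* r) :+ d :* (c :* r)) :+ (n :* c :+ d :* tc)) :=
           ((tn :+ n) :* (c :+ r) :+ d :* (tc :+ tr :+ c :* r)) :+ (t₂ :+ tn))
           ≡.refl n c r d (tri c) (tri n) (tri r) (tri₂ n) ⟩
    (tri (suc n) * (c + r) + d * (tri c + tri r + c * r)) + tri₂ (suc n)
      ≡⟨ ≡.cong (λ k → (tri (suc n) * (c + r) + d * k) + tri₂ (suc n)) (tri-+ c r) ⟨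
    (tri (suc n) * (c + r) + d * tri (c + r)) + tri₂ (suc n) ∎
    where open ≡.≡-Reasoning
          S = sumPairs pairL cs
          r = size cs
          p = moment cs
          t = tris cs
          x = ((suc c * tri n + n * r) + d * (c * r)) + (n * c + d * tri c)

  sumPairs-R : ∀ {n cs} → Filling n cs →
    sumPairs pairR cs + (moment cs + d * tris cs) ≡ n * (moment cs + d * tris cs)
  sumPairs-R [] = ℕ.*-zeroʳ d
  sumPairs-R (cons {n} {cs} c f) = begin
    (sum (map (pairR (n , c)) cs) + S) + ((n * c + p) + d * (tri c + t))
      ≡⟨ ≡.cong (λ k → (k + S) + ((n * c + p) + d * (tri c + t))) (sum-pairR n c f) ⟩
    (((n * (c * n) + p) + d * (n * tri c + t)) + S) +
      ((n * c + p) + d * (tri c + t))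
      ≡⟨ solve 7 (λ n c d S p t tc →
           (((n :* (c :* n) :+ p) :+ d :* (n :* tc :+ t)) :+ S) :+ ((n :* c :+ p) :+ d :* (tc :+ t)) :=
           (S :+ (p :+ d :* t)) :+ (((n :* (c :* n) :+ p) :+ d :* (n :* tc :+ t)) :+ (n :* c :+ d :* tc)))
           ≡.refl n c d S p t (tri c) ⟩
    (S + (p + d * t)) + x
      ≡⟨ ≡.cong (_+ x) (sumPairs-R f) ⟩
    n * (p + d * t) + x
      ≡⟨ solve 6 (λ n c d p t tc →
           n :* (p :+ d :* t) :+ (((n :* (c :* n) :+ p) :+ d :* (n :* tc :+ t)) :+ (n :* c :+ d :* tc)) :=
           (con 1 :+ n) :* ((n :* c :+ p) :+ d :* (tc :+ t)))
           ≡.refl n c d p t (tri c) ⟩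
    suc n * ((n * c + p) + d * (tri c + t)) ∎
    where open ≡.≡-Reasoning
          S = sumPairs pairR cs
          p = moment cs
          t = tris cs
          x = ((n * (c * n) + p) + d * (n * tri c + t)) + (n * c + d * tri c)

module ExponentIdentities where
  open import Data.Nat using (_+_; _*_)
  open +-*-Solver

  weight-∷ : ∀ k e x t p u →
    k * (x + e * t) + k * (p + e * u) ≡ k * ((x + p) + e * (t + u))
  weight-∷ = solve 6 (λ k e x t p u →
    k :* (x :+ e :* t) :+ k :* (p :+ e :* u) := k :* ((x :+ p) :+ e :* (t :+ u))) ≡.refl

  weight-suc : ∀ m a c d t →
    m * (a * c + d * t) + m * (c * d + a) ≡ m * (a * suc c + d * (t + c))
  weight-suc = solve 5 (λ m a c d t →
    m :* (a :* c :+ d :* t) :+ m :* (c :* d :+ a) :=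
    m :* (a :* (con 1 :+ c) :+ d :* (t :+ c))) ≡.refl

  -- Both sides equal `n κ tri c + κ b c + n a c + a b`. Exchanging step and weight is therefore the
  -- same as exchanging rows and columns.
  entry-transpose : ∀ κ n a b c →
    κ * (b * c + n * tri c) + (c * n + b) * a ≡
    n * (a * c + κ * tri c) + (c * κ + a) * b
  entry-transpose κ n a b c = solve 6 (λ κ n a b c t →
    κ :* (b :* c :+ n :* t) :+ (c :* n :+ b) :* a :=
    n :* (a :* c :+ κ :* t) :+ (c :* κ :+ a) :* b) ≡.refl κ n a b c (tri c)

  -- The surplus `m * t`, with `t = tri r`, is the source of the normalizing power in the theorem.
  base-+ : ∀ m n x t u →
    (x + (m + n) * t) + u ≡ ((x + n * t) + u) + m * t
  base-+ = solve 5 (λ m n x t u →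
    (x :+ (m :+ n) :* t) :+ u := ((x :+ n :* t) :+ u) :+ m :* t) ≡.refl

-- Numerators as determinants

module Numerator {c ℓ} (R : CommutativeRing c ℓ) (P : PointSystem R) (n : ℕ) where
  open PointSystem P
  open CommutativeRing R
    hiding (zero) renaming (Carrier to C; refl to ≈-refl; sym to ≈-sym; trans to ≈-trans)
  open RingSolver R
  open ListSums R
  open LinearSums R
  open Points R P
  open ExponentIdentities
  open Determinant R
  open GradedDeterminant R using (sumComp-det)
  open Algebra.Properties.Semiring.Exp semiring using (_^_; ^-homo-*)
  open Relation.Binary.Reasoning.Setoid setoid
  private
    module Z = Determinant (PowerSeries.ring′ R)

  -- The constant value of the left exponent plus the sum of the chain entries in `sumPairs-L`; the
  -- exponent in `sign` is the one determined by `sumPairs-S`.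
  base : ℕ → ℕ → ℕ
  base d r = (tri n ℕ.* r ℕ.+ d ℕ.* tri r) ℕ.+ tri₂ n

  sign : ℕ → C
  sign r = (- 1#) ^ ((n ℕ.* r ℕ.+ tri n) ∸ r)

  q-^ : ∀ p b → q p ^ b ≈ q (p ℕ.* b)
  q-^ p zero = ≈-trans (≈-sym q-0) (reflexive (≡.cong q (≡.sym (ℕ.*-zeroʳ p))))
  q-^ p (suc b) = ≈-trans (*-congˡ (q-^ p b))
    (≈-trans (≈-sym (q-+ p _)) (reflexive (≡.cong q (≡.sym (ℕ.*-suc p b)))))

  det-map : ∀ {A B C′ : Set} (M : B → C′ → C) (f : A → B) as bs →
    det M (map f as) bs ≈ det (M ∘ f) as bs
  det-map M f [] [] = ≈-refl
  det-map M f [] (b ∷ bs) = ≈-refl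
  det-map M f (a ∷ as) bs = sumPick-cong bs (λ b bs′ _ → *-congˡ (det-map M f as bs′))

  prodL-weight : ∀ k e cs → prodL (λ (a , c) → q (k ℕ.* (a ℕ.* c ℕ.+ e ℕ.* tri c))) cs ≈
    q (k ℕ.* (moment cs ℕ.+ e ℕ.* tris cs))
  prodL-weight k e [] = ≈-trans (≈-sym q-0) (reflexive (≡.cong q (≡.sym
    (≡.trans (≡.cong (k ℕ.*_) (ℕ.*-zeroʳ e)) (ℕ.*-zeroʳ k)))))
  prodL-weight k e ((a , c) ∷ cs) = ≈-trans (*-congˡ (prodL-weight k e cs))
    (≈-trans (≈-sym (q-+ _ _)) (reflexive (≡.cong q
      (weight-∷ k e (a ℕ.* c) (tri c) (moment cs) (tris cs)))))

  entry : ℕ → ℕ → ℕ → ℕ → ℕ → C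
  entry k d a c b = q (k ℕ.* (a ℕ.* c ℕ.+ d ℕ.* tri c) ℕ.+ (c ℕ.* d ℕ.+ a) ℕ.* b)

  module _ (d : ℕ) (n≤d : n ℕ.≤ d) where
    open Residues d
    open Fillings d
    open ChainProducts R P d

    -- The weight contributes `m μ` and the Vandermonde identity, after `base d r` is cleared,
    -- another `n μ`. Their total `(m + n) μ` splits over the chains and becomes the row factor `h`
    -- of a Vandermonde determinant.
    square-det : ∀ m {r} cs → Filling n cs → size cs ≡ r →
      q (base d r) * (q (m ℕ.* (moment cs ℕ.+ d ℕ.* tris cs)) * square K cs) ≈
      sign r * det (λ (a , c) b → entry (m ℕ.+ n) d a c b) cs (downFrom n)
    square-det m cs f ≡.refl = begin
      q (base d r) * (q (m ℕ.* μ) * square K cs)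
        ≈⟨ *-congʳ (≈-trans (reflexive (≡.cong q (≡.sym (sumPairs-L f)))) (q-+ L μ)) ⟩
      (q L * q μ) * (q (m ℕ.* μ) * square K cs)
        ≈⟨ solve 4 (λ l u w s → (l :* u) :* (w :* s) := (w :* u) :* (l :* s)) ≈-refl _ _ _ _ ⟩
      (q (m ℕ.* μ) * q μ) * (q L * square K cs)
        ≈⟨ *-congˡ (square-vander cs (Filling-Decreasing f) (Filling-Bounded f n≤d)
             (λ b<a a<d → separated a<d (ℕ.<-trans b<a a<d) (≡.≢-sym (ℕ.<⇒≢ b<a)))) ⟩
      (q (m ℕ.* μ) * q μ) * (sgn (sumPairs pairS cs) * (q R′ * vander (map point cs)))
        ≈⟨ solve 5 (λ w u s r v → (w :* u) :* (s :* (r :* v)) := s :* ((w :* (r :* u)) :* v))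
             ≈-refl _ _ _ _ _ ⟩
      sgn (sumPairs pairS cs) * ((q (m ℕ.* μ) * (q R′ * q μ)) * vander (map point cs))
        ≈⟨ *-cong (reflexive (≡.cong sgn (≡.trans (≡.sym (ℕ.m+n∸n≡m _ r))
             (≡.cong (_∸ r) (sumPairs-S f)))))
             (*-cong weights (≈-sym (vandermonde n (map point cs)
               (≡.trans (List.length-map point cs) (Filling-length f)) (Filling-Unique f n≤d)))) ⟩
      sign r * (prodL h cs * det (λ p b → q p ^ b) (map point cs) (downFrom n))
        ≈⟨ *-congˡ (≈-trans (*-congˡ (det-map _ point cs (downFrom n)))
             (≈-sym (det-scale-rows h (λ x b → q (point x) ^ b) cs (downFrom n)))) ⟩
      sign r * det (λ x b → h x * q (point x) ^ b) cs (downFrom n)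
        ≈⟨ *-congˡ (det-cong cs (downFrom n) (λ x b →
             ≈-trans (*-congˡ (q-^ (point x) b)) (≈-sym (q-+ _ _)))) ⟩
      sign r * det (λ (a , c) b → entry (m ℕ.+ n) d a c b) cs (downFrom n) ∎
      where
      r = size cs
      μ = moment cs ℕ.+ d ℕ.* tris cs
      L = sumPairs pairL cs
      R′ = sumPairs pairR cs
      h : ℕ × ℕ → C
      h (a , c) = q ((m ℕ.+ n) ℕ.* (a ℕ.* c ℕ.+ d ℕ.* tri c))
      weights : q (m ℕ.* μ) * (q R′ * q μ) ≈ prodL h cs
      weights = begin
        q (m ℕ.* μ) * (q R′ * q μ)
          ≈⟨ *-congˡ (≈-trans (≈-sym (q-+ R′ μ)) (reflexive (≡.cong q (sumPairs-R f)))) ⟩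
        q (m ℕ.* μ) * q (n ℕ.* μ)
          ≈⟨ ≈-trans (≈-sym (q-+ _ _)) (reflexive (≡.cong q (≡.sym (ℕ.*-distribʳ-+ μ m n)))) ⟩
        q ((m ℕ.+ n) ℕ.* μ)
          ≈⟨ prodL-weight (m ℕ.+ n) d cs ⟨
        prodL h cs ∎

    numerator : ℕ → ℕ → C
    numerator m r = sumComp (downFrom n) r (λ cs →
      q (m ℕ.* (moment cs ℕ.+ d ℕ.* tris cs)) * square K cs)

    numerator-det : ∀ m r → q (base d r) * numerator m r ≈
      sign r * Z.det (λ a b c → entry (m ℕ.+ n) d a c b) (downFrom n) (downFrom n) r
    numerator-det m r = begin
      q (base d r) * numerator m r
        ≈⟨ sumComp-*ˡ _ (downFrom n) r _ ⟨
      sumComp (downFrom n) r (λ cs →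
        q (base d r) * (q (m ℕ.* (moment cs ℕ.+ d ℕ.* tris cs)) * square K cs))
        ≈⟨ sumComp-cong (downFrom n) r (λ cs eq size≡ →
             square-det m cs (filling n cs eq) size≡) ⟩
      sumComp (downFrom n) r (λ cs →
        sign r * det (λ (a , c) b → entry (m ℕ.+ n) d a c b) cs (downFrom n))
        ≈⟨ sumComp-*ˡ _ (downFrom n) r _ ⟩
      sign r * sumComp (downFrom n) r (λ cs →
        det (λ (a , c) b → entry (m ℕ.+ n) d a c b) cs (downFrom n))
        ≈⟨ *-congˡ (sumComp-det (λ a c b → entry (m ℕ.+ n) d a c b) (downFrom n) r (downFrom n)) ⟩
      sign r * Z.det (λ a b c → entry (m ℕ.+ n) d a c b) (downFrom n) (downFrom n) r ∎

  -- The two numerators are determinants of transposed matrices.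
  numerator-duality : ∀ m r →
    numerator n ℕ.≤-refl m r ≈ q (m ℕ.* tri r) * numerator (m ℕ.+ n) (ℕ.m≤n+m n m) 0 r
  numerator-duality m r = q-cancel (base n r) (begin
    q (base n r) * numerator n ℕ.≤-refl m r
      ≈⟨ numerator-det n ℕ.≤-refl m r ⟩
    sign r * Z.det (λ a b c → entry κ n a c b) (downFrom n) (downFrom n) r
      ≈⟨ *-congˡ (Z.det-transpose (λ a b c → entry κ n a c b) (downFrom n) (downFrom n) r) ⟩
    sign r * Z.det (λ a b c → entry κ n b c a) (downFrom n) (downFrom n) r
      ≈⟨ *-congˡ (Z.det-cong (downFrom n) (downFrom n) (λ a b c →
           reflexive (≡.cong q (entry-transpose κ n a b c))) r) ⟩
    sign r * Z.det (λ a b c → entry n κ a c b) (downFrom n) (downFrom n) r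
      ≈⟨ numerator-det κ (ℕ.m≤n+m n m) 0 r ⟨
    q (base κ r) * numerator κ (ℕ.m≤n+m n m) 0 r
      ≈⟨ *-congʳ (≈-trans (reflexive (≡.cong q (base-+ m n (tri n ℕ.* r) (tri r) (tri₂ n)))) (q-+ _ _)) ⟩
    (q (base n r) * q (m ℕ.* tri r)) * numerator κ (ℕ.m≤n+m n m) 0 r
      ≈⟨ *-assoc _ _ _ ⟩
    q (base n r) * (q (m ℕ.* tri r) * numerator κ (ℕ.m≤n+m n m) 0 r) ∎)
    where
    κ = m ℕ.+ n

module PrincipalSpecialization where

  -- Formal power series over ℤ

  module ℤSums = ListSums ℤ.+-*-commutativeRing
  module ℤSeries = PowerSeries ℤ.+-*-commutativeRing

  sumℤ-applyUpTo : ∀ (h : ℕ → ℤ) (g : ℕ → ℕ) k →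
    sumℤ (map h (applyUpTo g (suc k))) ≡ ℤSums.sum≤ k (h ∘ g)
  sumℤ-applyUpTo h g zero = ℤ.+-identityʳ _
  sumℤ-applyUpTo h g (suc k) = ≡.cong (λ z → h (g 0) ℤ.+ z) (sumℤ-applyUpTo h (g ∘ suc) k)

  ⊗≡conv : ∀ f g k → (f ⊗ g) k ≡ ℤSeries.conv f g k
  ⊗≡conv f g k = sumℤ-applyUpTo (λ i → f i ℤ.* g (k ∸ i)) id k

  mono-conv-≥ : ∀ e f k → ℤSeries.conv (mono e) f (e ℕ.+ k) ≡ f k
  mono-conv-≥ zero f k = ≡.trans
    (ℤSeries.conv-cong {mono 0} {ℤSeries.one} {f} (λ { zero → ≡.refl ; (suc _) → ≡.refl }) (λ _ → ≡.refl) k)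
    (ℤSeries.conv-identityˡ f k)
  mono-conv-≥ (suc e) f k = ≡.trans
    (≡.cong (ℤ._+ ℤSeries.conv (mono e) f (e ℕ.+ k)) (ℤ.*-zeroˡ (f (suc (e ℕ.+ k)))))
    (≡.trans (ℤ.+-identityˡ _) (mono-conv-≥ e f k))

  mono-conv-< : ∀ {e} f {k} → k ℕ.< e → ℤSeries.conv (mono e) f k ≡ ℤ.0ℤ
  mono-conv-< f {zero} (s≤s _) = ℤ.*-zeroˡ (f 0)
  mono-conv-< f {suc k} (s≤s k<e) = ≡.trans
    (≡.cong₂ ℤ._+_ (ℤ.*-zeroˡ (f (suc k))) (mono-conv-< f k<e)) ≡.refl

  mono-⊗-≥ : ∀ e f k → (mono e ⊗ f) (e ℕ.+ k) ≡ f k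
  mono-⊗-≥ e f k = ≡.trans (⊗≡conv (mono e) f (e ℕ.+ k)) (mono-conv-≥ e f k)

  mono-⊗-< : ∀ {e} f {k} → k ℕ.< e → (mono e ⊗ f) k ≡ ℤ.0ℤ
  mono-⊗-< {e} f k<e = ≡.trans (⊗≡conv (mono e) f _) (mono-conv-< f k<e)

  mono-< : ∀ {e k} → k ℕ.< e → mono e k ≡ ℤ.0ℤ
  mono-< {suc e} {zero} _ = ≡.refl
  mono-< {suc e} {suc k} (s≤s p) = mono-< {e} {k} p

  mono-shift : ∀ x y j → mono (x ℕ.+ y) (x ℕ.+ j) ≡ mono y j
  mono-shift zero y j = ≡.refl
  mono-shift (suc x) y j = mono-shift x y j

  mono-+ : ∀ x y → ∀ k → mono (x ℕ.+ y) k ≡ (mono x ⊗ mono y) k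
  mono-+ x y k with x ℕ.≤? k
  ... | no x≰k = ≡.trans (mono-< (ℕ.<-≤-trans (ℕ.≰⇒> x≰k) (ℕ.m≤m+n x y)))
    (≡.sym (mono-⊗-< (mono y) (ℕ.≰⇒> x≰k)))
  ... | yes x≤k with j , ≡.refl ← ℕ.m≤n⇒∃[o]m+o≡n x≤k =
    ≡.trans (mono-shift x y j) (≡.sym (mono-⊗-≥ x (mono y) j))

  -- `invUpTo` lists its coefficients in descending order, so zipping it with ascending ones is a
  -- Cauchy product. General `h` and `g` allow the list to be shortened from the front.
  sumℤ-invUpTo : ∀ f (h : ℕ → ℤ) (g : ℕ → ℕ) k →
    sumℤ (zipWith ℤ._*_ (map h (applyUpTo g (suc k))) (invUpTo f k)) ≡ ℤSeries.conv (h ∘ g) (inv f) k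
  sumℤ-invUpTo f h g zero = ℤ.+-identityʳ _
  sumℤ-invUpTo f h g (suc k) =
    ≡.cong (λ z → h (g 0) ℤ.* inv f (suc k) ℤ.+ z) (sumℤ-invUpTo f h (g ∘ suc) k)

  ⊗-inv : ∀ f → f 0 ≡ ℤ.1ℤ → ∀ k → (f ⊗ inv f) k ≡ onePS k
  ⊗-inv f u k = ≡.trans (⊗≡conv f (inv f) k) (go k)
    where
    go : ∀ k → ℤSeries.conv f (inv f) k ≡ onePS k
    go zero = ≡.cong (ℤ._* ℤ.1ℤ) u
    go (suc k) = ≡.trans
      (≡.cong₂ ℤ._+_
        (≡.trans (≡.cong (ℤ._* inv f (suc k)) u) (≡.trans (ℤ.*-identityˡ _)
          (≡.cong ℤ.-_ (sumℤ-invUpTo f (f ∘ suc) id k))))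
        ≡.refl)
      (ℤ.+-inverseˡ (ℤSeries.conv (f ∘ suc) (inv f) k))

  -- Opaque, so that equality of series is not unfolded to coefficients elsewhere.
  opaque
    seriesRing : CommutativeRing 0ℓ 0ℓ
    seriesRing = record
      { isCommutativeRing =
          Algebra.Morphism.RingMonomorphism.isCommutativeRing embedding S.isCommutativeRing
      }
      where
      rawSeries : RawRing 0ℓ 0ℓ
      rawSeries = record
        { Carrier = PS
        ; _≈_ = λ f g → ∀ k → f k ≡ g k
        ; _+_ = _⊕_
        ; _*_ = _⊗_
        ; -_ = λ f k → ℤ.- f k
        ; 0# = zeroPS
        ; 1# = onePS
        }
      module S = CommutativeRing ℤSeries.ring′

      embedding : IsRingMonomorphism rawSeries S.rawRing id
      embedding = record
        { isRingHomomorphism = record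
          { isSemiringHomomorphism = record
            { isNearSemiringHomomorphism = record
              { +-isMonoidHomomorphism = record
                { isMagmaHomomorphism = record
                  { isRelHomomorphism = record { cong = id }
                  ; homo = λ f g k → ≡.refl
                  }
                ; ε-homo = λ k → ≡.refl
                }
              ; *-homo = ⊗≡conv
              }
            ; 1#-homo = λ { zero → ≡.refl ; (suc k) → ≡.refl }
            }
          ; -‿homo = λ f k → ≡.refl
          }
        ; injective = id
        }

  module 𝕊 = CommutativeRing seriesRing
  open 𝕊 using (_≈_; _+_; _*_; _-_; -_; 0#; 1#) renaming (Carrier to Series)
  open RingSolver seriesRing
  open ListSums seriesRing
  module ≈-Reasoning = Relation.Binary.Reasoning.Setoid 𝕊.setoid

  infix 4 _≈[_]_

  opaque
    unfolding seriesRing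

    ⟦_⟧ : PS → Series
    ⟦ f ⟧ = f

    coeff : Series → PS
    coeff f = f

    coeff-⟦⟧ : ∀ f k → coeff ⟦ f ⟧ k ≡ f k
    coeff-⟦⟧ f k = ≡.refl

    ⟦⊕⟧ : ∀ f g → ⟦ f ⊕ g ⟧ ≈ ⟦ f ⟧ + ⟦ g ⟧
    ⟦⊕⟧ f g k = ≡.refl

    ⟦⊖⟧ : ∀ f g → ⟦ f ⊖ g ⟧ ≈ ⟦ f ⟧ - ⟦ g ⟧
    ⟦⊖⟧ f g k = ≡.refl

    ⟦⊗⟧ : ∀ f g → ⟦ f ⊗ g ⟧ ≈ ⟦ f ⟧ * ⟦ g ⟧
    ⟦⊗⟧ f g k = ≡.refl

    ⟦zeroPS⟧ : ⟦ zeroPS ⟧ ≈ 0#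
    ⟦zeroPS⟧ k = ≡.refl

    ⟦onePS⟧ : ⟦ onePS ⟧ ≈ 1#
    ⟦onePS⟧ k = ≡.refl

    Unit : Series → Set
    Unit f = coeff f 0 ≡ ℤ.1ℤ

    Unit-⟦⟧ : ∀ {f} → f 0 ≡ ℤ.1ℤ → Unit ⟦ f ⟧
    Unit-⟦⟧ u = u

    Unit-coeff : ∀ {f} → Unit ⟦ f ⟧ → f 0 ≡ ℤ.1ℤ
    Unit-coeff u = u

    Unit-1 : Unit 1#
    Unit-1 = ≡.refl

    Unit-* : ∀ {x y} → Unit x → Unit y → Unit (x * y)
    Unit-* {x} {y} ux uy = ≡.trans (⊗≡conv x y 0) (≡.cong₂ ℤ._*_ ux uy)

    Unit-cong : ∀ {x y} → x ≈ y → Unit x → Unit y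
    Unit-cong eq u = ≡.trans (≡.sym (eq 0)) u

    inverse : Series → Series
    inverse f = inv f

    ⟦inv⟧ : ∀ f → ⟦ inv f ⟧ ≡ inverse ⟦ f ⟧
    ⟦inv⟧ f = ≡.refl

    *-inverse : ∀ x → Unit x → x * inverse x ≈ 1#
    *-inverse x u = ⊗-inv x u

    Unit-inverse : ∀ {x} → Unit x → Unit (inverse x)
    Unit-inverse _ = ≡.refl

    q : ℕ → Series
    q e = mono e

    ⟦mono⟧ : ∀ e → ⟦ mono e ⟧ ≡ q e
    ⟦mono⟧ e = ≡.refl

    q-0 : q 0 ≈ 1#
    q-0 k = ≡.refl

    q-+ : ∀ x y → q (x ℕ.+ y) ≈ q x * q y
    q-+ = mono-+

    q-cancelˡ : ∀ e {f g} → q e * f ≈ q e * g → f ≈ g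
    q-cancelˡ e {f} {g} eq k =
      ≡.trans (≡.sym (mono-⊗-≥ e f k)) (≡.trans (eq (e ℕ.+ k)) (mono-⊗-≥ e g k))

    Unit-1-q : ∀ {e} → e ≢ 0 → Unit (1# - q e)
    Unit-1-q {zero} e≢0 = ⊥-elim (e≢0 ≡.refl)
    Unit-1-q {suc e} _ = ≡.refl

    -- Congruence modulo `q^K`, the form in which all limits are taken.
    _≈[_]_ : Series → ℕ → Series → Set
    f ≈[ K ] g = ∀ k → k ℕ.< K → f k ≡ g k

    ≈[]⇒≈ : ∀ {f g} → (∀ K → f ≈[ K ] g) → f ≈ g
    ≈[]⇒≈ eq k = eq (suc k) k ℕ.≤-refl

    coeff⇒≈[] : ∀ {K f g} → (∀ k → k ℕ.< K → coeff f k ≡ coeff g k) → f ≈[ K ] g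
    coeff⇒≈[] eq = eq

    Unit-cong[] : ∀ {K f g} → f ≈[ suc K ] g → Unit f → Unit g
    Unit-cong[] eq u = ≡.trans (≡.sym (eq 0 (s≤s z≤n))) u

    coeff-≈[] : ∀ {K f g} → f ≈[ K ] g → ∀ k → k ℕ.< K → coeff f k ≡ coeff g k
    coeff-≈[] p = p

    ≈⇒≈[] : ∀ {K f g} → f ≈ g → f ≈[ K ] g
    ≈⇒≈[] eq k _ = eq k

    refl[] : ∀ {K f} → f ≈[ K ] f
    refl[] k _ = ≡.refl

    sym[] : ∀ {K f g} → f ≈[ K ] g → g ≈[ K ] f
    sym[] p k k< = ≡.sym (p k k<)

    trans[] : ∀ {K f g h} → f ≈[ K ] g → g ≈[ K ] h → f ≈[ K ] h
    trans[] p q k k< = ≡.trans (p k k<) (q k k<)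

    +-cong[] : ∀ {K f f′ g g′} → f ≈[ K ] f′ → g ≈[ K ] g′ → f + g ≈[ K ] f′ + g′
    +-cong[] p q k k< = ≡.cong₂ ℤ._+_ (p k k<) (q k k<)

    -‿cong[] : ∀ {K f f′} → f ≈[ K ] f′ → - f ≈[ K ] - f′
    -‿cong[] p k k< = ≡.cong ℤ.-_ (p k k<)

    *-cong[] : ∀ {K f f′ g g′} → f ≈[ K ] f′ → g ≈[ K ] g′ → f * g ≈[ K ] f′ * g′
    *-cong[] {K} {f} {f′} {g} {g′} p q k k< = ≡.trans (⊗≡conv f g k) (≡.trans
      (ℤSums.sum≤-cong≤ k (λ i i≤k → ≡.cong₂ ℤ._*_ (p i (ℕ.≤-<-trans i≤k k<))
        (q (k ∸ i) (ℕ.≤-<-trans (ℕ.m∸n≤m k i) k<))))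
      (≡.sym (⊗≡conv f′ g′ k)))

    ≈[]-mono : ∀ {K L f g} → K ℕ.≤ L → f ≈[ L ] g → f ≈[ K ] g
    ≈[]-mono K≤L p k k< = p k (ℕ.<-≤-trans k< K≤L)

    -- A factor `q s` raises the precision from `K` to `s + K`; this gain pays for the later
    -- division by the normalizing power.
    q-*-cong[] : ∀ {K} s {f g} → f ≈[ K ] g → q s * f ≈[ s ℕ.+ K ] q s * g
    q-*-cong[] {K} s {f} {g} p k k< with s ℕ.≤? k
    ... | no s≰k = ≡.trans (mono-⊗-< f (ℕ.≰⇒> s≰k)) (≡.sym (mono-⊗-< g (ℕ.≰⇒> s≰k)))
    ... | yes s≤k with j , ≡.refl ← ℕ.m≤n⇒∃[o]m+o≡n s≤k =
      ≡.trans (mono-⊗-≥ s f j) (≡.trans (p j (ℕ.+-cancelˡ-< s j K k<)) (≡.sym (mono-⊗-≥ s g j)))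

    coeff-q-≥ : ∀ s f k → coeff (q s * f) (s ℕ.+ k) ≡ coeff f k
    coeff-q-≥ = mono-⊗-≥

    coeff-q-< : ∀ {s} f {k} → k ℕ.< s → coeff (q s * f) k ≡ ℤ.0ℤ
    coeff-q-< = mono-⊗-<

    q≈0 : ∀ {K e} → K ℕ.≤ e → q e ≈[ K ] 0#
    q≈0 K≤e k k< = mono-< (ℕ.<-≤-trans k< K≤e)

  module _ {K : ℕ} where
    open Congruence (_≈[ K ]_) refl[] +-cong[] *-cong[] public
      using () renaming (prodL-cong∈ to prodL-cong∈[]; prodL-cong to prodL-cong[];
        sumComp-cong to sumComp-cong[])

  Unit-prodL : ∀ {a} {A : Set a} {f : A → Series} xs → (∀ x → Unit (f x)) → Unit (prodL f xs)
  Unit-prodL [] u = Unit-1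
  Unit-prodL (x ∷ xs) u = Unit-* (u x) (Unit-prodL xs u)

  ⟦prodPS⟧ : ∀ {A : Set} (f : A → PS) xs → ⟦ prodPS (map f xs) ⟧ ≈ prodL (λ x → ⟦ f x ⟧) xs
  ⟦prodPS⟧ f [] = ⟦onePS⟧
  ⟦prodPS⟧ f (x ∷ xs) = 𝕊.trans (⟦⊗⟧ _ _) (𝕊.*-congˡ (⟦prodPS⟧ f xs))

  ⟦sumPS⟧ : ∀ {A : Set} (f : A → PS) xs → ⟦ sumPS (map f xs) ⟧ ≈ sumL (λ x → ⟦ f x ⟧) xs
  ⟦sumPS⟧ f [] = ⟦zeroPS⟧
  ⟦sumPS⟧ f (x ∷ xs) = 𝕊.trans (⟦⊕⟧ _ _) (𝕊.+-congˡ (⟦sumPS⟧ f xs))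

  unit-cancel : ∀ u {f g} → Unit u → u * f ≈ u * g → f ≈ g
  unit-cancel u {f} {g} uu eq = begin
    f                 ≈⟨ 𝕊.*-identityˡ f ⟨
    1# * f         ≈⟨ 𝕊.*-congʳ (*-inverse u uu) ⟨
    (u * inverse u) * f   ≈⟨ solve 3 (λ u v f → (u :* v) :* f := v :* (u :* f)) 𝕊.refl u (inverse u) f ⟩
    inverse u * (u * f)   ≈⟨ 𝕊.*-congˡ eq ⟩
    inverse u * (u * g)   ≈⟨ solve 3 (λ u v f → (u :* v) :* f := v :* (u :* f)) 𝕊.refl u (inverse u) g ⟨
    (u * inverse u) * g   ≈⟨ 𝕊.*-congʳ (*-inverse u uu) ⟩
    1# * g         ≈⟨ 𝕊.*-identityˡ g ⟩
    g                 ∎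
    where open ≈-Reasoning

  q-split : ∀ {x y} → x ℕ.≤ y → q y ≈ q (y ∸ x) * q x
  q-split {x} {y} x≤y = 𝕊.trans
    (𝕊.reflexive (≡.cong q (≡.sym (ℕ.m∸n+n≡m x≤y)))) (q-+ (y ∸ x) x)

  q-minus : ∀ {x y} → x ℕ.≤ y → q x - q y ≈ q x * (1# - q (y ∸ x))
  q-minus {x} {y} x≤y = 𝕊.trans (𝕊.+-congˡ (𝕊.-‿cong (q-split x≤y)))
    (solve 2 (λ x e → x :- e :* x := x :* (:1 :- e)) 𝕊.refl (q x) (q (y ∸ x)))

  q-minus-cancel< : ∀ {x y f g} → x ℕ.< y →
    (q x - q y) * f ≈ (q x - q y) * g → f ≈ g
  q-minus-cancel< {x} {y} {f} {g} x<y eq =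
    unit-cancel (1# - q (y ∸ x)) (Unit-1-q (ℕ.m>n⇒m∸n≢0 x<y)) (q-cancelˡ x (begin
      q x * ((1# - q (y ∸ x)) * f)   ≈⟨ 𝕊.*-assoc (q x) (1# - q (y ∸ x)) f ⟨
      (q x * (1# - q (y ∸ x))) * f   ≈⟨ 𝕊.*-congʳ (q-minus (ℕ.<⇒≤ x<y)) ⟨
      (q x - q y) * f                   ≈⟨ eq ⟩
      (q x - q y) * g                   ≈⟨ 𝕊.*-congʳ (q-minus (ℕ.<⇒≤ x<y)) ⟩
      (q x * (1# - q (y ∸ x))) * g   ≈⟨ 𝕊.*-assoc (q x) (1# - q (y ∸ x)) g ⟩
      q x * ((1# - q (y ∸ x)) * g)   ∎))
    where open ≈-Reasoning

  q-minus-cancel : ∀ {x y f g} → x ≢ y →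
    (q x - q y) * f ≈ (q x - q y) * g → f ≈ g
  q-minus-cancel {x} {y} {f} {g} x≢y eq with ℕ.<-cmp x y
  ... | tri< x<y _ _ = q-minus-cancel< x<y eq
  ... | tri≈ _ x≡y _ = ⊥-elim (x≢y x≡y)
  ... | tri> _ _ y<x = q-minus-cancel< y<x (𝕊.trans (flip-sign f)
    (𝕊.trans (𝕊.-‿cong eq) (𝕊.sym (flip-sign g))))
    where
    flip-sign : ∀ h → (q y - q x) * h ≈ - ((q x - q y) * h)
    flip-sign h = solve 3 (λ x y h → (y :- x) :* h := :- ((x :- y) :* h)) 𝕊.refl (q x) (q y) h

  geometric : ℕ → Series
  geometric e = inverse (1# - q e)

  geometric-inverse : ∀ {e} → e ≢ 0 → (1# - q e) * geometric e ≈ 1#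
  geometric-inverse {e} e≢0 = *-inverse (1# - q e) (Unit-1-q e≢0)

  inverse-unique : ∀ u {v} → Unit u → u * v ≈ 1# → v ≈ inverse u
  inverse-unique u uu eq = unit-cancel u uu (𝕊.trans eq (𝕊.sym (*-inverse u uu)))

  ⟦inv⟧≈ : ∀ f {u} → f 0 ≡ ℤ.1ℤ → ⟦ f ⟧ ≈ u → ⟦ inv f ⟧ ≈ inverse u
  ⟦inv⟧≈ f {u} uf eq = inverse-unique u (Unit-cong eq (Unit-⟦⟧ uf)) (begin
    u * ⟦ inv f ⟧          ≈⟨ 𝕊.*-cong (𝕊.sym eq) (𝕊.reflexive (⟦inv⟧ f)) ⟩
    ⟦ f ⟧ * inverse ⟦ f ⟧  ≈⟨ *-inverse ⟦ f ⟧ (Unit-⟦⟧ uf) ⟩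
    1#                     ∎)
    where open ≈-Reasoning

  ⟦1⊖mono⟧ : ∀ e → ⟦ onePS ⊖ mono e ⟧ ≈ 1# - q e
  ⟦1⊖mono⟧ e = 𝕊.trans (⟦⊖⟧ onePS (mono e))
    (𝕊.+-cong ⟦onePS⟧ (𝕊.-‿cong (𝕊.reflexive (⟦mono⟧ e))))

  -- The expansion of `qˣ / (qˣ - qʸ)`. For `x > y` it has order `x - y`, and for `x < y` it is 1 up
  -- to order `y - x`; all convergence below rests on these two facts.
  quotient : ℕ → ℕ → Series
  quotient x y = if x ℕ.<ᵇ y
    then geometric (y ∸ x)
    else - (q (x ∸ y) * geometric (x ∸ y))

  ⟦geometric⟧ : ∀ {e} → e ≢ 0 → ⟦ inv (onePS ⊖ mono e) ⟧ ≈ geometric e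
  ⟦geometric⟧ {e} e≢0 = ⟦inv⟧≈ (onePS ⊖ mono e)
    (Unit-coeff (Unit-cong (𝕊.sym (⟦1⊖mono⟧ e)) (Unit-1-q e≢0))) (⟦1⊖mono⟧ e)

  quotient-< : ∀ {x y} → x ℕ.< y → quotient x y ≡ geometric (y ∸ x)
  quotient-< {x} {y} x<y with x ℕ.<ᵇ y in eq
  ... | true = ≡.refl
  ... | false = ⊥-elim (≡.subst T eq (ℕ.<⇒<ᵇ x<y))

  quotient-> : ∀ {x y} → y ℕ.< x → quotient x y ≡ - (q (x ∸ y) * geometric (x ∸ y))
  quotient-> {x} {y} y<x with x ℕ.<ᵇ y in eq
  ... | false = ≡.refl
  ... | true = ⊥-elim (ℕ.<-asym y<x (ℕ.<ᵇ⇒< x y (≡.subst T (≡.sym eq) _)))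

  quotient-def : ∀ {x y} → x ≢ y → (q x - q y) * quotient x y ≈ q x
  quotient-def {x} {y} x≢y with ℕ.<-cmp x y
  ... | tri≈ _ x≡y _ = ⊥-elim (x≢y x≡y)
  ... | tri< x<y _ _ = begin
    (q x - q y) * quotient x y
      ≈⟨ 𝕊.*-cong (q-minus (ℕ.<⇒≤ x<y)) (𝕊.reflexive (quotient-< x<y)) ⟩
    (q x * (1# - q e)) * geometric e
      ≈⟨ 𝕊.*-assoc (q x) (1# - q e) (geometric e) ⟩
    q x * ((1# - q e) * geometric e)
      ≈⟨ 𝕊.*-congˡ (geometric-inverse (ℕ.m>n⇒m∸n≢0 x<y)) ⟩
    q x * 1#
      ≈⟨ 𝕊.*-identityʳ (q x) ⟩
    q x ∎
    where open ≈-Reasoning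
          e = y ∸ x
  ... | tri> _ _ y<x = begin
    (q x - q y) * quotient x y
      ≈⟨ 𝕊.*-congˡ (𝕊.reflexive (quotient-> y<x)) ⟩
    (q x - q y) * (- (q e * geometric e))
      ≈⟨ solve 4 (λ x y e g → (x :- y) :* (:- (e :* g)) := ((y :- x) :* g) :* e)
           𝕊.refl (q x) (q y) (q e) (geometric e) ⟩
    ((q y - q x) * geometric e) * q e
      ≈⟨ 𝕊.*-congʳ (𝕊.*-congʳ (q-minus (ℕ.<⇒≤ y<x))) ⟩
    ((q y * (1# - q e)) * geometric e) * q e
      ≈⟨ solve 4 (λ y u g e → ((y :* u) :* g) :* e := (u :* g) :* (e :* y))
           𝕊.refl (q y) (1# - q e) (geometric e) (q e) ⟩
    ((1# - q e) * geometric e) * (q e * q y)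
      ≈⟨ 𝕊.*-cong (geometric-inverse (ℕ.m>n⇒m∸n≢0 y<x)) (𝕊.sym (q-split (ℕ.<⇒≤ y<x))) ⟩
    1# * q x
      ≈⟨ 𝕊.*-identityˡ (q x) ⟩
    q x ∎
    where open ≈-Reasoning
          e = x ∸ y

  seriesPoints : PointSystem seriesRing
  seriesPoints = record
    { q = q
    ; q-0 = q-0
    ; q-+ = q-+
    ; cancel = q-minus-cancel
    ; G = quotient
    ; G-def = quotient-def
    }

  open Points seriesRing seriesPoints
    using (ratioG; module HallLittlewood; prod-upTo-suc; perms-cong)
  open Algebra.Properties.Semiring.Exp 𝕊.semiring using (_^_; ^-homo-*)

  unit-cancel[] : ∀ {K} u {f g} → Unit u → u * f ≈[ K ] u * g → f ≈[ K ] g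
  unit-cancel[] u {f} {g} uu eq = trans[] (sym[] (≈⇒≈[] (strip f)))
    (trans[] (*-cong[] refl[] eq) (≈⇒≈[] (strip g)))
    where
    strip : ∀ h → inverse u * (u * h) ≈ h
    strip h = begin
      inverse u * (u * h) ≈⟨ solve 3 (λ u v f → v :* (u :* f) := (u :* v) :* f) 𝕊.refl u (inverse u) h ⟩
      (u * inverse u) * h ≈⟨ 𝕊.*-congʳ (*-inverse u uu) ⟩
      1# * h              ≈⟨ 𝕊.*-identityˡ h ⟩
      h                   ∎
      where open ≈-Reasoning

  1-q≈1 : ∀ {K e} → K ℕ.≤ e → 1# - q e ≈[ K ] 1#
  1-q≈1 K≤e = trans[] (+-cong[] refl[] (-‿cong[] (q≈0 K≤e)))
    (≈⇒≈[] (solve 1 (λ x → x :- :0 := x) 𝕊.refl 1#))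

  geometric≈1 : ∀ {K e} → K ℕ.≤ e → e ≢ 0 → geometric e ≈[ K ] 1#
  geometric≈1 {e = e} K≤e e≢0 = unit-cancel[] (1# - q e) (Unit-1-q e≢0)
    (trans[] (≈⇒≈[] (geometric-inverse e≢0))
      (trans[] (sym[] (1-q≈1 K≤e)) (≈⇒≈[] (𝕊.sym (𝕊.*-identityʳ (1# - q e))))))

  quotient≈1 : ∀ {K x y} → x ℕ.< y → K ℕ.≤ y ∸ x → quotient x y ≈[ K ] 1#
  quotient≈1 {K} {x} {y} x<y K≤ = ≡.subst (λ f → f ≈[ K ] 1#) (≡.sym (quotient-< x<y))
    (geometric≈1 K≤ (ℕ.m>n⇒m∸n≢0 x<y))

  quotient≈0 : ∀ {K x y} → y ℕ.< x → K ℕ.≤ x ∸ y → quotient x y ≈[ K ] 0#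
  quotient≈0 {K} {x} {y} y<x K≤ = ≡.subst (λ f → f ≈[ K ] 0#) (≡.sym (quotient-> y<x))
    (trans[] (-‿cong[] (*-cong[] (q≈0 K≤) refl[]))
      (≈⇒≈[] (solve 1 (λ g → :- (:0 :* g) := :0) 𝕊.refl (geometric (x ∸ y)))))

  -- Both expansions used by `ratio`, and `ratioG`, become `q a - q n * q b` after multiplication by
  -- `q a - q b`.
  ratio≈ratioG : ∀ n {a b} → a ≢ b → ⟦ ratio n a b ⟧ ≈ ratioG (q n) a b
  ratio≈ratioG n {a} {b} a≢b = q-minus-cancel a≢b (𝕊.trans (go (ℕ.<-cmp a b)) (𝕊.sym (begin
    (q a - q b) * ratioG (q n) a b
      ≈⟨ solve 4 (λ a b t g → (a :- b) :* (t :+ (:1 :- t) :* g) :=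
           (:1 :- t) :* ((a :- b) :* g) :+ t :* (a :- b))
           𝕊.refl (q a) (q b) (q n) (quotient a b) ⟩
    (1# - q n) * ((q a - q b) * quotient a b) + q n * (q a - q b)
      ≈⟨ 𝕊.+-congʳ (𝕊.*-congˡ (quotient-def a≢b)) ⟩
    (1# - q n) * q a + q n * (q a - q b)
      ≈⟨ solve 3 (λ a b t → (:1 :- t) :* a :+ t :* (a :- b) := a :- t :* b)
           𝕊.refl (q a) (q b) (q n) ⟩
    q a - q n * q b ∎)))
    where
    open ≈-Reasoning
    go : _ → (q a - q b) * ⟦ ratio n a b ⟧ ≈ q a - q n * q b
    go (tri≈ _ a≡b _) = ⊥-elim (a≢b a≡b)
    go (tri< a<b _ _) with a ℕ.<ᵇ b in eq
    ... | false = ⊥-elim (≡.subst T eq (ℕ.<⇒<ᵇ a<b))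
    ... | true = begin
      (q a - q b) * ⟦ (onePS ⊖ mono ((b ℕ.+ n) ∸ a)) ⊗ inv (onePS ⊖ mono (b ∸ a)) ⟧
        ≈⟨ 𝕊.*-congˡ (𝕊.trans (⟦⊗⟧ _ _) (𝕊.*-cong (⟦1⊖mono⟧ _) (⟦geometric⟧ (ℕ.m>n⇒m∸n≢0 a<b)))) ⟩
      (q a - q b) * ((1# - q ((b ℕ.+ n) ∸ a)) * geometric (b ∸ a))
        ≈⟨ 𝕊.*-congʳ (q-minus (ℕ.<⇒≤ a<b)) ⟩
      (q a * (1# - q (b ∸ a))) * ((1# - q ((b ℕ.+ n) ∸ a)) * geometric (b ∸ a))
        ≈⟨ solve 4 (λ a u v g → (a :* u) :* (v :* g) := (u :* g) :* (a :* v)) 𝕊.refl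
             (q a) (1# - q (b ∸ a)) (1# - q ((b ℕ.+ n) ∸ a)) (geometric (b ∸ a)) ⟩
      ((1# - q (b ∸ a)) * geometric (b ∸ a)) * (q a * (1# - q ((b ℕ.+ n) ∸ a)))
        ≈⟨ 𝕊.*-cong (geometric-inverse (ℕ.m>n⇒m∸n≢0 a<b))
             (𝕊.sym (q-minus (ℕ.≤-trans (ℕ.<⇒≤ a<b) (ℕ.m≤m+n b n)))) ⟩
      1# * (q a - q (b ℕ.+ n))
        ≈⟨ 𝕊.*-identityˡ (q a - q (b ℕ.+ n)) ⟩
      q a - q (b ℕ.+ n)
        ≈⟨ 𝕊.+-congˡ (𝕊.-‿cong (𝕊.trans (𝕊.reflexive (≡.cong q (ℕ.+-comm b n))) (q-+ n b))) ⟩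
      q a - q n * q b ∎
    go (tri> _ _ b<a) with a ℕ.<ᵇ b in eq
    ... | true = ⊥-elim (ℕ.<-asym b<a (ℕ.<ᵇ⇒< a b (≡.subst T (≡.sym eq) _)))
    ... | false = begin
      (q a - q b) * ⟦ (mono n ⊖ mono (a ∸ b)) ⊗ inv (onePS ⊖ mono (a ∸ b)) ⟧
        ≈⟨ 𝕊.*-congˡ (𝕊.trans (⟦⊗⟧ _ _) (𝕊.*-cong
             (𝕊.trans (⟦⊖⟧ _ _) (𝕊.+-cong (𝕊.reflexive (⟦mono⟧ n)) (𝕊.-‿cong (𝕊.reflexive (⟦mono⟧ (a ∸ b))))))
             (⟦geometric⟧ (ℕ.m>n⇒m∸n≢0 b<a)))) ⟩
      (q a - q b) * ((q n - q (a ∸ b)) * geometric (a ∸ b))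
        ≈⟨ solve 4 (λ a b v g → (a :- b) :* (v :* g) := ((b :- a) :* g) :* (:- v))
             𝕊.refl (q a) (q b) (q n - q (a ∸ b)) (geometric (a ∸ b)) ⟩
      ((q b - q a) * geometric (a ∸ b)) * (- (q n - q (a ∸ b)))
        ≈⟨ 𝕊.*-congʳ (𝕊.*-congʳ (q-minus (ℕ.<⇒≤ b<a))) ⟩
      ((q b * (1# - q (a ∸ b))) * geometric (a ∸ b)) * (- (q n - q (a ∸ b)))
        ≈⟨ solve 5 (λ b u g t e → ((b :* u) :* g) :* (:- (t :- e)) := (u :* g) :* (e :* b :- t :* b))
             𝕊.refl (q b) (1# - q (a ∸ b)) (geometric (a ∸ b)) (q n) (q (a ∸ b)) ⟩
      ((1# - q (a ∸ b)) * geometric (a ∸ b)) * (q (a ∸ b) * q b - q n * q b)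
        ≈⟨ 𝕊.*-cong (geometric-inverse (ℕ.m>n⇒m∸n≢0 b<a))
             (𝕊.+-congʳ (𝕊.sym (q-split (ℕ.<⇒≤ b<a)))) ⟩
      1# * (q a - q n * q b)
        ≈⟨ 𝕊.*-identityˡ (q a - q n * q b) ⟩
      q a - q n * q b ∎

  -- Subsets and residue chains

  downFrom↭upTo : ∀ n → downFrom n ↭ upTo n
  downFrom↭upTo n = ↭-trans (↭-reflexive (≡.sym (List.reverse-upTo n))) (↭-reverse (upTo n))

  chain-shift : ∀ d a ℓ → chain d (a ℕ.+ d) ℓ ≡ map (d ℕ.+_) (chain d a ℓ)
  chain-shift d a zero = ≡.refl
  chain-shift d a (suc ℓ) = ≡.cong₂ _∷_ (ℕ.+-comm a d) (chain-shift d (a ℕ.+ d) ℓ)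

  upTo-+ : ∀ a b → upTo (a ℕ.+ b) ≡ upTo a ++ map (a ℕ.+_) (upTo b)
  upTo-+ a b = go id a
    where
    go : ∀ (f : ℕ → ℕ) a → applyUpTo f (a ℕ.+ b) ≡ applyUpTo f a ++ map (λ i → f (a ℕ.+ i)) (upTo b)
    go f zero = ≡.sym (List.map-upTo f b)
    go f (suc a) = ≡.cong (f 0 ∷_) (go (f ∘ suc) a)

  -- The number of x < L n + s congruent to a modulo n, for a , s < n.
  chainLength : ℕ → ℕ → ℕ → ℕ
  chainLength L s a = (if a ℕ.<ᵇ s then 1 else 0) ℕ.+ L

  L≤chainLength : ∀ L s a → L ℕ.≤ chainLength L s a
  L≤chainLength L s a = ℕ.m≤n+m L _

  module _ (n : ℕ) where
    open ChainSums seriesRing n using (chains)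

    chains-0 : ∀ s k → chains (chainLength 0 s) (downFrom k) ≡ downFrom (k ℕ.⊓ s)
    chains-0 s zero = ≡.refl
    chains-0 s (suc k) with k ℕ.<ᵇ s in eq
    ... | true = begin
      k ∷ chains (chainLength 0 s) (downFrom k) ≡⟨ ≡.cong (k ∷_) (chains-0 s k) ⟩
      k ∷ downFrom (k ℕ.⊓ s)                    ≡⟨ ≡.cong (λ j → k ∷ downFrom j) (ℕ.m≤n⇒m⊓n≡m (ℕ.<⇒≤ k<s)) ⟩
      downFrom (suc k)                          ≡⟨ ≡.cong downFrom (ℕ.m≤n⇒m⊓n≡m k<s) ⟨
      downFrom (suc k ℕ.⊓ s)                    ∎
      where
      open ≡.≡-Reasoning
      k<s : k ℕ.< s
      k<s = ℕ.<ᵇ⇒< k s (≡.subst T (≡.sym eq) _)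
    ... | false = begin
      chains (chainLength 0 s) (downFrom k)     ≡⟨ chains-0 s k ⟩
      downFrom (k ℕ.⊓ s)                        ≡⟨ ≡.cong downFrom (ℕ.m≥n⇒m⊓n≡n s≤k) ⟩
      downFrom s                                ≡⟨ ≡.cong downFrom (ℕ.m≥n⇒m⊓n≡n (ℕ.m≤n⇒m≤1+n s≤k)) ⟨
      downFrom (suc k ℕ.⊓ s)                    ∎
      where
      open ≡.≡-Reasoning
      s≤k : s ℕ.≤ k
      s≤k = ℕ.≮⇒≥ (λ k<s → ≡.subst T eq (ℕ.<⇒<ᵇ k<s))

    -- Each chain is its first entry followed by the translate by `n` of a chain one shorter.
    chains-suc : ∀ L s as → chains (chainLength (suc L) s) as ↭
      as ++ map (n ℕ.+_) (chains (chainLength L s) as)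
    chains-suc L s [] = refl
    chains-suc L s (a ∷ as)
      rewrite ℕ.+-suc (if a ℕ.<ᵇ s then 1 else 0) L
            | chain-shift n a (chainLength L s a)
            | List.map-++ (n ℕ.+_) (chain n a (chainLength L s a)) (chains (chainLength L s) as)
      = prep a (↭-trans (++⁺ˡ X (chains-suc L s as)) (↭-trans
          (↭-reflexive (≡.sym (List.++-assoc X as Y)))
          (↭-trans (++⁺ʳ Y (++-comm X as)) (↭-reflexive (List.++-assoc as X Y)))))
      where
      X = map (n ℕ.+_) (chain n a (chainLength L s a))
      Y = map (n ℕ.+_) (chains (chainLength L s) as)

    chains-↭-upTo : ∀ L s → s ℕ.≤ n →
      chains (chainLength L s) (downFrom n) ↭ upTo (L ℕ.* n ℕ.+ s)
    chains-↭-upTo zero s s≤n = ↭-trans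
      (↭-reflexive (≡.trans (chains-0 s n) (≡.cong downFrom (ℕ.m≥n⇒m⊓n≡n s≤n))))
      (downFrom↭upTo s)
    chains-↭-upTo (suc L) s s≤n = ↭-trans (chains-suc L s (downFrom n)) (↭-trans
      (++⁺ (downFrom↭upTo n) (map⁺ (n ℕ.+_) (chains-↭-upTo L s s≤n)))
      (↭-reflexive (≡.sym (≡.trans (≡.cong upTo (ℕ.+-assoc n (L ℕ.* n) s)) (upTo-+ n _)))))

  Unique-++⁻ʳ : ∀ (X : List ℕ) {Y} → Unique (X ++ Y) → Unique Y
  Unique-++⁻ʳ [] u = u
  Unique-++⁻ʳ (x ∷ X) (_ ∷ u) = Unique-++⁻ʳ X u

  -- The chains of the residues below `n` are a final part of the list of chains for all residues
  -- below `m + n`, and that list rearranges an interval.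
  chains-Unique : ∀ m n L → Unique (ChainSums.chains seriesRing (m ℕ.+ n) (λ _ → L) (downFrom n))
  chains-Unique m n L = drop m (Unique-resp-↭
    (↭-sym (chains-↭-upTo (m ℕ.+ n) L 0 z≤n)) (Unique.upTo⁺ _))
    where
    open ChainSums seriesRing (m ℕ.+ n) using (chains)
    drop : ∀ k → Unique (chains (λ _ → L) (downFrom (k ℕ.+ n))) → Unique (chains (λ _ → L) (downFrom n))
    drop zero u = u
    drop (suc k) u = drop k (Unique-++⁻ʳ (chain (m ℕ.+ n) (k ℕ.+ n) L) u)

  ∈-chain : ∀ {d x} a c → x ∈ chain d a c → ∃[ k ] k ℕ.< c × x ≡ k ℕ.* d ℕ.+ a
  ∈-chain a (suc c) (here ≡.refl) = 0 , s≤s z≤n , ≡.refl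
  ∈-chain {d} a (suc c) (there x∈) with k , k<c , eq ← ∈-chain (a ℕ.+ d) c x∈ =
    suc k , s≤s k<c , ≡.trans eq (≡.sym (chain-next d a k))

  ∈-Filling-unique : ∀ {n cs a c c′} → Filling n cs → (a , c) ∈ cs → (a , c′) ∈ cs → c ≡ c′
  ∈-Filling-unique (cons _ f) (here ≡.refl) (here ≡.refl) = ≡.refl
  ∈-Filling-unique (cons _ f) (here ≡.refl) (there p) = ⊥-elim (ℕ.<-irrefl ≡.refl (All.lookup (Filling-< f) p))
  ∈-Filling-unique (cons _ f) (there p) (here ≡.refl) = ⊥-elim (ℕ.<-irrefl ≡.refl (All.lookup (Filling-< f) p))
  ∈-Filling-unique (cons _ f) (there p) (there p′) = ∈-Filling-unique f p p′

  ∈⇒≤size : ∀ {a c} {cs : List (ℕ × ℕ)} → (a , c) ∈ cs → c ℕ.≤ size cs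
  ∈⇒≤size (here ≡.refl) = ℕ.m≤m+n _ _
  ∈⇒≤size (there p) = ℕ.≤-trans (∈⇒≤size p) (ℕ.m≤n+m _ _)

  prodL≈0 : ∀ {A : Set} {K x} (f : A → Series) {xs} → x ∈ xs → f x ≈[ K ] 0# → prodL f xs ≈[ K ] 0#
  prodL≈0 f {x ∷ xs} (here ≡.refl) fx = trans[] (*-cong[] fx refl[]) (≈⇒≈[] (𝕊.zeroˡ _))
  prodL≈0 f {x ∷ xs} (there p) fx = trans[] (*-cong[] refl[] (prodL≈0 f p fx)) (≈⇒≈[] (𝕊.zeroʳ _))

  module Chains (d : ℕ) (d≢0 : d ≢ 0) where
    open ChainSums seriesRing d
    open Residues d
    open Fillings d
    open ChainProducts seriesRing seriesPoints d
    open HallLittlewood (q d)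

    ratioG-minus : ∀ {x y} → x ≢ y → (q x - q y) * ratioG (q d) x y ≈ q x - q (y ℕ.+ d)
    ratioG-minus {x} {y} x≢y = begin
      (q x - q y) * ratioG (q d) x y
        ≈⟨ solve 4 (λ x y d g → (x :- y) :* (d :+ (:1 :- d) :* g) :=
             d :* (x :- y) :+ (:1 :- d) :* ((x :- y) :* g)) 𝕊.refl _ _ _ _ ⟩
      q d * (q x - q y) + (1# - q d) * ((q x - q y) * quotient x y)
        ≈⟨ 𝕊.+-congˡ (𝕊.*-congˡ (quotient-def x≢y)) ⟩
      q d * (q x - q y) + (1# - q d) * q x
        ≈⟨ solve 3 (λ x y d → d :* (x :- y) :+ (:1 :- d) :* x := x :- y :* d) 𝕊.refl _ _ _ ⟩
      q x - q y * q d
        ≈⟨ 𝕊.+-congˡ (𝕊.-‿cong (q-+ y d)) ⟨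
      q x - q (y ℕ.+ d) ∎
      where open ≈-Reasoning

    -- With `t = q d` the numerator is `q x - q (y + d)`, which is zero at `x = y + d`.
    ratioG-vanish : ∀ y → ratioG (q d) (y ℕ.+ d) y ≈ 0#
    ratioG-vanish y = q-minus-cancel y+d≢y (𝕊.trans (ratioG-minus y+d≢y)
      (solve 2 (λ x y → x :- x := (x :- y) :* :0) 𝕊.refl (q (y ℕ.+ d)) (q y)))
      where
      y+d≢y : y ℕ.+ d ≢ y
      y+d≢y eq = d≢0 (ℕ.+-cancelˡ-≡ y d 0 (≡.trans eq (≡.sym (ℕ.+-identityʳ y))))

    -- The numerator of the ratio at `y` is the denominator of the ratio at `y + d`; this drives the
    -- telescoping.
    ratioG-step : ∀ {x y} → x ≢ y → x ≢ y ℕ.+ d →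
      ratioG (q d) x y * quotient x (y ℕ.+ d) ≈ quotient x y
    ratioG-step {x} {y} x≢y x≢y+d = q-minus-cancel x≢y (begin
      (q x - q y) * (ratioG (q d) x y * quotient x (y ℕ.+ d))
        ≈⟨ 𝕊.*-assoc _ _ _ ⟨
      ((q x - q y) * ratioG (q d) x y) * quotient x (y ℕ.+ d)
        ≈⟨ 𝕊.*-congʳ (ratioG-minus x≢y) ⟩
      (q x - q (y ℕ.+ d)) * quotient x (y ℕ.+ d)
        ≈⟨ quotient-def x≢y+d ⟩
      q x
        ≈⟨ quotient-def x≢y ⟨
      (q x - q y) * quotient x y ∎)
      where open ≈-Reasoning

    telescope : ∀ x y ℓ → (∀ k → x ≢ k ℕ.* d ℕ.+ y) →
      prodL (ratioG (q d) x) (chain d y ℓ) * quotient x (ℓ ℕ.* d ℕ.+ y) ≈ quotient x y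
    telescope x y zero sep = 𝕊.*-identityˡ _
    telescope x y (suc ℓ) sep = begin
      (ratioG (q d) x y * prodL (ratioG (q d) x) (chain d (y ℕ.+ d) ℓ)) * quotient x (suc ℓ ℕ.* d ℕ.+ y)
        ≈⟨ 𝕊.trans (𝕊.*-assoc _ _ _) (𝕊.*-congˡ (𝕊.*-congˡ
             (𝕊.reflexive (≡.cong (quotient x) (chain-next d y ℓ))))) ⟩
      ratioG (q d) x y * (prodL (ratioG (q d) x) (chain d (y ℕ.+ d) ℓ) * quotient x (ℓ ℕ.* d ℕ.+ (y ℕ.+ d)))
        ≈⟨ 𝕊.*-congˡ (telescope x (y ℕ.+ d) ℓ (λ k eq → sep (suc k) (≡.trans eq (≡.sym (chain-next d y k))))) ⟩
      ratioG (q d) x y * quotient x (y ℕ.+ d)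
        ≈⟨ ratioG-step (sep 0) (λ eq → sep 1 (≡.trans eq (≡.sym (chain-next d y 0)))) ⟩
      quotient x y ∎
      where open ≈-Reasoning

    -- Hence only unions of initial segments of the residue chains contribute.
    cross-vanish : ∀ (w : ℕ → Series) → Vanishing (λ I J → prodL w I * cross I J)
    cross-vanish w {I} {J} {y} y∈J y+d∈I = 𝕊.trans (𝕊.*-congˡ (zeroFactor I y+d∈I)) (𝕊.zeroʳ _)
      where
      zeroFactor′ : ∀ J → y ∈ J → prodL (ratioG (q d) (y ℕ.+ d)) J ≈ 0#
      zeroFactor′ (_ ∷ J) (here ≡.refl) = 𝕊.trans (𝕊.*-congʳ (ratioG-vanish y)) (𝕊.zeroˡ _)
      zeroFactor′ (_ ∷ J) (there p) = 𝕊.trans (𝕊.*-congˡ (zeroFactor′ J p)) (𝕊.zeroʳ _)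
      zeroFactor : ∀ I → y ℕ.+ d ∈ I → cross I J ≈ 0#
      zeroFactor (_ ∷ I) (here ≡.refl) = 𝕊.trans (𝕊.*-congʳ (zeroFactor′ J y∈J)) (𝕊.zeroˡ _)
      zeroFactor (_ ∷ I) (there p) = 𝕊.trans (𝕊.*-congˡ (zeroFactor I p)) (𝕊.zeroʳ _)

    Fpair : ℕ × ℕ → ℕ × ℕ → Series
    Fpair (a , c) y = F a c (point y)

    Dpair : ℕ × ℕ → ℕ × ℕ → Series
    Dpair (a , c) (b , _) = D a b c

    -- For `i` in `I`, the ratios against one complementary chain telescope to the quotient at its
    -- first point, up to a quotient at the point where the finite chain ends. That last quotient is
    -- 1 modulo `q^K` when the end is far enough away.
    cross≈square : ∀ {n r K} ℓ cs → Filling n cs → n ℕ.≤ d → size cs ≡ r →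
      (∀ a → suc (r ℕ.+ K) ℕ.≤ ℓ a) → cross (taken cs) (left ℓ cs) ≈[ K ] square Fpair cs
    cross≈square {n} {r} {K} ℓ cs f n≤d size≡ ℓ≥ = trans[] (≈⇒≈[] expand)
      (prodL-cong∈[] cs (λ { (a , c) x∈ → trans[] (≈⇒≈[] (prodL-swap _ (chain d a c) cs))
        (prodL-cong∈[] cs (λ { (b , c′) y∈ → prodL-cong∈[] (chain d a c) (λ i i∈ →
          factor a c b c′ i x∈ y∈ i∈) })) }))
      where
      bounded : Bounded cs
      bounded = Filling-Bounded f n≤d
      expand : cross (taken cs) (left ℓ cs) ≈
        prodL (λ (a , c) → prodL (λ i → prodL (λ (b , c′) →
          prodL (ratioG (q d) i) (chain d (c′ ℕ.* d ℕ.+ b) (ℓ b ∸ c′))) cs) (chain d a c)) cs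
      expand = 𝕊.trans (prodL-concatMap _ (λ (a , c) → chain d a c) cs)
        (prodL-cong cs (λ (a , c) → prodL-cong (chain d a c) (λ i →
          prodL-concatMap (ratioG (q d) i) (λ (b , c′) → chain d (c′ ℕ.* d ℕ.+ b) (ℓ b ∸ c′)) cs)))
      factor : ∀ a c b c′ i → (a , c) ∈ cs → (b , c′) ∈ cs → i ∈ chain d a c →
        prodL (ratioG (q d) i) (chain d (c′ ℕ.* d ℕ.+ b) (ℓ b ∸ c′)) ≈[ K ] quotient i (c′ ℕ.* d ℕ.+ b)
      factor a c b c′ i x∈ y∈ i∈ with k , k<c , ≡.refl ← ∈-chain a c i∈ =
        trans[] (≈⇒≈[] (𝕊.sym (𝕊.*-identityʳ _)))
          (trans[] (*-cong[] refl[] (sym[] (quotient≈1 i<end K≤)))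
            (≈⇒≈[] (telescope i (c′ ℕ.* d ℕ.+ b) (ℓ b ∸ c′) sep)))
        where
        a<d = All.lookup bounded x∈
        b<d = All.lookup bounded y∈
        -- Different residues never meet. For equal residues the chain is the same one, and `k < c`
        -- places `i` strictly below its complement.
        sep : ∀ l → k ℕ.* d ℕ.+ a ≢ l ℕ.* d ℕ.+ (c′ ℕ.* d ℕ.+ b)
        sep l eq with a ℕ.≟ b
        ... | no a≢b = separated a<d b<d a≢b k (l ℕ.+ c′) (≡.trans eq
          (≡.trans (≡.sym (ℕ.+-assoc (l ℕ.* d) (c′ ℕ.* d) b))
            (≡.cong (ℕ._+ b) (≡.sym (ℕ.*-distribʳ-+ d l c′)))))
        ... | yes ≡.refl with ≡.refl ← ∈-Filling-unique f x∈ y∈ = ℕ.<-irrefl eq (ℕ.<-≤-trans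
          (ℕ.+-monoˡ-< a (ℕ.*-monoˡ-< d {{ℕ.≢-nonZero d≢0}} k<c)) (ℕ.m≤n+m _ (l ℕ.* d)))
        end = (ℓ b ∸ c′) ℕ.* d ℕ.+ (c′ ℕ.* d ℕ.+ b)
        c′≤r : c′ ℕ.≤ r
        c′≤r = ≡.subst (c′ ℕ.≤_) size≡ (∈⇒≤size y∈)
        c≤r : c ℕ.≤ r
        c≤r = ≡.subst (c ℕ.≤_) size≡ (∈⇒≤size x∈)
        r≤ℓ : r ℕ.≤ ℓ b
        r≤ℓ = ℕ.≤-trans (ℕ.m≤m+n r K) (ℕ.≤-trans (ℕ.n≤1+n _) (ℓ≥ b))
        -- Entries of `I` lie below `r d`, because no chain has more than `r` entries, while the
        -- chain of `b` ends beyond `(r + K) d`.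
        i+K<end : i ℕ.+ K ℕ.< end
        i+K<end = begin-strict
          (k ℕ.* d ℕ.+ a) ℕ.+ K            <⟨ ℕ.+-monoˡ-< K (ℕ.+-monoʳ-< (k ℕ.* d) a<d) ⟩
          (k ℕ.* d ℕ.+ d) ℕ.+ K            ≡⟨ ≡.cong (ℕ._+ K) (ℕ.+-comm (k ℕ.* d) d) ⟩
          suc k ℕ.* d ℕ.+ K                ≤⟨ ℕ.+-mono-≤ (ℕ.*-monoˡ-≤ d (ℕ.≤-trans k<c c≤r))
                                                (ℕ.m≤m*n K d {{ℕ.≢-nonZero d≢0}}) ⟩
          r ℕ.* d ℕ.+ K ℕ.* d              ≡⟨ ℕ.*-distribʳ-+ d r K ⟨
          (r ℕ.+ K) ℕ.* d                  ≤⟨ ℕ.*-monoˡ-≤ d (ℕ.≤-trans (ℕ.n≤1+n _) (ℓ≥ b)) ⟩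
          ℓ b ℕ.* d                        ≡⟨ ≡.cong (ℕ._* d) (ℕ.m∸n+n≡m (ℕ.≤-trans c′≤r r≤ℓ)) ⟨
          ((ℓ b ∸ c′) ℕ.+ c′) ℕ.* d        ≡⟨ ℕ.*-distribʳ-+ d (ℓ b ∸ c′) c′ ⟩
          (ℓ b ∸ c′) ℕ.* d ℕ.+ c′ ℕ.* d    ≤⟨ ℕ.+-monoʳ-≤ ((ℓ b ∸ c′) ℕ.* d) (ℕ.m≤m+n _ b) ⟩
          end                              ∎
          where open ℕ.≤-Reasoning
        i<end : i ℕ.< end
        i<end = ℕ.≤-<-trans (ℕ.m≤m+n i K) i+K<end
        K≤ : K ℕ.≤ end ∸ i
        K≤ = ℕ.m+n≤o⇒m≤o∸n K (ℕ.≤-trans (ℕ.≤-reflexive (ℕ.+-comm K i)) (ℕ.<⇒≤ i+K<end))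

  -- Theta products

  poch∞ : ℕ → ℕ → Series
  poch∞ e d = ⟦ qPochInf e d ⟧

  finPoch : ℕ → ℕ → ℕ → Series
  finPoch e d L = prodL (λ j → 1# - q (e ℕ.+ d ℕ.* j)) (upTo L)

  -- The factors with index `j ≥ K` have exponent at least `K`, since `d ≥ 1`, and are 1 at this
  -- precision.
  finPoch-stable : ∀ e d {K L} → d ≢ 0 → K ℕ.≤ L → finPoch e d L ≈[ K ] finPoch e d K
  finPoch-stable e d {K} d≢0 K≤L with j , ≡.refl ← ℕ.m≤n⇒∃[o]m+o≡n K≤L = go j
    where
    go : ∀ j → finPoch e d (K ℕ.+ j) ≈[ K ] finPoch e d K
    go zero = ≈⇒≈[] (𝕊.reflexive (≡.cong (finPoch e d) (ℕ.+-identityʳ K)))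
    go (suc j) = trans[]
      (≈⇒≈[] (𝕊.trans (𝕊.reflexive (≡.cong (finPoch e d) (ℕ.+-suc K j))) (prod-upTo-suc _ (K ℕ.+ j))))
      (trans[] (*-cong[] (go j) (1-q≈1 (begin
        K                         ≤⟨ ℕ.m≤m+n K j ⟩
        K ℕ.+ j                   ≤⟨ ℕ.m≤n*m (K ℕ.+ j) d {{ℕ.≢-nonZero d≢0}} ⟩
        d ℕ.* (K ℕ.+ j)           ≤⟨ ℕ.m≤n+m _ e ⟩
        e ℕ.+ d ℕ.* (K ℕ.+ j)     ∎)))
        (≈⇒≈[] (𝕊.*-identityʳ _)))
      where open ℕ.≤-Reasoning

  ⟦finPoch⟧ : ∀ e d L → ⟦ prodPS (map (λ j → onePS ⊖ mono (e ℕ.+ d ℕ.* j)) (upTo L)) ⟧ ≈ finPoch e d L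
  ⟦finPoch⟧ e d L = 𝕊.trans (⟦prodPS⟧ _ (upTo L)) (prodL-cong (upTo L) (λ j → ⟦1⊖mono⟧ _))

  poch∞≈finPoch : ∀ e d {K L} → d ≢ 0 → K ℕ.≤ L → poch∞ e d ≈[ K ] finPoch e d L
  poch∞≈finPoch e d {K} {L} d≢0 K≤L = coeff⇒≈[] (λ k k<K → ≡.trans (coeff-⟦⟧ (qPochInf e d) k)
    (≡.trans (≡.sym (coeff-⟦⟧ (prodPS (map (λ j → onePS ⊖ mono (e ℕ.+ d ℕ.* j)) (upTo (suc k)))) k))
    (coeff-≈[] {suc k} (trans[] (≈⇒≈[] (⟦finPoch⟧ e d (suc k)))
        (sym[] (finPoch-stable e d d≢0 (ℕ.≤-trans k<K K≤L)))) k ℕ.≤-refl)))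

  Unit-poch∞ : ∀ e d → e ≢ 0 → d ≢ 0 → Unit (poch∞ e d)
  Unit-poch∞ e d e≢0 d≢0 = Unit-cong[] {0} (sym[] (poch∞≈finPoch e d d≢0 (ℕ.≤-refl {1})))
    (Unit-prodL {f = λ j → 1# - q (e ℕ.+ d ℕ.* j)} (upTo 1) (λ j → Unit-1-q (λ eq → e≢0 (ℕ.m+n≡0⇒m≡0 e eq))))

  downFrom-+ : ∀ u a → downFrom (u ℕ.+ a) ≡ map (a ℕ.+_) (downFrom u) ++ downFrom a
  downFrom-+ zero a = ≡.refl
  downFrom-+ (suc u) a = ≡.cong₂ _∷_ (ℕ.+-comm u a) (downFrom-+ u a)

  prodL-downFrom-+ : ∀ (g : ℕ → Series) u a →
    prodL g (downFrom (u ℕ.+ a)) ≈ prodL (λ b → g (a ℕ.+ b)) (downFrom u) * prodL g (downFrom a)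
  prodL-downFrom-+ g u a = 𝕊.trans (𝕊.reflexive (≡.cong (prodL g) (downFrom-+ u a)))
    (𝕊.trans (prodL-++ g (map (a ℕ.+_) (downFrom u)) (downFrom a))
      (𝕊.*-congʳ (𝕊.reflexive (prodL-map g (a ℕ.+_) (downFrom u)))))

  prodL-upTo-+ : ∀ (g : ℕ → Series) u a →
    prodL g (upTo (u ℕ.+ a)) ≈ prodL g (upTo u) * prodL (λ b → g (u ℕ.+ b)) (upTo a)
  prodL-upTo-+ g u a = 𝕊.trans (𝕊.reflexive (≡.cong (prodL g) (upTo-+ u a)))
    (𝕊.trans (prodL-++ g (upTo u) (map (u ℕ.+_) (upTo a)))
      (𝕊.*-congˡ (𝕊.reflexive (prodL-map g (u ℕ.+_) (upTo a)))))

  prodL-reflect : ∀ (g : ℕ → Series) a k →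
    prodL (λ b → g ((a ℕ.+ k) ∸ b)) (downFrom a) ≈ prodL (λ i → g (suc (k ℕ.+ i))) (upTo a)
  prodL-reflect g a k = 𝕊.trans (go a k) (𝕊.reflexive (≡.trans
    (≡.cong (prodL g) (≡.sym (List.map-upTo (λ i → suc (k ℕ.+ i)) a)))
    (prodL-map g (λ i → suc (k ℕ.+ i)) (upTo a))))
    where
    go : ∀ a k → prodL (λ b → g ((a ℕ.+ k) ∸ b)) (downFrom a) ≈
      prodL g (applyUpTo (λ i → suc (k ℕ.+ i)) a)
    go zero k = 𝕊.refl
    go (suc a) k = 𝕊.*-cong
      (𝕊.reflexive (≡.cong g (≡.trans (≡.cong (_∸ a) (≡.sym (ℕ.+-suc a k)))
        (≡.trans (ℕ.m+n∸m≡n a (suc k)) (≡.cong suc (≡.sym (ℕ.+-identityʳ k)))))))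
      (𝕊.trans (prodL-cong (downFrom a) (λ b → 𝕊.reflexive (≡.cong (λ x → g (x ∸ b)) (≡.sym (ℕ.+-suc a k)))))
        (𝕊.trans (go a (suc k)) (𝕊.reflexive (≡.cong (prodL g) (applyUpTo-cong a)))))
      where
      applyUpTo-cong : ∀ a {k} → applyUpTo (λ i → suc (suc k ℕ.+ i)) a ≡ applyUpTo (λ i → suc (k ℕ.+ suc i)) a
      applyUpTo-cong a {k} = ≡.trans (≡.sym (List.map-upTo _ a)) (≡.trans
        (List.map-cong (λ i → ≡.cong suc (≡.sym (ℕ.+-suc k i))) (upTo a)) (List.map-upTo _ a))

  module Products (κ : ℕ) where
    open Residues κ using (gap)

    gap-> : ∀ {a b} → b ℕ.< a → gap a b ≡ a ∸ b
    gap-> {a} {b} b<a with b ℕ.<ᵇ a in eq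
    ... | true = ≡.refl
    ... | false = ⊥-elim (≡.subst T eq (ℕ.<⇒<ᵇ b<a))

    gap-≤ : ∀ {a b} → a ℕ.≤ b → gap a b ≡ κ ∸ (b ∸ a)
    gap-≤ {a} {b} a≤b with b ℕ.<ᵇ a in eq
    ... | false = ≡.refl
    ... | true = ⊥-elim (ℕ.<-irrefl ≡.refl (ℕ.<-≤-trans (ℕ.<ᵇ⇒< b a (≡.subst T (≡.sym eq) _)) a≤b))

    gap-+ : ∀ k a b → gap (k ℕ.+ a) (k ℕ.+ b) ≡ gap a b
    gap-+ k a b with a ℕ.≤? b
    ... | yes a≤b = ≡.trans (gap-≤ (ℕ.+-monoʳ-≤ k a≤b))
      (≡.trans (≡.cong (κ ∸_) (ℕ.[m+n]∸[m+o]≡n∸o k b a)) (≡.sym (gap-≤ a≤b)))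
    ... | no a≰b = ≡.trans (gap-> (ℕ.+-monoʳ-< k (ℕ.≰⇒> a≰b)))
      (≡.trans (ℕ.[m+n]∸[m+o]≡n∸o k a b) (≡.sym (gap-> (ℕ.≰⇒> a≰b))))

    -- In row `a` the gaps take each value from 1 to `κ` once: the columns `b ≥ a` give
    -- `a + 1 , … , κ` and the columns `b < a` give `1 , … , a`.
    prod-row : ∀ (g : ℕ → Series) a u → u ℕ.+ a ≡ κ →
      prodL (λ b → g (gap a b)) (downFrom κ) ≈ prodL (g ∘ suc) (upTo κ)
    prod-row g a u ≡.refl = begin
      prodL (λ b → g (gap a b)) (downFrom (u ℕ.+ a))
        ≈⟨ prodL-downFrom-+ _ u a ⟩
      prodL (λ b → g (gap a (a ℕ.+ b))) (downFrom u) * prodL (λ b → g (gap a b)) (downFrom a)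
        ≈⟨ 𝕊.*-cong
             (prodL-cong (downFrom u) (λ b → 𝕊.reflexive (≡.cong g
               (≡.trans (gap-≤ (ℕ.m≤m+n a b)) (≡.cong (κ ∸_) (ℕ.m+n∸m≡n a b))))))
             (prodL-cong∈ (downFrom a) (λ b b∈ → 𝕊.reflexive (≡.cong g
               (≡.trans (gap-> (∈-downFrom⁻ b∈)) (≡.cong (_∸ b) (≡.sym (ℕ.+-identityʳ a))))))) ⟩
      prodL (λ b → g ((u ℕ.+ a) ∸ b)) (downFrom u) * prodL (λ b → g ((a ℕ.+ 0) ∸ b)) (downFrom a)
        ≈⟨ 𝕊.*-cong (prodL-reflect g u a) (prodL-reflect g a 0) ⟩
      prodL (λ i → g (suc (a ℕ.+ i))) (upTo u) * prodL (g ∘ suc) (upTo a)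
        ≈⟨ 𝕊.trans (𝕊.*-comm _ _) (𝕊.sym (prodL-upTo-+ (g ∘ suc) a u)) ⟩
      prodL (g ∘ suc) (upTo (a ℕ.+ u))
        ≡⟨ ≡.cong (λ k → prodL (g ∘ suc) (upTo k)) (ℕ.+-comm a u) ⟩
      prodL (g ∘ suc) (upTo (u ℕ.+ a)) ∎
      where open ≈-Reasoning

    -- In column `b` the rows `a > b` give the gaps `1 , … , u` and the rows `a ≤ b` give
    -- `u + 1 , … , κ`.
    prod-column : ∀ (g : ℕ → Series) b u → u ℕ.+ suc b ≡ κ →
      prodL (λ a → g (gap a b)) (downFrom κ) ≈ prodL (g ∘ suc) (upTo κ)
    prod-column g b u ≡.refl = begin
      prodL (λ a → g (gap a b)) (downFrom (u ℕ.+ suc b))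
        ≈⟨ prodL-downFrom-+ _ u (suc b) ⟩
      prodL (λ a → g (gap (suc b ℕ.+ a) b)) (downFrom u) * prodL (λ a → g (gap a b)) (downFrom (suc b))
        ≈⟨ 𝕊.*-cong
             (prodL-cong (downFrom u) (λ a → 𝕊.reflexive (≡.cong g
               (≡.trans (gap-> (s≤s (ℕ.m≤m+n b a))) (≡.trans (≡.cong (_∸ b) (≡.sym (ℕ.+-suc b a)))
                 (ℕ.m+n∸m≡n b (suc a)))))))
             (prodL-cong∈ (downFrom (suc b)) (λ a a∈ → 𝕊.reflexive (≡.cong g
               (≡.trans (gap-≤ (ℕ.≤-pred (∈-downFrom⁻ a∈))) (wrap a (ℕ.≤-pred (∈-downFrom⁻ a∈))))))) ⟩
      prodL (g ∘ suc) (downFrom u) * prodL (λ a → g (suc (u ℕ.+ a))) (downFrom (suc b))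
        ≈⟨ 𝕊.trans (𝕊.*-comm _ _) (𝕊.sym (prodL-downFrom-+ (g ∘ suc) (suc b) u)) ⟩
      prodL (g ∘ suc) (downFrom (suc b ℕ.+ u))
        ≡⟨ ≡.cong (λ k → prodL (g ∘ suc) (downFrom k)) (ℕ.+-comm (suc b) u) ⟩
      prodL (g ∘ suc) (downFrom (u ℕ.+ suc b))
        ≈⟨ prodL-↭ (g ∘ suc) (downFrom↭upTo (u ℕ.+ suc b)) ⟩
      prodL (g ∘ suc) (upTo (u ℕ.+ suc b)) ∎
      where
      open ≈-Reasoning
      wrap : ∀ a → a ℕ.≤ b → (u ℕ.+ suc b) ∸ (b ∸ a) ≡ suc (u ℕ.+ a)
      wrap a a≤b = ≡.trans (ℕ.+-∸-assoc u (ℕ.≤-trans (ℕ.m∸n≤m b a) (ℕ.n≤1+n b)))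
        (≡.trans (≡.cong (u ℕ.+_) (≡.trans (ℕ.+-∸-assoc 1 (ℕ.m∸n≤m b a))
          (≡.cong suc (ℕ.m∸[m∸n]≡n a≤b)))) (ℕ.+-suc u a))

    -- Every number from 1 to `L κ` is `i + 1 + κ j` for exactly one `i < κ` and `j < L`.
    prod-finPoch : ∀ L → prodL (λ i → finPoch (suc i) κ L) (upTo κ) ≈ finPoch 1 1 (L ℕ.* κ)
    prod-finPoch L = 𝕊.trans (prodL-swap _ (upTo κ) (upTo L)) (go L)
      where
      factor : ℕ → Series
      factor k = 1# - q (1 ℕ.+ 1 ℕ.* k)
      go : ∀ L → prodL (λ j → prodL (λ i → 1# - q (suc i ℕ.+ κ ℕ.* j)) (upTo κ)) (upTo L) ≈
        prodL factor (upTo (L ℕ.* κ))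
      go zero = 𝕊.refl
      go (suc L) = begin
        prodL (λ j → prodL (λ i → 1# - q (suc i ℕ.+ κ ℕ.* j)) (upTo κ)) (upTo (suc L))
          ≈⟨ prod-upTo-suc _ L ⟩
        prodL (λ j → prodL (λ i → 1# - q (suc i ℕ.+ κ ℕ.* j)) (upTo κ)) (upTo L) *
          prodL (λ i → 1# - q (suc i ℕ.+ κ ℕ.* L)) (upTo κ)
          ≈⟨ 𝕊.*-cong (go L) (prodL-cong (upTo κ) (λ i → 𝕊.reflexive (≡.cong (λ x → 1# - q (suc x))
               (≡.trans (ℕ.+-comm i _) (≡.trans (≡.cong (ℕ._+ i) (ℕ.*-comm κ L))
                 (≡.sym (ℕ.*-identityˡ _))))))) ⟩
        prodL factor (upTo (L ℕ.* κ)) * prodL (λ i → factor (L ℕ.* κ ℕ.+ i)) (upTo κ)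
          ≈⟨ prodL-upTo-+ factor (L ℕ.* κ) κ ⟨
        prodL factor (upTo (L ℕ.* κ ℕ.+ κ))
          ≡⟨ ≡.cong (λ k → prodL factor (upTo k)) (ℕ.+-comm (L ℕ.* κ) κ) ⟩
        prodL factor (upTo (suc L ℕ.* κ)) ∎
        where open ≈-Reasoning

    prod-poch∞ : κ ≢ 0 → prodL (λ i → poch∞ (suc i) κ) (upTo κ) ≈ poch∞ 1 1
    prod-poch∞ κ≢0 = ≈[]⇒≈ (λ K → trans[]
      (prodL-cong[] (upTo κ) (λ i → poch∞≈finPoch (suc i) κ κ≢0 (ℕ.≤-refl {K})))
      (trans[] (≈⇒≈[] (prod-finPoch K))
        (sym[] (poch∞≈finPoch 1 1 (λ ()) (ℕ.m≤m*n K κ {{ℕ.≢-nonZero κ≢0}})))))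

    denom : ℕ → ℕ → Series
    denom a b = poch∞ (gap a b) κ

    -- The limit of the denominators when all chains grow.
    Θ : ℕ → Series
    Θ n = square denom (downFrom n)

    prodL-const : ∀ {A : Set} x (xs : List A) → prodL (λ _ → x) xs ≈ x ^ length xs
    prodL-const x [] = 𝕊.refl
    prodL-const x (_ ∷ xs) = 𝕊.*-congˡ (prodL-const x xs)

    prodL-downFrom-const : ∀ x n → prodL (λ (_ : ℕ) → x) (downFrom n) ≈ x ^ n
    prodL-downFrom-const x n = 𝕊.trans (prodL-const x (downFrom n))
      (𝕊.reflexive (≡.cong (x ^_) (List.length-downFrom n)))

    denom-row : ∀ {a} → a ℕ.< κ → prodL (denom a) (downFrom κ) ≈ poch∞ 1 1
    denom-row {a} a<κ = 𝕊.trans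
      (prod-row (λ e → poch∞ e κ) a (κ ∸ a) (ℕ.m∸n+n≡m (ℕ.<⇒≤ a<κ)))
      (prod-poch∞ (λ { ≡.refl → ℕ.n≮0 a<κ }))

    denom-column : ∀ {b} → b ℕ.< κ → prodL (λ a → denom a b) (downFrom κ) ≈ poch∞ 1 1
    denom-column {b} b<κ = 𝕊.trans
      (prod-column (λ e → poch∞ e κ) b (κ ∸ suc b) (ℕ.m∸n+n≡m b<κ))
      (prod-poch∞ (λ { ≡.refl → ℕ.n≮0 b<κ }))

    -- For the first sum the step equals the number of residues, so the whole square is present and
    -- this is its limiting denominator.
    Θ-full : Θ κ ≈ poch∞ 1 1 ^ κ
    Θ-full = 𝕊.trans (prodL-cong∈ (downFrom κ) (λ a a∈ → denom-row (∈-downFrom⁻ a∈)))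
      (prodL-downFrom-const _ κ)

  module _ (m n : ℕ) where
    open Products (m ℕ.+ n)

    -- Split the rows a ≥ n and the columns b < n of the square [0 , m + n)².
    Θ-duality : Θ n * poch∞ 1 1 ^ m ≈ Θ m * poch∞ 1 1 ^ n
    Θ-duality = begin
      Θ n * poch∞ 1 1 ^ m
        ≈⟨ 𝕊.*-congˡ (prodL-downFrom-const _ m) ⟨
      Θ n * prodL (λ _ → poch∞ 1 1) (downFrom m)
        ≈⟨ 𝕊.*-congˡ (prodL-cong∈ (downFrom m) (λ a a∈ → 𝕊.sym (𝕊.trans
             (𝕊.sym (prodL-downFrom-+ _ m n))
             (denom-row (≡.subst (n ℕ.+ a ℕ.<_) (ℕ.+-comm n m) (ℕ.+-monoʳ-< n (∈-downFrom⁻ a∈))))))) ⟩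
      Θ n * prodL (λ a → prodL (λ b → denom (n ℕ.+ a) (n ℕ.+ b)) (downFrom m) *
                         prodL (denom (n ℕ.+ a)) (downFrom n)) (downFrom m)
        ≈⟨ 𝕊.*-congˡ (prodL-* _ _ (downFrom m)) ⟩
      Θ n * (square (λ a b → denom (n ℕ.+ a) (n ℕ.+ b)) (downFrom m) * X)
        ≈⟨ 𝕊.*-congˡ (𝕊.*-congʳ (prodL-cong (downFrom m) (λ a → prodL-cong (downFrom m) (λ b →
             𝕊.reflexive (≡.cong (λ e → poch∞ e (m ℕ.+ n)) (gap-+ n a b)))))) ⟩
      Θ n * (Θ m * X)
        ≈⟨ solve 3 (λ a b x → a :* (b :* x) := b :* (x :* a)) 𝕊.refl (Θ n) (Θ m) X ⟩
      Θ m * (X * Θ n)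
        ≈⟨ 𝕊.*-congˡ (𝕊.*-cong (prodL-swap _ (downFrom m) (downFrom n))
             (prodL-swap denom (downFrom n) (downFrom n))) ⟩
      Θ m * (prodL (λ b → prodL (λ a → denom (n ℕ.+ a) b) (downFrom m)) (downFrom n) *
             prodL (λ b → prodL (λ a → denom a b) (downFrom n)) (downFrom n))
        ≈⟨ 𝕊.*-congˡ (prodL-* _ _ (downFrom n)) ⟨
      Θ m * prodL (λ b → prodL (λ a → denom (n ℕ.+ a) b) (downFrom m) *
                         prodL (λ a → denom a b) (downFrom n)) (downFrom n)
        ≈⟨ 𝕊.*-congˡ (prodL-cong∈ (downFrom n) (λ b b∈ → 𝕊.trans
             (𝕊.sym (prodL-downFrom-+ (λ a → denom a b) m n))
             (denom-column (ℕ.<-≤-trans (∈-downFrom⁻ b∈) (ℕ.m≤n+m n m))))) ⟩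
      Θ m * prodL (λ _ → poch∞ 1 1) (downFrom n)
        ≈⟨ 𝕊.*-congˡ (prodL-downFrom-const _ n) ⟩
      Θ m * poch∞ 1 1 ^ n ∎
      where
      open ≈-Reasoning
      X = prodL (λ a → prodL (denom (n ℕ.+ a)) (downFrom n)) (downFrom m)

  module RightHandSide (κ : ℕ) (κ≢0 : κ ≢ 0) where
    open Products κ

    φ = poch∞ κ κ
    E = poch∞ 1 1

    ⟦powPS⟧ : ∀ f k → ⟦ powPS f k ⟧ ≈ ⟦ f ⟧ ^ k
    ⟦powPS⟧ f zero = ⟦onePS⟧
    ⟦powPS⟧ f (suc k) = 𝕊.trans (⟦⊗⟧ _ _) (𝕊.*-congˡ (⟦powPS⟧ f k))

    pairs-∷ʳ : ∀ (g : ℕ × ℕ → Series) xs y →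
      prodL g (pairs (xs ++ y ∷ [])) ≈ prodL g (pairs xs) * prodL (λ x → g (x , y)) xs
    pairs-∷ʳ g [] y = 𝕊.sym (𝕊.*-identityˡ 1#)
    pairs-∷ʳ g (x ∷ xs) y = begin
      prodL g (map (x ,_) (xs ++ y ∷ []) ++ pairs (xs ++ y ∷ []))
        ≈⟨ prodL-++ g (map (x ,_) (xs ++ y ∷ [])) _ ⟩
      prodL g (map (x ,_) (xs ++ y ∷ [])) * prodL g (pairs (xs ++ y ∷ []))
        ≈⟨ 𝕊.*-cong (𝕊.trans (𝕊.reflexive (prodL-map g (x ,_) (xs ++ y ∷ [])))
             (prodL-++ _ xs (y ∷ []))) (pairs-∷ʳ g xs y) ⟩
      (prodL (λ z → g (x , z)) xs * (g (x , y) * 1#)) *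
        (prodL g (pairs xs) * prodL (λ z → g (z , y)) xs)
        ≈⟨ solve 4 (λ a b c e → (a :* (b :* :1)) :* (c :* e) := (a :* c) :* (b :* e)) 𝕊.refl _ _ _ _ ⟩
      (prodL (λ z → g (x , z)) xs * prodL g (pairs xs)) * (g (x , y) * prodL (λ z → g (z , y)) xs)
        ≈⟨ 𝕊.*-congʳ (𝕊.trans (prodL-++ g (map (x ,_) xs) (pairs xs))
             (𝕊.*-congʳ (𝕊.reflexive (prodL-map g (x ,_) xs)))) ⟨
      prodL g (pairs (x ∷ xs)) * prodL (λ z → g (z , y)) (x ∷ xs) ∎
      where open ≈-Reasoning

    thetaPairs : ℕ → Series
    thetaPairs n = prodL (λ (i , j) → ⟦ theta (j ∸ i) κ ⟧) (pairs (map suc (upTo n)))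

    thetaPairs-suc : ∀ n →
      thetaPairs (suc n) ≈ thetaPairs n * prodL (λ b → ⟦ theta (n ∸ b) κ ⟧) (downFrom n)
    thetaPairs-suc n = begin
      thetaPairs (suc n)
        ≡⟨ ≡.cong (λ xs → prodL _ (pairs xs)) (≡.trans (≡.cong (map suc) (≡.sym (List.upTo-∷ʳ n)))
             (List.map-++ suc (upTo n) (n ∷ []))) ⟩
      prodL _ (pairs (map suc (upTo n) ++ suc n ∷ []))
        ≈⟨ pairs-∷ʳ _ (map suc (upTo n)) (suc n) ⟩
      thetaPairs n * prodL (λ b → ⟦ theta (suc n ∸ b) κ ⟧) (map suc (upTo n))
        ≈⟨ 𝕊.*-congˡ (𝕊.trans (𝕊.reflexive (prodL-map _ suc (upTo n)))
             (𝕊.sym (prodL-↭ _ (downFrom↭upTo n)))) ⟩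
      thetaPairs n * prodL (λ b → ⟦ theta (n ∸ b) κ ⟧) (downFrom n) ∎
      where open ≈-Reasoning

    -- The two gaps of a pair `b < n` are `n - b` and `κ - (n - b)`, the two bases in the theta
    -- function; a diagonal entry has gap `κ` and gives `φ`.
    Θ≈theta : ∀ n → Θ n ≈ φ ^ n * thetaPairs n
    Θ≈theta zero = 𝕊.sym (𝕊.*-identityˡ 1#)
    Θ≈theta (suc n) = begin
      Θ (suc n)
        ≈⟨ square-∷ denom n (downFrom n) ⟩
      denom n n * (prodL (λ b → denom n b * denom b n) (downFrom n) * Θ n)
        ≈⟨ 𝕊.*-cong
             (𝕊.reflexive (≡.cong (λ e → poch∞ e κ) (≡.trans (gap-≤ (ℕ.≤-refl {n})) (≡.cong (κ ∸_) (ℕ.n∸n≡0 n)))))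
             (𝕊.*-cong (prodL-cong∈ (downFrom n) (λ b b∈ → 𝕊.sym (𝕊.trans (⟦⊗⟧ _ _)
               (𝕊.*-cong (𝕊.reflexive (≡.cong (λ e → poch∞ e κ) (≡.sym (gap-> (∈-downFrom⁻ b∈)))))
                 (𝕊.reflexive (≡.cong (λ e → poch∞ e κ) (≡.sym (gap-≤ (ℕ.<⇒≤ (∈-downFrom⁻ b∈))))))))))
               (Θ≈theta n)) ⟩
      φ * (prodL (λ b → ⟦ theta (n ∸ b) κ ⟧) (downFrom n) * (φ ^ n * thetaPairs n))
        ≈⟨ solve 4 (λ f p f′ t → f :* (p :* (f′ :* t)) := (f :* f′) :* (t :* p)) 𝕊.refl _ _ _ _ ⟩
      φ ^ suc n * (thetaPairs n * prodL (λ b → ⟦ theta (n ∸ b) κ ⟧) (downFrom n))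
        ≈⟨ 𝕊.*-congˡ (thetaPairs-suc n) ⟨
      φ ^ suc n * thetaPairs (suc n) ∎
      where open ≈-Reasoning

    Unit-^ : ∀ {x} k → Unit x → Unit (x ^ k)
    Unit-^ zero u = Unit-1
    Unit-^ (suc k) u = Unit-* u (Unit-^ k u)

    Unit-E : Unit E
    Unit-E = Unit-poch∞ 1 1 (λ ()) (λ ())

    Unit-φ : Unit φ
    Unit-φ = Unit-poch∞ κ κ κ≢0 κ≢0

    -- Clearing denominators also raises `φ` from the exponent `n - 1` to the exponent `n` of `Θ n`;
    -- `n ≢ 0` makes the truncated subtraction exact.
    rhs-Θ : ∀ n → n ≢ 0 → (φ * E ^ n) * ⟦ rhsSeries κ n ⟧ ≈ Θ n
    rhs-Θ zero n≢0 = ⊥-elim (n≢0 ≡.refl)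
    rhs-Θ (suc n) _ = begin
      (φ * E ^ suc n) * ⟦ rhsSeries κ (suc n) ⟧
        ≈⟨ 𝕊.*-congˡ (𝕊.trans (⟦⊗⟧ _ _) (𝕊.*-cong (𝕊.trans (⟦⊗⟧ _ _) (𝕊.*-cong (⟦powPS⟧ _ n)
             (⟦inv⟧≈ _ (Unit-coeff (Unit-cong (𝕊.sym (⟦powPS⟧ _ (suc n))) (Unit-^ (suc n) Unit-E)))
               (⟦powPS⟧ _ (suc n))))) (⟦prodPS⟧ _ (pairs (map suc (upTo (suc n))))))) ⟩
      (φ * E ^ suc n) * ((φ ^ n * inverse (E ^ suc n)) * thetaPairs (suc n))
        ≈⟨ solve 5 (λ f e f′ i t → (f :* e) :* ((f′ :* i) :* t) := (e :* i) :* ((f :* f′) :* t))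
             𝕊.refl _ _ _ _ _ ⟩
      (E ^ suc n * inverse (E ^ suc n)) * (φ ^ suc n * thetaPairs (suc n))
        ≈⟨ 𝕊.*-cong (*-inverse _ (Unit-^ (suc n) Unit-E)) (𝕊.sym (Θ≈theta (suc n))) ⟩
      1# * Θ (suc n)
        ≈⟨ 𝕊.*-identityˡ _ ⟩
      Θ (suc n) ∎
      where open ≈-Reasoning

  rhs-duality : ∀ m n → m ≢ 0 → n ≢ 0 → ⟦ rhsSeries (m ℕ.+ n) n ⟧ ≈ ⟦ rhsSeries (m ℕ.+ n) m ⟧
  rhs-duality m n m≢0 n≢0 = unit-cancel (φ * (E ^ n * E ^ m))
    (Unit-* Unit-φ (Unit-* (Unit-^ n Unit-E) (Unit-^ m Unit-E))) (begin
      (φ * (E ^ n * E ^ m)) * ⟦ rhsSeries κ n ⟧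
        ≈⟨ solve 4 (λ f e e′ r → (f :* (e :* e′)) :* r := ((f :* e) :* r) :* e′) 𝕊.refl _ _ _ _ ⟩
      ((φ * E ^ n) * ⟦ rhsSeries κ n ⟧) * E ^ m
        ≈⟨ 𝕊.*-congʳ (rhs-Θ n n≢0) ⟩
      Products.Θ κ n * E ^ m
        ≈⟨ Θ-duality m n ⟩
      Products.Θ κ m * E ^ n
        ≈⟨ 𝕊.*-congʳ (rhs-Θ m m≢0) ⟨
      ((φ * E ^ m) * ⟦ rhsSeries κ m ⟧) * E ^ n
        ≈⟨ solve 4 (λ f e e′ r → (f :* (e :* e′)) :* r := ((f :* e′) :* r) :* e) 𝕊.refl _ _ _ _ ⟨
      (φ * (E ^ n * E ^ m)) * ⟦ rhsSeries κ m ⟧ ∎)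
    where
    κ = m ℕ.+ n
    open RightHandSide κ (λ eq → m≢0 (ℕ.m+n≡0⇒m≡0 m eq))
    open ≈-Reasoning

  -- Convergence

  q-^ : ∀ p b → q p ^ b ≈ q (p ℕ.* b)
  q-^ = Numerator.q-^ seriesRing seriesPoints 0

  module Limit (d : ℕ) (d≢0 : d ≢ 0) (n : ℕ) (n≤d : n ℕ.≤ d) where
    open Chains d d≢0
    open ChainSums seriesRing d
    open Residues d
    open Fillings d
    open HallLittlewood (q d)
    open Products d using (Θ; denom)
    open ExponentIdentities using (weight-suc)
    private
      module CP = ChainProducts seriesRing seriesPoints d
      module Num = Numerator seriesRing seriesPoints n

    weight : ℕ → List (ℕ × ℕ) → Series
    weight m cs = q (m ℕ.* (moment cs ℕ.+ d ℕ.* tris cs))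

    -- The sum over closed subsets with infinite complementary chains telescoped away; multiplied by
    -- its limiting denominator it becomes a numerator.
    chainSum : ℕ → ℕ → Series
    chainSum m r = sumComp (downFrom n) r (λ cs → weight m cs * square Fpair cs)

    -- A large total size forces a chain with at least `2 K + 2` entries. Its last entry is at least
    -- `(2 K + 1) d`, while the next point of the short chain is below `K d`; their quotient has
    -- order at least `K` and divides the product.
    square-Fpair≈0 : ∀ {K cs} → Filling n cs → (∃[ b ] ∃[ c ] (b , c) ∈ cs × c ℕ.< K) →
      n ℕ.* (suc (suc (K ℕ.+ K))) ℕ.≤ size cs → square Fpair cs ≈[ K ] 0#
    square-Fpair≈0 {K} {cs} f (b , c′ , y∈ , c′<K) big with pigeonhole (suc (suc (K ℕ.+ K))) cs
    -- If no chain were that long, `size + length` would be at most `n (2 K + 2)`, hence at most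
    -- `size`, and the list would be empty.
    ... | inj₂ small = ⊥-elim (nonempty y∈ (ℕ.m+n≡0⇒m≡0 (length cs) {0} (≡.trans (ℕ.+-identityʳ _)
      (ℕ.n≤0⇒n≡0 (ℕ.+-cancelˡ-≤ (size cs) _ _ (ℕ.≤-trans small (ℕ.≤-trans
        (ℕ.≤-trans (ℕ.≤-reflexive (≡.cong (ℕ._* _) (Filling-length f))) big)
        (ℕ.≤-reflexive (≡.sym (ℕ.+-identityʳ _))))))))))
      where
      nonempty : ∀ {x} {cs : List (ℕ × ℕ)} → x ∈ cs → length cs ≢ 0
      nonempty (here _) ()
      nonempty (there _) ()
    ... | inj₁ (a , suc k , x∈ , s≤s K+K<k) =
      prodL≈0 (λ x → prodL (Fpair x) cs) x∈ (prodL≈0 (Fpair (a , suc k)) y∈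
        (prodL≈0 (λ i → quotient i (c′ ℕ.* d ℕ.+ b)) (∈-chain⁺ d a (ℕ.≤-refl {suc k}))
          (quotient≈0 y<x (ℕ.m+n≤o⇒m≤o∸n K (ℕ.<⇒≤ K+y<x)))))
      where
      instance
        d-nonZero : ℕ.NonZero d
        d-nonZero = ℕ.≢-nonZero d≢0
      K+y<x : K ℕ.+ (c′ ℕ.* d ℕ.+ b) ℕ.< k ℕ.* d ℕ.+ a
      K+y<x = begin-strict
        K ℕ.+ (c′ ℕ.* d ℕ.+ b)   <⟨ ℕ.+-monoʳ-< K (ℕ.+-monoʳ-< (c′ ℕ.* d)
                                      (All.lookup (Filling-Bounded f n≤d) y∈)) ⟩
        K ℕ.+ (c′ ℕ.* d ℕ.+ d)   ≡⟨ ≡.cong (K ℕ.+_) (ℕ.+-comm (c′ ℕ.* d) d) ⟩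
        K ℕ.+ suc c′ ℕ.* d       ≤⟨ ℕ.+-mono-≤ (ℕ.m≤m*n K d) (ℕ.*-monoˡ-≤ d c′<K) ⟩
        K ℕ.* d ℕ.+ K ℕ.* d      ≡⟨ ℕ.*-distribʳ-+ d K K ⟨
        (K ℕ.+ K) ℕ.* d          ≤⟨ ℕ.*-monoˡ-≤ d (ℕ.<⇒≤ K+K<k) ⟩
        k ℕ.* d                  ≤⟨ ℕ.m≤m+n _ a ⟩
        k ℕ.* d ℕ.+ a            ∎
        where open ℕ.≤-Reasoning
      y<x : c′ ℕ.* d ℕ.+ b ℕ.< k ℕ.* d ℕ.+ a
      y<x = ℕ.≤-<-trans (ℕ.m≤n+m _ K) K+y<x

    square-Dpair≈Θ : ∀ {K cs} → map proj₁ cs ≡ downFrom n → All (λ (_ , c) → K ℕ.≤ c) cs →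
      square Dpair cs ≈[ K ] Θ n
    square-Dpair≈Θ {K} {cs} eq long = trans[]
      (prodL-cong∈[] cs (λ { (a , c) x∈ → prodL-cong[] cs (λ { (b , _) →
        sym[] (poch∞≈finPoch (gap a b) d d≢0
          (ℕ.≤-trans (All.lookup long x∈) (ℕ.m≤n+m c (descent a b)))) }) }))
      (≈⇒≈[] (𝕊.trans (square-map denom proj₁ cs) (𝕊.reflexive (≡.cong (square denom) eq))))

    -- Either all chains are long and the denominators have converged, or a short
    -- chain forces a long one and the term has high order.
    term-limit : ∀ m s {K} cs → map proj₁ cs ≡ downFrom n →
      s ℕ.≤ m ℕ.* (moment cs ℕ.+ d ℕ.* tris cs) → n ℕ.* (suc (suc (K ℕ.+ K))) ℕ.≤ size cs →
      weight m cs * square CP.K cs ≈[ s ℕ.+ K ] Θ n * (weight m cs * square Fpair cs)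
    term-limit m s {K} cs eq s≤ big = trans[]
      (≈[]-mono (ℕ.+-monoˡ-≤ K s≤) (q-*-cong[] _ (trans[]
        (≈⇒≈[] (square-* Fpair Dpair cs)) (lim (short-or-long K cs)))))
      (≈⇒≈[] (solve 3 (λ w f t → w :* (f :* t) := t :* (w :* f)) 𝕊.refl _ _ _))
      where
      lim : _ → square Fpair cs * square Dpair cs ≈[ K ] square Fpair cs * Θ n
      lim (inj₁ long) = *-cong[] refl[] (square-Dpair≈Θ eq long)
      lim (inj₂ short) = trans[] (*-cong[] F≈0 refl[]) (trans[]
        (≈⇒≈[] (𝕊.trans (𝕊.zeroˡ _) (𝕊.sym (𝕊.zeroˡ (Θ n)))))
        (*-cong[] (sym[] F≈0) refl[]))
        where
        F≈0 : square Fpair cs ≈[ K ] 0#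
        F≈0 = square-Fpair≈0 (filling n cs eq) short big

    -- Here `s` bounds the order of all weights from below. Each weight lifts the precision `K` of
    -- the denominators to `s + K`, so the later division by `q s` loses nothing.
    numerator-limit : ∀ m s r {K} → n ℕ.* (suc (suc (K ℕ.+ K))) ℕ.≤ r →
      (∀ cs → Filling n cs → size cs ≡ r → s ℕ.≤ m ℕ.* (moment cs ℕ.+ d ℕ.* tris cs)) →
      Num.numerator d n≤d m r ≈[ s ℕ.+ K ] Θ n * chainSum m r
    numerator-limit m s r big s≤ = trans[]
      (sumComp-cong[] (downFrom n) r (λ cs eq size≡ → term-limit m s cs eq
        (s≤ cs (filling n cs eq) size≡) (≡.subst (_ ℕ.≤_) (≡.sym size≡) big)))
      (≈⇒≈[] (LinearSums.sumComp-*ˡ seriesRing (Θ n) (downFrom n) r _))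

    prodL-chain-weight : ∀ m a c →
      prodL (λ i → q (m ℕ.* i)) (chain d a c) ≈ q (m ℕ.* (a ℕ.* c ℕ.+ d ℕ.* tri c))
    prodL-chain-weight m a zero = 𝕊.trans (𝕊.sym q-0) (𝕊.reflexive (≡.cong q (≡.sym (begin
      m ℕ.* (a ℕ.* 0 ℕ.+ d ℕ.* 0)   ≡⟨ ≡.cong₂ (λ x y → m ℕ.* (x ℕ.+ y)) (ℕ.*-zeroʳ a) (ℕ.*-zeroʳ d) ⟩
      m ℕ.* 0                       ≡⟨ ℕ.*-zeroʳ m ⟩
      0                             ∎))))
      where open ≡.≡-Reasoning
    prodL-chain-weight m a (suc c) = 𝕊.trans
      (𝕊.reflexive (≡.cong (prodL _) (chain-∷ʳ d a c)))
      (𝕊.trans (prodL-++ _ (chain d a c) _) (𝕊.trans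
        (𝕊.*-cong (prodL-chain-weight m a c) (𝕊.*-identityʳ _))
        (𝕊.trans (𝕊.sym (q-+ _ _)) (𝕊.reflexive (≡.cong q (weight-suc m a c d (tri c)))))))

    prodL-taken-weight : ∀ m cs → prodL (λ i → q (m ℕ.* i)) (taken cs) ≈ weight m cs
    prodL-taken-weight m cs = 𝕊.trans (prodL-concatMap _ (λ (a , c) → chain d a c) cs)
      (𝕊.trans (prodL-cong cs (λ (a , c) → prodL-chain-weight m a c))
        (Num.prodL-weight m d cs))

    -- P_{(mʳ)} in the variables qˣ, x ∈ X, by Hall–Littlewood symmetrization.
    splitSum : ℕ → List ℕ → ℕ → Series
    splitSum m X r = sumSplit X r (λ I J → prodL (λ i → q (m ℕ.* i)) I * cross I J)

    splitSum-chains : ∀ m ℓ r {K} → (∀ a → suc (r ℕ.+ K) ℕ.≤ ℓ a) →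
      splitSum m (chains ℓ (downFrom n)) r ≈[ K ] chainSum m r
    splitSum-chains m ℓ r {K} ℓ≥ = trans[]
      (≈⇒≈[] (sumSplit-chains ℓ (downFrom n) r _
        (λ a → ℕ.≤-trans (ℕ.≤-trans (ℕ.m≤m+n r K) (ℕ.n≤1+n _)) (ℓ≥ a))
        (cross-vanish (λ i → q (m ℕ.* i)))))
      (sumComp-cong[] (downFrom n) r (λ cs eq size≡ → *-cong[]
        (≈⇒≈[] (prodL-taken-weight m cs))
        (cross≈square ℓ cs (filling n cs eq) n≤d size≡ ℓ≥)))

    pochT≈finPoch : ∀ k → pochT k ≈ finPoch d d k
    pochT≈finPoch k = prodL-cong (upTo k) (λ j → 𝕊.+-congˡ (𝕊.-‿cong
      (𝕊.trans (q-^ d (suc j)) (𝕊.reflexive (≡.cong q (ℕ.*-suc d j))))))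

    pochT≈poch∞ : ∀ {K k} → K ℕ.≤ k → pochT k ≈[ K ] poch∞ d d
    pochT≈poch∞ {k = k} K≤k = trans[] (≈⇒≈[] (pochT≈finPoch k)) (sym[] (poch∞≈finPoch d d d≢0 K≤k))

    Unit-pochT : ∀ k → Unit (pochT k)
    Unit-pochT k = Unit-cong (𝕊.sym (pochT≈finPoch k))
      (Unit-prodL (upTo k) (λ j → Unit-1-q (λ eq → d≢0 (ℕ.m+n≡0⇒m≡0 d eq))))

  -- With trivial weight the sum over splittings of `N` points is `(t;t)_N / ((t;t)_r (t;t)_(N-r))`
  -- for `t = q κ`, by comparing `weighted-sum` with `sum-arrangements`. Both hold for arbitrary
  -- distinct points, so chains of only `n` of the `κ` residues are admissible. For large `r` and
  -- `N - r` the quotient tends to `1 / (t;t)_∞`.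
  chainSum-0 : ∀ m n r {K} (n≢0 : n ≢ 0) (κ≢0 : m ℕ.+ n ≢ 0) → K ℕ.≤ r →
    Limit.chainSum (m ℕ.+ n) κ≢0 n (ℕ.m≤n+m n m) 0 r * poch∞ (m ℕ.+ n) (m ℕ.+ n) ≈[ K ] 1#
  chainSum-0 m zero r n≢0 _ _ = ⊥-elim (n≢0 ≡.refl)
  chainSum-0 m n@(suc n₀) r {K} _ κ≢0 K≤r = unit-cancel[] (pochT (N ∸ r)) (Unit-pochT (N ∸ r)) (trans[]
    (≈⇒≈[] (solve 3 (λ p a f → p :* (a :* f) := a :* (f :* p)) 𝕊.refl _ _ _))
    (trans[] (*-cong[] (sym[] (splitSum-chains 0 (λ _ → L) r (λ _ → ℕ.≤-refl)))
      (*-cong[] (sym[] (pochT≈poch∞ K≤r)) refl[]))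
    (trans[] (≈⇒≈[] (begin
      splitSum 0 X r * (pochT r * pochT (N ∸ r))
        ≈⟨ 𝕊.*-congʳ (sumSplit-cong X r (λ I J _ _ → 𝕊.*-congʳ (prodL-cong I (λ i → q-0)))) ⟩
      sumSplit X r (λ I J → prodL (λ _ → 1#) I * cross I J) * (pochT r * pochT (N ∸ r))
        ≈⟨ weighted-sum (λ _ → 1#) (λ _ → 1#) X r uX
             (ℕ.≤-trans (ℕ.m≤m+n r K) (ℕ.<⇒≤ L≤N)) (λ I J _ _ → 𝕊.sym (prodL-1 I)) ⟨
      (1# - q κ) ^ N * sumL (λ e → 1# * arrangement e) (perms X)
        ≈⟨ 𝕊.*-congˡ (sumL-cong (perms X) (λ e → 𝕊.*-identityˡ _)) ⟩
      (1# - q κ) ^ N * sumL arrangement (perms X)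
        ≈⟨ sum-arrangements X uX ⟩
      pochT N
        ≈⟨ 𝕊.*-identityʳ _ ⟨
      pochT N * 1# ∎))
      (*-cong[] (trans[] (pochT≈poch∞ K≤N) (sym[] (pochT≈poch∞ K≤N∸r))) refl[]))))
    where
    open ≈-Reasoning
    κ = m ℕ.+ n
    L = suc (r ℕ.+ K)
    open Limit κ κ≢0 n (ℕ.m≤n+m n m)
    open HallLittlewood (q κ)
    X = ChainSums.chains seriesRing κ (λ _ → L) (downFrom n)
    uX : Unique X
    uX = chains-Unique m n L
    N = length X
    length-chain : ∀ d a ℓ → length (chain d a ℓ) ≡ ℓ
    length-chain d a zero = ≡.refl
    length-chain d a (suc ℓ) = ≡.cong suc (length-chain d (a ℕ.+ d) ℓ)
    L≤N : L ℕ.≤ N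
    L≤N = ℕ.≤-trans (ℕ.≤-trans (ℕ.≤-reflexive (≡.sym (length-chain κ n₀ L))) (ℕ.m≤m+n _ _))
      (ℕ.≤-reflexive (≡.sym (List.length-++ (chain κ n₀ L))))
    K≤N∸r : K ℕ.≤ N ∸ r
    K≤N∸r = ℕ.m+n≤o⇒m≤o∸n K (ℕ.≤-trans (ℕ.≤-reflexive (ℕ.+-comm K r)) (ℕ.<⇒≤ L≤N))
    K≤N : K ℕ.≤ N
    K≤N = ℕ.≤-trans K≤N∸r (ℕ.m∸n≤m N r)

  -- Division of `N` by `n` arranges an interval of any length into chains with at least `N / n`
  -- entries; the summand ignores the order of the points.
  splitSum-upTo : ∀ m n (n≢0 : n ≢ 0) r {K} N → suc (r ℕ.+ K) ℕ.* n ℕ.≤ N →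
    let open Limit n n≢0 n ℕ.≤-refl in splitSum m (upTo N) r ≈[ K ] chainSum m r
  splitSum-upTo m n n≢0 r {K} N M≤N = trans[]
    (≈⇒≈[] (sumSplit-↭ r
      (λ p p′ → 𝕊.*-cong (prodL-↭ _ p) (HallLittlewood.cross-↭ (q n) p p′))
      (↭-trans (↭-reflexive (≡.cong upTo N≡)) (↭-sym (chains-↭-upTo n L s (m%n≤n N n))))))
    (splitSum-chains m (chainLength L s) r (λ a → ℕ.≤-trans K<L (L≤chainLength L s a)))
    where
    instance
      n-nonZero : ℕ.NonZero n
      n-nonZero = ℕ.≢-nonZero n≢0
    open Limit n n≢0 n ℕ.≤-refl
    L = N / n
    s = N % n
    N≡ : N ≡ L ℕ.* n ℕ.+ s
    N≡ = ≡.trans (m≡m%n+[m/n]*n N n) (ℕ.+-comm s (L ℕ.* n))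
    K<L : suc (r ℕ.+ K) ℕ.≤ L
    K<L = ℕ.≤-trans (ℕ.≤-reflexive (≡.sym (m*n/n≡m (suc (r ℕ.+ K)) n))) (/-monoˡ-≤ n M≤N)

  -- The Hall–Littlewood polynomial of a rectangle

  pairs-cong : ∀ {f g : ℕ × ℕ → Series} e → Unique e →
    (∀ {a b} → a ≢ b → f (a , b) ≈ g (a , b)) → prodL f (pairs e) ≈ prodL g (pairs e)
  pairs-cong [] _ h = 𝕊.refl
  pairs-cong {f} {g} (x ∷ e) (x∉e ∷ u) h = begin
    prodL f (map (x ,_) e ++ pairs e)
      ≈⟨ 𝕊.trans (prodL-++ f (map (x ,_) e) (pairs e)) (𝕊.*-congʳ (𝕊.reflexive (prodL-map f (x ,_) e))) ⟩
    prodL (λ y → f (x , y)) e * prodL f (pairs e)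
      ≈⟨ 𝕊.*-cong (prodL-cong∈ e (λ y y∈ → h (All.lookup x∉e y∈))) (pairs-cong e u h) ⟩
    prodL (λ y → g (x , y)) e * prodL g (pairs e)
      ≈⟨ 𝕊.trans (prodL-++ g (map (x ,_) e) (pairs e)) (𝕊.*-congʳ (𝕊.reflexive (prodL-map g (x ,_) e))) ⟨
    prodL g (map (x ,_) e ++ pairs e) ∎
    where open ≈-Reasoning

  count-replicate-≢ : ∀ {i x} k xs → x ≢ i → count i (replicate k x ++ xs) ≡ count i xs
  count-replicate-≢ zero xs _ = ≡.refl
  count-replicate-≢ {i} {x} (suc k) xs x≢i with x ℕ.≡ᵇ i in eq
  ... | true = ⊥-elim (x≢i (ℕ.≡ᵇ⇒≡ x i (≡.subst T (≡.sym eq) _)))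
  ... | false = count-replicate-≢ k xs x≢i

  count-replicate : ∀ x k xs → count x (replicate k x ++ xs) ≡ k ℕ.+ count x xs
  count-replicate x zero xs = ≡.refl
  count-replicate x (suc k) xs with x ℕ.≡ᵇ x in eq
  ... | true = ≡.cong suc (count-replicate x k xs)
  ... | false = ⊥-elim (≡.subst T eq (ℕ.≡⇒≡ᵇ x x ≡.refl))

  maxPart-rectangle : ∀ m r k → maxPart (replicate (suc r) m ++ replicate k 0) ≡ m
  maxPart-rectangle m zero k = ≡.trans (≡.cong (m ℕ.⊔_) (zeros k)) (ℕ.⊔-identityʳ m)
    where
    zeros : ∀ k → maxPart (replicate k 0) ≡ 0
    zeros zero = ≡.refl
    zeros (suc k) = zeros k
  maxPart-rectangle m (suc r) k = ≡.trans (≡.cong (m ℕ.⊔_) (maxPart-rectangle m r k)) (ℕ.⊔-idem m)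

  sum-rectangle : ∀ m k I J → sum (zipWith ℕ._*_ (replicate (length I) m ++ replicate k 0) (I ++ J)) ≡ m ℕ.* sum I
  sum-rectangle m k [] J = ≡.trans (zeros k J) (≡.sym (ℕ.*-zeroʳ m))
    where
    zeros : ∀ k J → sum (zipWith ℕ._*_ (replicate k 0) J) ≡ 0
    zeros zero J = ≡.refl
    zeros (suc k) [] = ≡.refl
    zeros (suc k) (j ∷ J) = zeros k J
  sum-rectangle m k (i ∷ I) J = ≡.trans (≡.cong (m ℕ.* i ℕ.+_) (sum-rectangle m k I J))
    (≡.sym (ℕ.*-distribˡ-+ m i (sum I)))

  prodL-q : ∀ m I → prodL (λ i → q (m ℕ.* i)) I ≈ q (m ℕ.* sum I)
  prodL-q m [] = 𝕊.trans (𝕊.sym q-0) (𝕊.reflexive (≡.cong q (≡.sym (ℕ.*-zeroʳ m))))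
  prodL-q m (i ∷ I) = 𝕊.trans (𝕊.*-congˡ (prodL-q m I)) (𝕊.trans (𝕊.sym (q-+ _ _))
    (𝕊.reflexive (≡.cong q (≡.sym (ℕ.*-distribˡ-+ m i (sum I))))))

  module Rectangle (m₀ n : ℕ) (n≢0 : n ≢ 0) (r₀ N : ℕ) (r≤N : suc r₀ ℕ.≤ N) where
    private
      m = suc m₀
      r = suc r₀
      s = 1# - q n
    open Limit n n≢0 n ℕ.≤-refl using (splitSum; Unit-pochT)
    open HallLittlewood (q n)
    open RightHandSide n n≢0 using (⟦powPS⟧; Unit-^)

    shape : List ℕ
    shape = replicate r m ++ replicate (N ∸ r) 0

    Unit-s^ : ∀ k → Unit (s ^ k)
    Unit-s^ k = Unit-^ k (Unit-1-q n≢0)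

    factor : ℕ → Series
    factor c = ⟦ tPoch n c ⊗ inv (oneMinusTPow n c) ⟧

    s^*factor : ∀ c → s ^ c * factor c ≈ pochT c
    s^*factor c = begin
      s ^ c * factor c
        ≈⟨ 𝕊.*-congˡ (𝕊.trans (⟦⊗⟧ _ _) (𝕊.*-cong
             (𝕊.trans (⟦prodPS⟧ _ (upTo c)) (prodL-cong (upTo c) (λ j → 𝕊.trans (⟦1⊖mono⟧ _)
               (𝕊.+-congˡ (𝕊.-‿cong (𝕊.sym (q-^ n (suc j))))))))
             (⟦inv⟧≈ _ (Unit-coeff (Unit-cong (𝕊.sym denominator) (Unit-s^ c))) denominator))) ⟩
      s ^ c * (pochT c * inverse (s ^ c))
        ≈⟨ solve 3 (λ s p i → s :* (p :* i) := p :* (s :* i)) 𝕊.refl _ _ _ ⟩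
      pochT c * (s ^ c * inverse (s ^ c))
        ≈⟨ 𝕊.trans (𝕊.*-congˡ (*-inverse _ (Unit-s^ c))) (𝕊.*-identityʳ _) ⟩
      pochT c ∎
      where
      open ≈-Reasoning
      denominator : ⟦ oneMinusTPow n c ⟧ ≈ s ^ c
      denominator = 𝕊.trans (⟦powPS⟧ _ c) (^-cong c (⟦1⊖mono⟧ n))
        where
        ^-cong : ∀ {x y} k → x ≈ y → x ^ k ≈ y ^ k
        ^-cong zero _ = 𝕊.refl
        ^-cong (suc k) eq = 𝕊.*-cong eq (^-cong k eq)

    ⟦vLam⟧ : ⟦ vLam n shape ⟧ ≈ factor (N ∸ r) * factor r
    ⟦vLam⟧ = begin
      ⟦ vLam n shape ⟧
        ≈⟨ ⟦prodPS⟧ _ (upTo (suc (maxPart shape))) ⟩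
      prodL multiplicity (upTo (suc (maxPart shape)))
        ≡⟨ ≡.cong (λ k → prodL multiplicity (upTo (suc k))) (maxPart-rectangle m r₀ (N ∸ r)) ⟩
      prodL multiplicity (upTo (suc (suc m₀)))
        ≈⟨ prod-upTo-suc multiplicity (suc m₀) ⟩
      prodL multiplicity (upTo (suc m₀)) * multiplicity m
        ≈⟨ 𝕊.*-cong (𝕊.*-cong (𝕊.reflexive (≡.cong factor count-0))
             (𝕊.trans (𝕊.reflexive (≡.trans (≡.cong (prodL multiplicity) (≡.sym (List.map-upTo suc m₀)))
                 (prodL-map multiplicity suc (upTo m₀))))
               (𝕊.trans (prodL-cong∈ (upTo m₀) (λ i i∈ → 𝕊.trans
                 (𝕊.reflexive (≡.cong factor (count-between i (∈-upTo⁻ i∈)))) factor-0)) (prodL-1 (upTo m₀)))))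
             (𝕊.reflexive (≡.cong factor count-m)) ⟩
      (factor (N ∸ r) * 1#) * factor r
        ≈⟨ 𝕊.*-congʳ (𝕊.*-identityʳ _) ⟩
      factor (N ∸ r) * factor r ∎
      where
      open ≈-Reasoning
      multiplicity : ℕ → Series
      multiplicity i = factor (count i shape)
      append-[] : ∀ i → count i shape ≡ count i (replicate r m ++ (replicate (N ∸ r) 0 ++ []))
      append-[] i = ≡.cong (λ z → count i (replicate r m ++ z)) (≡.sym (List.++-identityʳ _))
      count-0 : count 0 shape ≡ N ∸ r
      count-0 = ≡.trans (append-[] 0) (≡.trans (count-replicate-≢ {0} {m} r (replicate (N ∸ r) 0 ++ []) (λ ()))
        (≡.trans (count-replicate 0 (N ∸ r) []) (ℕ.+-identityʳ _)))
      count-m : count m shape ≡ r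
      count-m = ≡.trans (append-[] m) (≡.trans (count-replicate m r _)
        (≡.trans (≡.cong (r ℕ.+_) (count-replicate-≢ (N ∸ r) [] (λ ()))) (ℕ.+-identityʳ r)))
      count-between : ∀ i → i ℕ.< m₀ → count (suc i) shape ≡ 0
      count-between i i<m₀ = ≡.trans (append-[] (suc i)) (≡.trans
        (count-replicate-≢ r _ (λ eq → ℕ.<-irrefl (≡.sym (ℕ.suc-injective eq)) i<m₀))
        (count-replicate-≢ (N ∸ r) [] (λ ())))
      factor-0 : factor 0 ≈ 1#
      factor-0 = 𝕊.trans (𝕊.sym (𝕊.*-identityˡ _)) (s^*factor 0)

    -- The only parts are 0 and `m`, with multiplicities `N - r` and `r`; every part size in between
    -- contributes 1 to `vLam`.
    normalization : s ^ N * ⟦ vLam n shape ⟧ ≈ pochT r * pochT (N ∸ r)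
    normalization = begin
      s ^ N * ⟦ vLam n shape ⟧
        ≈⟨ 𝕊.*-cong (𝕊.trans (𝕊.reflexive (≡.cong (s ^_) (≡.sym (ℕ.m+[n∸m]≡n r≤N))))
             (^-homo-* s r (N ∸ r))) ⟦vLam⟧ ⟩
      (s ^ r * s ^ (N ∸ r)) * (factor (N ∸ r) * factor r)
        ≈⟨ solve 4 (λ a b c e → (a :* b) :* (c :* e) := (a :* e) :* (b :* c)) 𝕊.refl _ _ _ _ ⟩
      (s ^ r * factor r) * (s ^ (N ∸ r) * factor (N ∸ r))
        ≈⟨ 𝕊.*-cong (s^*factor r) (s^*factor (N ∸ r)) ⟩
      pochT r * pochT (N ∸ r) ∎
      where open ≈-Reasoning

    exponentWeight : List ℕ → Series
    exponentWeight e = q (sum (zipWith ℕ._*_ shape e))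

    ⟦hlTerm⟧ : ∀ e → Unique e → ⟦ hlTerm n shape e ⟧ ≈ exponentWeight e * arrangement e
    ⟦hlTerm⟧ e u = 𝕊.trans (⟦⊗⟧ _ _) (𝕊.*-cong (𝕊.reflexive (⟦mono⟧ _))
      (𝕊.trans (⟦prodPS⟧ _ (pairs e)) (pairs-cong e u (ratio≈ratioG n))))

    symmetrization : s ^ N * ⟦ sumPS (map (hlTerm n shape) (perms (upTo N))) ⟧ ≈
      splitSum m (upTo N) r * (pochT r * pochT (N ∸ r))
    symmetrization = begin
      s ^ N * ⟦ sumPS (map (hlTerm n shape) (perms (upTo N))) ⟧
        ≈⟨ 𝕊.*-congˡ (𝕊.trans (⟦sumPS⟧ _ (perms (upTo N))) (perms-cong (upTo N) (λ e e↭ →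
             ⟦hlTerm⟧ e (Unique-resp-↭ (↭-sym e↭) (Unique.upTo⁺ N))))) ⟩
      s ^ N * sumL (λ e → exponentWeight e * arrangement e) (perms (upTo N))
        ≡⟨ ≡.cong (λ k → s ^ k * sumL (λ e → exponentWeight e * arrangement e) (perms (upTo N)))
             (≡.sym (List.length-upTo N)) ⟩
      s ^ length (upTo N) * sumL (λ e → exponentWeight e * arrangement e) (perms (upTo N))
        ≈⟨ weighted-sum (λ i → q (m ℕ.* i)) exponentWeight (upTo N) r (Unique.upTo⁺ N)
             (ℕ.≤-trans r≤N (ℕ.≤-reflexive (≡.sym (List.length-upTo N)))) weight-first ⟩
      splitSum m (upTo N) r * (pochT r * pochT (length (upTo N) ∸ r))
        ≡⟨ ≡.cong (λ k → splitSum m (upTo N) r * (pochT r * pochT (k ∸ r))) (List.length-upTo N) ⟩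
      splitSum m (upTo N) r * (pochT r * pochT (N ∸ r)) ∎
      where
      open ≈-Reasoning
      weight-first : ∀ I J → I ++ J ↭ upTo N → length I ≡ r →
        exponentWeight (I ++ J) ≈ prodL (λ i → q (m ℕ.* i)) I
      weight-first I J _ len = 𝕊.trans (𝕊.reflexive (≡.cong q (≡.trans
        (≡.cong (λ k → sum (zipWith ℕ._*_ (replicate k m ++ replicate (N ∸ r) 0) (I ++ J))) (≡.sym len))
        (sum-rectangle m (N ∸ r) I J)))) (𝕊.sym (prodL-q m I))

    hlP-unfold : hlP (replicate r m) N n ≡
      inv (vLam n shape) ⊗ sumPS (map (hlTerm n shape) (perms (upTo N)))
    hlP-unfold rewrite List.length-replicate r₀ {m} with r ℕ.≤ᵇ N in eq
    ... | true = ≡.refl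
    ... | false = ⊥-elim (≡.subst T eq (ℕ.≤⇒≤ᵇ r≤N))

    -- `normalization` and `symmetrization` carry the same factors `s ^ N` and
    -- `pochT r * pochT (N ∸ r)`, which therefore drop out of the polynomial.
    hlP≈splitSum : ⟦ hlP (replicate r m) N n ⟧ ≈ splitSum m (upTo N) r
    hlP≈splitSum = unit-cancel (pochT r * pochT (N ∸ r)) (Unit-* (Unit-pochT r) (Unit-pochT (N ∸ r))) (begin
      (pochT r * pochT (N ∸ r)) * ⟦ hlP (replicate r m) N n ⟧
        ≈⟨ 𝕊.*-cong (𝕊.sym normalization) (𝕊.trans (𝕊.reflexive (≡.cong ⟦_⟧ hlP-unfold)) (⟦⊗⟧ _ _)) ⟩
      (s ^ N * V) * (⟦ inv (vLam n shape) ⟧ * S)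
        ≈⟨ 𝕊.*-congˡ (𝕊.*-congʳ (⟦inv⟧≈ (vLam n shape) (Unit-coeff Unit-V) 𝕊.refl)) ⟩
      (s ^ N * V) * (inverse V * S)
        ≈⟨ solve 4 (λ p v i t → (p :* v) :* (i :* t) := (v :* i) :* (p :* t)) 𝕊.refl _ _ _ _ ⟩
      (V * inverse V) * (s ^ N * S)
        ≈⟨ 𝕊.*-cong (*-inverse V Unit-V) symmetrization ⟩
      1# * (splitSum m (upTo N) r * (pochT r * pochT (N ∸ r)))
        ≈⟨ 𝕊.trans (𝕊.*-identityˡ _) (𝕊.*-comm _ _) ⟩
      (pochT r * pochT (N ∸ r)) * splitSum m (upTo N) r ∎)
      where
      open ≈-Reasoning
      V = ⟦ vLam n shape ⟧
      S = ⟦ sumPS (map (hlTerm n shape) (perms (upTo N))) ⟧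
      Unit-factor : ∀ c → Unit (factor c)
      Unit-factor c = Unit-cong (unit-cancel (s ^ c) (Unit-s^ c) (begin
        s ^ c * (inverse (s ^ c) * pochT c)   ≈⟨ 𝕊.*-assoc _ _ _ ⟨
        (s ^ c * inverse (s ^ c)) * pochT c   ≈⟨ 𝕊.trans (𝕊.*-congʳ (*-inverse _ (Unit-s^ c))) (𝕊.*-identityˡ _) ⟩
        pochT c                               ≈⟨ s^*factor c ⟨
        s ^ c * factor c                      ∎))
        (Unit-* (Unit-inverse (Unit-s^ c)) (Unit-pochT c))
      Unit-V : Unit V
      Unit-V = Unit-cong (𝕊.sym ⟦vLam⟧) (Unit-* (Unit-factor (N ∸ r)) (Unit-factor r))

  -- Assembly of the coefficientwise limit

  tri≡C2 : ∀ r → tri r ≡ r C 2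
  tri≡C2 zero = ≡.refl
  tri≡C2 (suc r) = ≡.trans (ℕ.+-comm (tri r) r)
    (≡.trans (≡.cong₂ ℕ._+_ (≡.sym (nC1≡n r)) (tri≡C2 r)) (nCk+nC[k+1]≡[n+1]C[k+1] r 1))

  -- In the bound on `r`, the product with `n` forces a long chain whenever there is a short one,
  -- and `suc K` makes `(t;t)_r` converge to the precision `K` and `r` positive. In the bound on
  -- `N`, the product makes all residue chains long enough for the precision `m * tri r + K`, and
  -- the summand `r` leaves room for the rectangle.
  rectangular-limit : ∀ m n K r N → m ≢ 0 → n ≢ 0 → n ℕ.* suc (suc (K ℕ.+ K)) ℕ.+ suc K ℕ.≤ r →
    suc (r ℕ.+ (m ℕ.* tri r ℕ.+ K)) ℕ.* n ℕ.+ r ℕ.≤ N →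
    ⟦ hlP (replicate r m) N n ⟧ ≈[ m ℕ.* tri r ℕ.+ K ] q (m ℕ.* tri r) * ⟦ rhsSeries (m ℕ.+ n) n ⟧
  rectangular-limit zero n K r N m≢0 _ _ _ = ⊥-elim (m≢0 ≡.refl)
  rectangular-limit m n K zero N _ _ R≤r _ = ⊥-elim (ℕ.1+n≰n (ℕ.≤-trans (s≤s z≤n)
    (ℕ.≤-trans (ℕ.m≤n+m (suc K) (n ℕ.* suc (suc (K ℕ.+ K)))) R≤r)))
  rectangular-limit m@(suc m₀) n K r@(suc r₀) N m≢0 n≢0 R≤r M≤N =
    -- `E ^ n` is `Θ n` at step `n`, so it turns the first chain sum into a numerator. By duality
    -- this is `q s` times the numerator at step `κ`, which tends to `Θ n` at step `κ` times the
    -- second chain sum; `φ` cancels that chain sum, and `rhs-Θ` recognizes what is left.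
    unit-cancel[] (φ * E ^ n) (Unit-* Unit-φ (Unit-^ n Unit-E)) (
      trans[] (*-cong[] refl[] (trans[] (≈⇒≈[] (Rectangle.hlP≈splitSum m₀ n n≢0 r₀ N r≤N))
        (splitSum-upTo m n n≢0 r N (ℕ.≤-trans (ℕ.m≤m+n _ r) M≤N))))
      (trans[] (≈⇒≈[] (𝕊.trans
        (solve 3 (λ f e a → (f :* e) :* a := f :* (e :* a)) 𝕊.refl φ (E ^ n) (A.chainSum m r))
        (𝕊.*-congˡ (𝕊.*-congʳ (𝕊.sym (Products.Θ-full n))))))
      (trans[] (*-cong[] refl[] (sym[] (A.numerator-limit m s r big (λ cs f size≡ →
        ℕ.*-monoʳ-≤ m (≡.subst (λ k → tri k ℕ.≤ moment cs ℕ.+ n ℕ.* tris cs) size≡ (tri-size-≤ f))))))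
      (trans[] (≈⇒≈[] (𝕊.trans (𝕊.*-congˡ (Numerator.numerator-duality seriesRing seriesPoints n m r))
        (solve 3 (λ f x b → f :* (x :* b) := x :* (b :* f)) 𝕊.refl φ (q s) (B.num))))
      (trans[] (q-*-cong[] s (trans[]
        (*-cong[] (B.numerator-limit 0 0 r big (λ _ _ _ → z≤n)) refl[])
        (trans[] (≈⇒≈[] (𝕊.*-assoc _ _ _)) (*-cong[] refl[] (chainSum-0 m n r n≢0 κ≢0 K≤r)))))
      (≈⇒≈[] (𝕊.trans (𝕊.*-congˡ (𝕊.trans (𝕊.*-identityʳ _) (𝕊.sym (rhs-Θ n n≢0))))
        (solve 3 (λ x u h → x :* (u :* h) := u :* (x :* h)) 𝕊.refl _ _ _))))))))
    where
    κ = m ℕ.+ n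
    s = m ℕ.* tri r
    κ≢0 : κ ≢ 0
    κ≢0 ()
    module A = Limit n n≢0 n ℕ.≤-refl
    module B where
      open Limit κ κ≢0 n (ℕ.m≤n+m n m) public
      num = Numerator.numerator seriesRing seriesPoints n κ (ℕ.m≤n+m n m) 0 r
    open RightHandSide κ κ≢0
    big : n ℕ.* suc (suc (K ℕ.+ K)) ℕ.≤ r
    big = ℕ.≤-trans (ℕ.m≤m+n _ _) R≤r
    K≤r : K ℕ.≤ r
    K≤r = ℕ.≤-trans (ℕ.n≤1+n K) (ℕ.≤-trans (ℕ.m≤n+m _ _) R≤r)
    r≤N : r ℕ.≤ N
    r≤N = ℕ.≤-trans (ℕ.m≤n+m r _) M≤N

  shiftCoeff-limit : ∀ s K {f g} → ⟦ f ⟧ ≈[ s ℕ.+ K ] q s * ⟦ g ⟧ →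
    ∀ k → k ℤ.< ℤ.+ K → shiftCoeff s f k ≡ coeffℤ g k
  shiftCoeff-limit s K {f} {g} eq (ℤ.+ k) (ℤ.+<+ k<K) = begin
    f (k ℕ.+ s)                            ≡⟨ ≡.cong f (ℕ.+-comm k s) ⟩
    f (s ℕ.+ k)                            ≡⟨ coeff-⟦⟧ f (s ℕ.+ k) ⟨
    coeff ⟦ f ⟧ (s ℕ.+ k)                  ≡⟨ coeff-≈[] eq (s ℕ.+ k) (ℕ.+-monoʳ-< s k<K) ⟩
    coeff (q s * ⟦ g ⟧) (s ℕ.+ k)          ≡⟨ coeff-q-≥ s ⟦ g ⟧ k ⟩
    coeff ⟦ g ⟧ k                          ≡⟨ coeff-⟦⟧ g k ⟩
    g k                                    ∎
    where open ≡.≡-Reasoning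
  -- A negative exponent `k` must give 0. Either `k + s` is still negative and `coeffℤ` returns 0,
  -- or it is an index below `s`, where the factor `q s` leaves no coefficient.
  shiftCoeff-limit s K {f} {g} eq ℤ.-[1+ j ] _ with s ℕ.≤? j
  ... | yes s≤j = ≡.cong (coeffℤ f) (≡.trans (ℤ.⊖-< (s≤s s≤j))
    (≡.cong (λ x → ℤ.- (ℤ.+ x)) (ℕ.+-∸-assoc 1 s≤j)))
  ... | no s≰j = begin
    coeffℤ f (s ℤ.⊖ suc j)                 ≡⟨ ≡.cong (coeffℤ f) (ℤ.⊖-≥ (ℕ.≰⇒> s≰j)) ⟩
    f (s ∸ suc j)                          ≡⟨ coeff-⟦⟧ f (s ∸ suc j) ⟨
    coeff ⟦ f ⟧ (s ∸ suc j)                ≡⟨ coeff-≈[] eq (s ∸ suc j) (ℕ.<-≤-trans below (ℕ.m≤m+n s K)) ⟩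
    coeff (q s * ⟦ g ⟧) (s ∸ suc j)        ≡⟨ coeff-q-< ⟦ g ⟧ below ⟩
    ℤ.0ℤ                                   ∎
    where
    open ≡.≡-Reasoning
    below : s ∸ suc j ℕ.< s
    below = ℕ.∸-monoʳ-< {s} {suc j} {0} (s≤s z≤n) (ℕ.≰⇒> s≰j)

  limit-coefficient : ∀ m n → m ≢ 0 → n ≢ 0 → (k : ℤ) →
    ∃[ R ] ((r : ℕ) → R ℕ.≤ r → ∃[ M ] ((N : ℕ) → M ℕ.≤ N →
      shiftCoeff (m ℕ.* (r C 2)) (hlP (replicate r m) N n) k ≡ coeffℤ (rhsSeries (m ℕ.+ n) n) k))
  limit-coefficient m n m≢0 n≢0 k =
    n ℕ.* suc (suc (K ℕ.+ K)) ℕ.+ suc K , λ r R≤r →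
    suc (r ℕ.+ (m ℕ.* tri r ℕ.+ K)) ℕ.* n ℕ.+ r , λ N M≤N →
    ≡.subst (λ c → shiftCoeff (m ℕ.* c) (hlP (replicate r m) N n) k ≡ _) (tri≡C2 r)
      (shiftCoeff-limit (m ℕ.* tri r) K (rectangular-limit m n K r N m≢0 n≢0 R≤r M≤N) k
        (below k))
    where
    K = suc ℤ.∣ k ∣
    below : ∀ k → k ℤ.< ℤ.+ suc ℤ.∣ k ∣
    below (ℤ.+ k) = ℤ.+<+ ℕ.≤-refl
    below ℤ.-[1+ k ] = ℤ.-<+

  rhs-coefficient : ∀ m n → m ≢ 0 → n ≢ 0 → ∀ k →
    coeffℤ (rhsSeries (m ℕ.+ n) n) k ≡ coeffℤ (rhsSeries (m ℕ.+ n) m) k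
  rhs-coefficient m n m≢0 n≢0 (ℤ.+ k) = ≡.trans (≡.sym (coeff-⟦⟧ (rhsSeries (m ℕ.+ n) n) k))
    (≡.trans (coeff-≈[] (≈⇒≈[] (rhs-duality m n m≢0 n≢0)) k ℕ.≤-refl)
      (coeff-⟦⟧ (rhsSeries (m ℕ.+ n) m) k))
  rhs-coefficient m n m≢0 n≢0 ℤ.-[1+ k ] = ≡.refl

open PrincipalSpecialization using (limit-coefficient; rhs-coefficient)
open import Data.Nat using (_≤_; _+_; _*_)

theorem1p5 : (m n : ℕ) → 1 ≤ m → 1 ≤ n →
    ((k : ℤ) → ∃[ R ] ((r : ℕ) → R ≤ r → ∃[ M ] ((N : ℕ) → M ≤ N →
    shiftCoeff (m * (r C 2)) (hlP (replicate r m) N n) k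
    ≡ coeffℤ (rhsSeries (m + n) n) k)))
    ×
    ((k : ℤ) → ∃[ R ] ((r : ℕ) → R ≤ r → ∃[ M ] ((N : ℕ) → M ≤ N →
    shiftCoeff (m * (r C 2)) (hlP (replicate r m) N n) k
    ≡ coeffℤ (rhsSeries (m + n) m) k)))
theorem1p5 m n 1≤m 1≤n = limit-coefficient m n m≢0 n≢0 , λ k →
  let R , limit = limit-coefficient m n m≢0 n≢0 k in
  R , λ r R≤r → let M , limit′ = limit r R≤r in
  M , λ N M≤N → ≡.trans (limit′ N M≤N) (rhs-coefficient m n m≢0 n≢0 k)
  where
  m≢0 = ℕ.m<n⇒n≢0 1≤m
  n≢0 = ℕ.m<n⇒n≢0 1≤n
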